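{- Define $\Lambda:\mathcal H_{\mathbf T}\to\mathbf{WQSym}$ on a topology $\mathcal T$ on $[n]$ by $\Lambda(\mathcal T)=\sum_{f\in\mathcal L_{\mathcal T}(Z)}f(1)\cdots f(n)$, where $Z$ is an infinite totally ordered alphabet of noncommuting variables and $\mathbf{WQSym}(Z)$ is identified with $\mathbf{WQSym}$; equivalently $\Lambda(\mathcal T)=\sum_w M_w$ over all packed words $w=w_1\cdots w_n$ such that $i<_{\mathcal T}j\Rightarrow w_i<w_j$ and $i\sim_{\mathcal T}j\Rightarrow w_i=w_j$. Then $\Lambda$ is a Hopf algebra morphism from $(\mathcal H_{\mathbf T},\cdot,\Delta)$ to $(\mathbf{WQSym},\cdot,\Delta)$, and it is compatible with the internal coproducts: $(\Lambda\otimes\Lambda)\circ\Gamma=\rho\circ\Lambda$.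
   Context: For a topology $\mathcal T$ on a finite set $X$: $x\le_{\mathcal T}y$ iff every open set containing $x$ contains $y$ (open sets = final segments); $x\sim_{\mathcal T}y$ iff $x\le_{\mathcal T}y\le_{\mathcal T}x$; $x<_{\mathcal T}y$ iff $x\le_{\mathcal T}y$ and not $y\le_{\mathcal T}x$; $\mathcal T|_Y=\{W\cap Y:W\in\mathcal T\}$; $Y$ is $\mathcal T$-connected if $(Y,\mathcal T|_Y)$ is connected. $\mathcal L_{\mathcal T}(Z)$ is the set of maps $f:[n]\to Z$ with $i<_{\mathcal T}j\Rightarrow f(i)<f(j)$ and $i\sim_{\mathcal T}j\Rightarrow f(i)=f(j)$. $\mathcal H_{\mathbf T}$ is the graded vector space with basis all topologies on $[n]=\{1,\dots,n\}$, $n\ge0$. Product: for $\mathcal T$ on $[n]$, $\mathcal T'$ on $[n']$, $\mathcal T\cdot\mathcal T'$ is the topology on $[n+n']$ whose open sets are $Y\sqcup(Y'+n)$, $Y\in\mathcal T$, $Y'\in\mathcal T'$. For a totally ordered finite set $E$ with $|E|=m$, $\mathrm{Std}$ transports structures along the increasing bijection $E\to[m]$. Coproduct: $\Delta(\mathcal T)=\sum_{Y\in\mathcal T}\mathrm{Std}(\mathcal T|_{[n]\setminus Y})\otimes\mathrm{Std}(\mathcal T|_Y)$. Internal coproduct on each homogeneous component: $\Gamma(\mathcal T)=\sum\mathcal T'\otimes\mathcal T/\mathcal T'$ over $\mathcal T$-admissible topologies $\mathcal T'$ on $[n]$, where $\mathcal T'\prec\mathcal T$ means every $\mathcal T$-open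 set is $\mathcal T'$-open, $\mathcal T/\mathcal T'$ is the topology on $[n]$ with quasi-order the transitive closure of $x\,\mathcal R\,y\iff(x\le_{\mathcal T}y\text{ or }y\le_{\mathcal T'}x)$, and $\mathcal T'$ is $\mathcal T$-admissible if $\mathcal T'\prec\mathcal T$, $\mathcal T'|_Y=\mathcal T|_Y$ for every $\mathcal T'$-connected $Y$, and $x\sim_{\mathcal T/\mathcal T'}y\iff x\sim_{\mathcal T'/\mathcal T'}y$. $\mathbf{WQSym}$: a packed word is a surjection $w:[k]\to[\max w]$, written $w_1\cdots w_k$; basis $M_w$, realized as $M_w(Z)=\sum X_1\cdots X_k$ over words in $Z$ whose packing (replace letters by their rank among the letters occurring) is $w$. For $i_1,\dots,i_p\ge0$, $\mathrm{QSh}(i_1,\dots,i_p)$ is the set of surjections $u:[i_1+\dots+i_p]\to[\max u]$ strictly increasing on each consecutive block of sizes $i_1,\dots,i_p$. Product: $M_uM_v=\sum_{w\in\mathrm{QSh}(\max u,\max v)}M_{w\circ(u\,v[\max u])}$, where $v[m]$ adds $m$ to each letter of $v$ and $u\,v[m]$ is concatenation. Coproduct: $\Delta(M_w)=\sum_{k=0}^{\max w}M_{w|_{\{1,\dots,k\}}}\otimes M_{\mathrm{Pack}(w|_{\{k+1,\dots,\max w\}})}$, where $w|_I$ keeps the letters of $w$ in $I$. Internal coproduct: $\rho(M_u)=\sum_{i_1+\dots+i_p=\max u}\sum_{v\in\mathrm{QSh}(i_1,\dots,i_p)}M_{v\circ u}\otimes M_{(1^{i_1}2^{i_2}\cdots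 p^{i_p})\circ u}$, where $1^{i_1}\cdots p^{i_p}$ is the word with $i_1$ letters $1$, then $i_2$ letters $2$, etc., viewed as a map $[\max u]\to[p]$. -}

module Defs where

-- Conventions:
--  * [n] is modelled by Fin n (element i : Fin n stands for i+1), a subset of
--    [n] by a Bool-vector of length n, a "family of subsets" by a Bool-valued
--    predicate on subsets.  A topology on [n] is such a family satisfying the
--    topology axioms (IsTopology).
--  * A word is a List ℕ with letters ≥ 1; packed words are the basis M_w of WQSym.
--  * All structure constants involved are 0/1 sums of basis elements, so an
--    element of the free module is represented by the list of basis elements
--    (with multiplicity); equality of elements = permutation (_↭_) of lists.

open import Data.Bool using (Bool; true; false; _∧_; _∨_; not; if_then_else_)
open import Data.Nat using (ℕ; zero; suc; _+_; _∸_; _≡ᵇ_; _<ᵇ_; _≤ᵇ_; _⊔_)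
open import Data.Fin using (Fin)
open import Data.Vec as V using (Vec; []; _∷_)
open import Data.List as L using (List; []; _∷_; _++_; concatMap)
open import Data.Product using (Σ; _,_; _×_)
open import Data.Nat.ListAction using (sum)
open import Relation.Binary.PropositionalEquality using (_≡_)

filterᵇ : {A : Set} → (A → Bool) → List A → List A
filterᵇ p [] = []
filterᵇ p (x ∷ xs) = if p x then x ∷ filterᵇ p xs else filterᵇ p xs

allᵇ : {A : Set} → (A → Bool) → List A → Bool
allᵇ p [] = true
allᵇ p (x ∷ xs) = p x ∧ allᵇ p xs

anyᵇ : {A : Set} → (A → Bool) → List A → Bool
anyᵇ p [] = false
anyᵇ p (x ∷ xs) = p x ∨ anyᵇ p xs

eqB : Bool → Bool → Bool
eqB true b = b
eqB false b = not b

_⇒ᵇ_ : Bool → Bool → Bool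
a ⇒ᵇ b = not a ∨ b

range1 : ℕ → List ℕ
range1 m = L.map suc (L.upTo m)

Sub : ℕ → Set
Sub n = Vec Bool n

allSubs : (n : ℕ) → List (Sub n)
allSubs zero = [] ∷ []
allSubs (suc n) = concatMap (λ s → (false ∷ s) ∷ (true ∷ s) ∷ []) (allSubs n)

_∈ˢ_ : {n : ℕ} → Fin n → Sub n → Bool
x ∈ˢ Y = V.lookup Y x

_∩ˢ_ : {n : ℕ} → Sub n → Sub n → Sub n
_∩ˢ_ = V.zipWith _∧_

_∪ˢ_ : {n : ℕ} → Sub n → Sub n → Sub n
_∪ˢ_ = V.zipWith _∨_

∁ˢ : {n : ℕ} → Sub n → Sub n
∁ˢ = V.map not

∅ˢ : {n : ℕ} → Sub n
∅ˢ = V.replicate _ false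

fullˢ : {n : ℕ} → Sub n
fullˢ = V.replicate _ true

eqSub : {n : ℕ} → Sub n → Sub n → Bool
eqSub [] [] = true
eqSub (a ∷ A) (b ∷ B) = eqB a b ∧ eqSub A B

size : {n : ℕ} → Sub n → ℕ
size [] = 0
size (true ∷ Y) = suc (size Y)
size (false ∷ Y) = size Y

-- the increasing bijection [size Y] → Y, applied to subsets:
-- embed Y S is the image in [n] of S ⊆ [size Y]
embed : {n : ℕ} → (Y : Sub n) → Sub (size Y) → Sub n
embed [] S = []
embed (true ∷ Y) (b ∷ S) = b ∷ embed Y S
embed (false ∷ Y) S = false ∷ embed Y S

Fam : ℕ → Set
Fam n = Sub n → Bool

IsTopology : {n : ℕ} → Fam n → Set
IsTopology T =
  (T ∅ˢ ≡ true) × (T fullˢ ≡ true)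
  × (∀ A B → T A ≡ true → T B ≡ true → T (A ∪ˢ B) ≡ true)
  × (∀ A B → T A ≡ true → T B ≡ true → T (A ∩ˢ B) ≡ true)

isTopᵇ : {n : ℕ} → Fam n → Bool
isTopᵇ {n} T =
  T ∅ˢ ∧ T fullˢ
  ∧ allᵇ (λ A → allᵇ (λ B → (T A ∧ T B) ⇒ᵇ (T (A ∪ˢ B) ∧ T (A ∩ˢ B))) (allSubs n)) (allSubs n)

eqFam : {n : ℕ} → Fam n → Fam n → Bool
eqFam {n} F G = allᵇ (λ S → eqB (F S) (G S)) (allSubs n)

-- all families of subsets of [n] (each extensionally distinct one exactly once)
funs : {n : ℕ} → List (Sub n) → List (Fam n)
funs [] = (λ _ → false) ∷ []
funs (s ∷ ss) =
  concatMap (λ f → (λ x → if eqSub x s then false else f x)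
                 ∷ (λ x → if eqSub x s then true else f x) ∷ []) (funs ss)

allFams : (n : ℕ) → List (Fam n)
allFams n = funs (allSubs n)

leqᵀ : {n : ℕ} → Fam n → Fin n → Fin n → Bool
leqᵀ {n} T x y = allᵇ (λ Y → (T Y ∧ (x ∈ˢ Y)) ⇒ᵇ (y ∈ˢ Y)) (allSubs n)

simᵀ : {n : ℕ} → Fam n → Fin n → Fin n → Bool
simᵀ T x y = leqᵀ T x y ∧ leqᵀ T y x

ltᵀ : {n : ℕ} → Fam n → Fin n → Fin n → Bool
ltᵀ T x y = leqᵀ T x y ∧ not (leqᵀ T y x)

restrict : {n : ℕ} → Fam n → (Y : Sub n) → Fam (size Y)
restrict {n} T Y S = anyᵇ (λ W → T W ∧ eqSub (W ∩ˢ Y) (embed Y S)) (allSubs n)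

connectedᵇ : {m : ℕ} → Fam m → Bool
connectedᵇ {m} F =
  allᵇ (λ A → (F A ∧ F (∁ˢ A)) ⇒ᵇ (eqSub A ∅ˢ ∨ eqSub A fullˢ)) (allSubs m)

Rel : ℕ → Set
Rel n = Fin n → Fin n → Bool

fromQO : {n : ℕ} → Rel n → Fam n
fromQO {n} Q S =
  allᵇ (λ x → allᵇ (λ y → ((x ∈ˢ S) ∧ Q x y) ⇒ᵇ (y ∈ˢ S)) (L.allFin n)) (L.allFin n)

-- transitive closure (the relations used are reflexive, so n iterations suffice)
tcStep : {n : ℕ} → Rel n → Rel n → Rel n
tcStep {n} R Q x y = Q x y ∨ anyᵇ (λ z → Q x z ∧ R z y) (L.allFin n)

tcIter : {n : ℕ} → ℕ → Rel n → Rel n → Rel n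
tcIter zero R Q = Q
tcIter (suc k) R Q = tcIter k R (tcStep R Q)

tc : {n : ℕ} → Rel n → Rel n
tc {n} R = tcIter n R R

quot : {n : ℕ} → Fam n → Fam n → Fam n
quot T T' = fromQO (tc (λ x y → leqᵀ T x y ∨ leqᵀ T' y x))

precᵇ : {n : ℕ} → Fam n → Fam n → Bool
precᵇ {n} T' T = allᵇ (λ Y → T Y ⇒ᵇ T' Y) (allSubs n)

admissibleᵇ : {n : ℕ} → Fam n → Fam n → Bool
admissibleᵇ {n} T T' =
  precᵇ T' T
  ∧ allᵇ (λ Y → connectedᵇ (restrict T' Y) ⇒ᵇ eqFam (restrict T' Y) (restrict T Y)) (allSubs n)
  ∧ allᵇ (λ x → allᵇ (λ y → eqB (simᵀ (quot T T') x y) (simᵀ (quot T' T') x y))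
                       (L.allFin n)) (L.allFin n)

Top : Set
Top = Σ ℕ Fam

prodT : {n m : ℕ} → Fam n → Fam m → Fam (n + m)
prodT {n} T T' Z = T (V.take n Z) ∧ T' (V.drop n Z)

ΔT : {n : ℕ} → Fam n → List (Top × Top)
ΔT {n} T =
  concatMap (λ Y → if T Y then ((_ , restrict T (∁ˢ Y)) , (_ , restrict T Y)) ∷ [] else [])
            (allSubs n)

ΓT : {n : ℕ} → Fam n → List (Top × Top)
ΓT {n} T =
  L.map (λ T' → ((n , T') , (n , quot T T')))
        (filterᵇ (λ T' → isTopᵇ T' ∧ admissibleᵇ T T') (allFams n))

εT : ℕ → ℕ
εT n = if n ≡ᵇ 0 then 1 else 0

Word : Set
Word = List ℕ

maxW : Word → ℕ
maxW = L.foldr _⊔_ 0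

memᵇ : ℕ → Word → Bool
memᵇ a w = anyᵇ (λ b → a ≡ᵇ b) w

packedᵇ : Word → Bool
packedᵇ w = allᵇ (λ a → 1 ≤ᵇ a) w ∧ allᵇ (λ a → memᵇ a w) (range1 (maxW w))

allVecs : (n k : ℕ) → List (Vec ℕ n)
allVecs zero k = [] ∷ []
allVecs (suc n) k = concatMap (λ v → L.map (λ a → a ∷ v) (range1 k)) (allVecs n k)

allWords : (n k : ℕ) → List Word
allWords n k = L.map V.toList (allVecs n k)

-- letter at 1-based position i (0 if out of range); a word is a map [k] → ℕ
at : Word → ℕ → ℕ
at [] i = 0
at (a ∷ w) zero = 0
at (a ∷ w) (suc zero) = a
at (a ∷ w) (suc (suc i)) = at w (suc i)

compose : Word → Word → Word
compose w u = L.map (at w) u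

shift : ℕ → Word → Word
shift m = L.map (m +_)

strictIncᵇ : Word → Bool
strictIncᵇ [] = true
strictIncᵇ (a ∷ []) = true
strictIncᵇ (a ∷ b ∷ w) = (a <ᵇ b) ∧ strictIncᵇ (b ∷ w)

blocksIncᵇ : List ℕ → Word → Bool
blocksIncᵇ [] w = true
blocksIncᵇ (i ∷ is) w = strictIncᵇ (L.take i w) ∧ blocksIncᵇ is (L.drop i w)

QSh : List ℕ → List Word
QSh is = filterᵇ (λ u → packedᵇ u ∧ blocksIncᵇ is u) (allWords (sum is) (sum is))

multW : Word → Word → List Word
multW u v = L.map (λ w → compose w (u ++ shift (maxW u) v)) (QSh (maxW u ∷ maxW v ∷ []))

_*W_ : List Word → List Word → List Word
xs *W ys = concatMap (λ u → concatMap (λ v → multW u v) ys) xs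

rank : Word → ℕ → ℕ
rank w a = L.length (filterᵇ (λ c → memᵇ c w) (range1 a))

pack : Word → Word
pack w = L.map (rank w) w

ΔW : Word → List (Word × Word)
ΔW w = L.map (λ k → (filterᵇ (λ a → a ≤ᵇ k) w , pack (filterᵇ (λ a → k <ᵇ a) w)))
             (L.upTo (suc (maxW w)))

compsF : ℕ → ℕ → List (List ℕ)
compsF f zero = [] ∷ []
compsF zero (suc m) = []
compsF (suc f) (suc m) = concatMap (λ i → L.map (suc i ∷_) (compsF f (m ∸ i))) (L.upTo (suc m))

comps : ℕ → List (List ℕ)
comps m = compsF m m

blockWordFrom : ℕ → List ℕ → Word
blockWordFrom k [] = []
blockWordFrom k (i ∷ is) = L.replicate i k ++ blockWordFrom (suc k) is

blockWord : List ℕ → Word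
blockWord = blockWordFrom 1

ρW : Word → List (Word × Word)
ρW u = concatMap (λ is → L.map (λ v → (compose v u , compose (blockWord is) u)) (QSh is))
                 (comps (maxW u))

εW : List Word → ℕ
εW xs = L.length (filterᵇ (λ w → L.null w) xs)

ΔW* : List Word → List (Word × Word)
ΔW* = concatMap ΔW

ρW* : List Word → List (Word × Word)
ρW* = concatMap ρW

compatᵇ : {n : ℕ} → Fam n → Vec ℕ n → Bool
compatᵇ {n} T v =
  allᵇ (λ i → allᵇ (λ j →
      (ltᵀ T i j ⇒ᵇ (V.lookup v i <ᵇ V.lookup v j))
    ∧ (simᵀ T i j ⇒ᵇ (V.lookup v i ≡ᵇ V.lookup v j))) (L.allFin n)) (L.allFin n)

-- Λ(T) = Σ M_w over packed words w of length n compatible with T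
-- (packed words of length n have letters in {1..n})
Λ : (n : ℕ) → Fam n → List Word
Λ n T = L.map V.toList (filterᵇ (λ v → packedᵇ (V.toList v) ∧ compatᵇ T v) (allVecs n n))

ΛΛ : List (Top × Top) → List (Word × Word)
ΛΛ = concatMap (λ { ((n , A) , (m , B)) → concatMap (λ u → L.map (u ,_) (Λ m B)) (Λ n A) })

{-# OPTIONS --safe #-}

-- Each identity is a bijection: once every term is tagged with the data that produced it, both sides are
-- repetition-free lists with the same members.  The rigidity used throughout is that a packed word is
-- determined by the order it induces on its positions.
--  * Product: a packed word x y lies in Λ(T · T') iff pack x and pack y lie in Λ(T) and Λ(T'); the quasi-shuffle
--    is the increasing relabelling of pack x and pack y into x y.
--  * Coproduct: a cut of w ∈ Λ(T) at height k corresponds to the open set Y of the positions of letters above k.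
--  * Internal coproduct: a pair (a , b) occurs on either side iff the lexicographic packing of (b , a) lies in
--    Λ(T).  On the topological side T' is forced: x ≤ y in T' iff x ≤ y in T and b takes the same value at x and y.
module Submission where

open import Defs
open import Data.Bool using (Bool; true; false; _∧_; _∨_; not; if_then_else_)
open import Data.Bool.Properties using (T-≡; not-involutive) renaming (_≟_ to _≟ᴮ_)
open import Data.Empty using (⊥; ⊥-elim)
open import Data.Fin using (Fin; zero; suc; toℕ; _↑ˡ_; _↑ʳ_; splitAt)
open import Data.Fin.Properties as Finₚ using (toℕ<n; toℕ-injective)
open import Data.List as L using (List; []; _∷_; _++_; concatMap)
open import Data.List.Membership.Propositional using (_∈_; find; lose)
open import Data.List.Membership.Propositional.Properties as ∈ₚ using (∈-map⁺; ∈-map⁻; ∈-++⁺ˡ; ∈-++⁺ʳ; ∈-++⁻; ∈-concatMap⁺; ∈-concatMap⁻; ∈-upTo⁺; ∈-upTo⁻; ∈-allFin; ∈-filter⁺; ∈-filter⁻)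
open import Data.List.Membership.Propositional.Properties.WithK using (unique∧set⇒bag)
open import Data.List.Relation.Binary.BagAndSetEquality using (∼bag⇒↭)
import Data.List.Properties as Lₚ
open import Data.List.Relation.Binary.Permutation.Propositional using (_↭_; ↭-refl)
open import Data.List.Relation.Binary.Permutation.Propositional.Properties using (map⁺)
open import Data.List.Relation.Unary.All as All using (All; []; _∷_)
open import Data.List.Relation.Unary.AllPairs as AllPairs using (AllPairs; []; _∷_)
import Data.List.Relation.Unary.AllPairs.Properties as AllPairsₚ
open import Data.List.Relation.Unary.Any as Any using (here; there)
import Data.List.Relation.Unary.Any.Properties as Anyₚ
open import Data.List.Relation.Unary.Unique.Propositional using (Unique)
import Data.List.Relation.Unary.Unique.Propositional.Properties as Uniqueₚ
open import Data.Nat as ℕ using (ℕ; zero; suc; _+_; _*_; _∸_; _≤_; _<_; z≤n; s≤s; _≡ᵇ_; _<ᵇ_; _≤ᵇ_)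
import Data.Nat.Properties as ℕₚ
open import Data.Nat.ListAction using (sum)
open import Data.Product using (Σ; ∃; _,_; _×_; proj₁; proj₂)
open import Data.Sum using (_⊎_; inj₁; inj₂; swap)
open import Data.Vec as V using (Vec; []; _∷_; lookup; tabulate)
import Data.Vec.Properties as Vₚ
open import Function using (_∘_; id; Equivalence; mk⇔)
open import Relation.Binary.PropositionalEquality using (_≡_; _≢_; refl; sym; trans; cong; cong₂; subst; subst₂)
open import Relation.Binary.Definitions using (tri<; tri≈; tri>)
open import Relation.Nullary using (¬_; yes; no)

-- Multiplicity decides where tags must be explicit. A term of a product or of the internal
-- coproduct remembers its origin: the first `n` and last `m` letters of a product word repack to
-- its two factors, and a pair (a , b) fixes both the packed word it came from and, through b, the
-- topology. The ordinary coproduct forgets: cuts of different words can give the same pair, because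
-- the pair does not say which positions were cut off. There the open set is carried along and
-- dropped only after the two lists have been matched.
--
-- Recovering the topology from b rests on one fact about admissibility: the classes of T/T' are the
-- connected components of T', and T' agrees with T on each of them. Since a family of subsets is a
-- function, this recovery, like the enumeration of all families, holds up to pointwise equality;
-- families are therefore separated by pointwise difference.

-- Boolean tests as propositions

∧-true⁻ : ∀ {a b} → (a ∧ b) ≡ true → a ≡ true × b ≡ true
∧-true⁻ {true} {true} _ = refl , refl

∧-true⁺ : ∀ {a b} → a ≡ true → b ≡ true → (a ∧ b) ≡ true
∧-true⁺ refl refl = refl

∨-true⁻ : ∀ {a b} → (a ∨ b) ≡ true → a ≡ true ⊎ b ≡ true
∨-true⁻ {true} _ = inj₁ refl
∨-true⁻ {false} p = inj₂ p

∨-trueˡ : ∀ {a b} → a ≡ true → (a ∨ b) ≡ true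
∨-trueˡ refl = refl

∨-trueʳ : ∀ {a b} → b ≡ true → (a ∨ b) ≡ true
∨-trueʳ {true} _ = refl
∨-trueʳ {false} p = p

⇒-true⁻ : ∀ {a b} → (a ⇒ᵇ b) ≡ true → a ≡ true → b ≡ true
⇒-true⁻ p refl = p

⇒-true⁺ : ∀ {a b} → (a ≡ true → b ≡ true) → (a ⇒ᵇ b) ≡ true
⇒-true⁺ {true} h = h refl
⇒-true⁺ {false} _ = refl

not-true⁻ : ∀ {a} → not a ≡ true → a ≢ true
not-true⁻ {false} _ ()

not-true⁺ : ∀ {a} → a ≢ true → not a ≡ true
not-true⁺ {true} h = ⊥-elim (h refl)
not-true⁺ {false} _ = refl

bool-ext : ∀ {a b} → (a ≡ true → b ≡ true) → (b ≡ true → a ≡ true) → a ≡ b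
bool-ext {true} {b} f g = sym (f refl)
bool-ext {false} {true} f g = g refl
bool-ext {false} {false} f g = refl

eqB-true⁻ : ∀ {a b} → eqB a b ≡ true → a ≡ b
eqB-true⁻ {true} {true} _ = refl
eqB-true⁻ {false} {false} _ = refl

eqB-refl : ∀ a → eqB a a ≡ true
eqB-refl true = refl
eqB-refl false = refl

<ᵇ-true⁻ : ∀ {a b} → (a <ᵇ b) ≡ true → a < b
<ᵇ-true⁻ {a} {b} p = ℕₚ.<ᵇ⇒< a b (Equivalence.from T-≡ p)

<ᵇ-true⁺ : ∀ {a b} → a < b → (a <ᵇ b) ≡ true
<ᵇ-true⁺ p = Equivalence.to T-≡ (ℕₚ.<⇒<ᵇ p)

≤ᵇ-true⁻ : ∀ {a b} → (a ≤ᵇ b) ≡ true → a ≤ b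
≤ᵇ-true⁻ {a} {b} p = ℕₚ.≤ᵇ⇒≤ a b (Equivalence.from T-≡ p)

≤ᵇ-true⁺ : ∀ {a b} → a ≤ b → (a ≤ᵇ b) ≡ true
≤ᵇ-true⁺ p = Equivalence.to T-≡ (ℕₚ.≤⇒≤ᵇ p)

≡ᵇ-true⁻ : ∀ {a b} → (a ≡ᵇ b) ≡ true → a ≡ b
≡ᵇ-true⁻ {a} {b} p = ℕₚ.≡ᵇ⇒≡ a b (Equivalence.from T-≡ p)

≡ᵇ-true⁺ : ∀ {a b} → a ≡ b → (a ≡ᵇ b) ≡ true
≡ᵇ-true⁺ {a} {b} p = Equivalence.to T-≡ (ℕₚ.≡⇒≡ᵇ a b p)

-- Membership and absence of repetition in lists

module _ {A : Set} {p : A → Bool} where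

  allᵇ⁻ : ∀ {xs x} → allᵇ p xs ≡ true → x ∈ xs → p x ≡ true
  allᵇ⁻ h (here refl) = proj₁ (∧-true⁻ h)
  allᵇ⁻ h (there x∈) = allᵇ⁻ (proj₂ (∧-true⁻ h)) x∈

  allᵇ⁺ : ∀ xs → (∀ {x} → x ∈ xs → p x ≡ true) → allᵇ p xs ≡ true
  allᵇ⁺ [] h = refl
  allᵇ⁺ (x ∷ xs) h = ∧-true⁺ (h (here refl)) (allᵇ⁺ xs (h ∘ there))

  anyᵇ⁻ : ∀ xs → anyᵇ p xs ≡ true → ∃ λ x → x ∈ xs × p x ≡ true
  anyᵇ⁻ (x ∷ xs) h with ∨-true⁻ h
  ... | inj₁ px = x , here refl , px
  ... | inj₂ q = let y , y∈ , py = anyᵇ⁻ xs q in y , there y∈ , py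

  anyᵇ⁺ : ∀ {xs x} → x ∈ xs → p x ≡ true → anyᵇ p xs ≡ true
  anyᵇ⁺ (here refl) px = ∨-trueˡ px
  anyᵇ⁺ (there x∈) px = ∨-trueʳ (anyᵇ⁺ x∈ px)

  filterᵇ≡filter : ∀ xs → filterᵇ p xs ≡ L.filter (λ x → p x ≟ᴮ true) xs
  filterᵇ≡filter [] = refl
  filterᵇ≡filter (x ∷ xs) with p x
  ... | true = cong (x ∷_) (filterᵇ≡filter xs)
  ... | false = filterᵇ≡filter xs

  ∈-filterᵇ⁻ : ∀ {xs x} → x ∈ filterᵇ p xs → x ∈ xs × p x ≡ true
  ∈-filterᵇ⁻ {xs} {x} x∈ = ∈-filter⁻ (λ y → p y ≟ᴮ true) {xs = xs} (subst (x ∈_) (filterᵇ≡filter xs) x∈)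

  ∈-filterᵇ⁺ : ∀ {xs x} → x ∈ xs → p x ≡ true → x ∈ filterᵇ p xs
  ∈-filterᵇ⁺ {xs} {x} x∈ px = subst (x ∈_) (sym (filterᵇ≡filter xs)) (∈-filter⁺ (λ y → p y ≟ᴮ true) x∈ px)

  filterᵇ-AllPairs : ∀ {R : A → A → Set} {xs} → AllPairs R xs → AllPairs R (filterᵇ p xs)
  filterᵇ-AllPairs {R} {xs} h = subst (AllPairs R) (sym (filterᵇ≡filter xs)) (AllPairsₚ.filter⁺ (λ y → p y ≟ᴮ true) h)

  filterᵇ-++ : ∀ xs ys → filterᵇ p (xs ++ ys) ≡ filterᵇ p xs ++ filterᵇ p ys
  filterᵇ-++ [] ys = refl
  filterᵇ-++ (x ∷ xs) ys with p x
  ... | true = cong (x ∷_) (filterᵇ-++ xs ys)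
  ... | false = filterᵇ-++ xs ys

module _ {A B : Set} where

  ∈-concatMap⁻′ : ∀ (f : A → List B) xs {z} → z ∈ concatMap f xs → ∃ λ x → x ∈ xs × z ∈ f x
  ∈-concatMap⁻′ f xs z∈ = find (∈-concatMap⁻ f z∈)

  ∈-concatMap⁺′ : ∀ (f : A → List B) {xs x z} → x ∈ xs → z ∈ f x → z ∈ concatMap f xs
  ∈-concatMap⁺′ f x∈ z∈ = ∈-concatMap⁺ f (lose x∈ z∈)

  -- The separation relation `R` is left open because for families of subsets the usable notion is
  -- `_≢ᶠ_`: a common term of two blocks yields only pointwise equality of the families.
  concatMap-unique : ∀ {R : A → A → Set} {f : A → List B} {xs} → AllPairs R xs →
    (∀ {x} → x ∈ xs → Unique (f x)) →
    (∀ {x y z} → x ∈ xs → y ∈ xs → R x y → z ∈ f x → z ∈ f y → ⊥) →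
    Unique (concatMap f xs)
  concatMap-unique [] _ _ = []
  concatMap-unique {f = f} {x ∷ xs} (rx ∷ rxs) u d =
    Uniqueₚ.++⁺ (u (here refl))
      (concatMap-unique rxs (u ∘ there) (λ x∈ y∈ → d (there x∈) (there y∈)))
      λ (z∈x , z∈xs) → let y , y∈ , z∈y = ∈-concatMap⁻′ f xs z∈xs in
        d (here refl) (there y∈) (All.lookup rx y∈) z∈x z∈y

  concatMap-unique-by : ∀ {f : A → List B} {xs} → Unique xs →
    (∀ {x} → x ∈ xs → Unique (f x)) →
    (∀ {x y z} → x ∈ xs → y ∈ xs → z ∈ f x → z ∈ f y → x ≡ y) →
    Unique (concatMap f xs)
  concatMap-unique-by ux u d = concatMap-unique ux u (λ x∈ y∈ x≢y z∈x z∈y → x≢y (d x∈ y∈ z∈x z∈y))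

  map-unique : ∀ {f : A → B} {xs} → Unique xs →
    (∀ {x y} → x ∈ xs → y ∈ xs → f x ≡ f y → x ≡ y) → Unique (L.map f xs)
  map-unique [] _ = []
  map-unique {f} {x ∷ xs} (x∉ ∷ ux) inj =
    All.tabulate (λ z∈ → λ { refl → let y , y∈ , eq = ∈-map⁻ f z∈ in
      All.lookup x∉ y∈ (inj (here refl) (there y∈) eq) })
    ∷ map-unique ux (λ a b → inj (there a) (there b))

unique-↭ : ∀ {A : Set} {xs ys : List A} → Unique xs → Unique ys →
  (∀ {x} → x ∈ xs → x ∈ ys) → (∀ {x} → x ∈ ys → x ∈ xs) → xs ↭ ys
unique-↭ ux uy f g = ∼bag⇒↭ (unique∧set⇒bag ux uy (mk⇔ f g))

-- Enumerations of letters, subsets and vectors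

∈-range1⁻ : ∀ {m a} → a ∈ range1 m → 1 ≤ a × a ≤ m
∈-range1⁻ a∈ with ∈-map⁻ suc a∈
... | b , b∈ , refl = s≤s z≤n , ∈-upTo⁻ b∈

∈-range1⁺ : ∀ {m a} → 1 ≤ a → a ≤ m → a ∈ range1 m
∈-range1⁺ (s≤s z≤n) a≤m = ∈-map⁺ suc (∈-upTo⁺ a≤m)

range1-unique : ∀ m → Unique (range1 m)
range1-unique m = Uniqueₚ.map⁺ ℕₚ.suc-injective (Uniqueₚ.upTo⁺ m)

∈-allSubs : ∀ {n} (S : Sub n) → S ∈ allSubs n
∈-allSubs [] = here refl
∈-allSubs (false ∷ S) = ∈-concatMap⁺′ (λ s → (false ∷ s) ∷ (true ∷ s) ∷ []) (∈-allSubs S) (here refl)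
∈-allSubs (true ∷ S) = ∈-concatMap⁺′ (λ s → (false ∷ s) ∷ (true ∷ s) ∷ []) (∈-allSubs S) (there (here refl))

allSubs-unique : ∀ n → Unique (allSubs n)
allSubs-unique zero = [] ∷ []
allSubs-unique (suc n) = concatMap-unique-by (allSubs-unique n)
  (λ _ → ((λ ()) ∷ []) ∷ [] ∷ [])
  λ { _ _ (here refl) (here refl) → refl
    ; _ _ (here refl) (there (here ()))
    ; _ _ (there (here refl)) (here ())
    ; _ _ (there (here refl)) (there (here refl)) → refl }

∈-allVecs⁺ : ∀ {n k} {v : Vec ℕ n} → (∀ i → 1 ≤ lookup v i × lookup v i ≤ k) → v ∈ allVecs n k
∈-allVecs⁺ {v = []} _ = here refl
∈-allVecs⁺ {k = k} {v = a ∷ v} h = ∈-concatMap⁺′ (λ u → L.map (λ b → b ∷ u) (range1 k)) (∈-allVecs⁺ (h ∘ suc))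
  (∈-map⁺ (_∷ v) (∈-range1⁺ (proj₁ (h zero)) (proj₂ (h zero))))

allVecs-unique : ∀ n k → Unique (allVecs n k)
allVecs-unique zero k = [] ∷ []
allVecs-unique (suc n) k = concatMap-unique-by (allVecs-unique n k)
  (λ _ → Uniqueₚ.map⁺ Vₚ.∷-injectiveˡ (range1-unique k))
  λ {u} {u'} _ _ z∈ z∈' → let a , _ , eq = ∈-map⁻ (_∷ u) z∈
                              a' , _ , eq' = ∈-map⁻ (_∷ u') z∈'
                          in Vₚ.∷-injectiveʳ (trans (sym eq) eq')

eqSub⁻ : ∀ {n} {A B : Sub n} → eqSub A B ≡ true → A ≡ B
eqSub⁻ {A = []} {[]} _ = refl
eqSub⁻ {A = a ∷ A} {b ∷ B} h = let p , q = ∧-true⁻ h in cong₂ _∷_ (eqB-true⁻ p) (eqSub⁻ q)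

eqSub-refl : ∀ {n} (A : Sub n) → eqSub A A ≡ true
eqSub-refl [] = refl
eqSub-refl (a ∷ A) = ∧-true⁺ (eqB-refl a) (eqSub-refl A)

vec-ext : ∀ {A : Set} {n} {u v : Vec A n} → (∀ i → lookup u i ≡ lookup v i) → u ≡ v
vec-ext {u = u} {v} h = trans (sym (Vₚ.tabulate∘lookup u)) (trans (Vₚ.tabulate-cong h) (Vₚ.tabulate∘lookup v))

toList-inj : ∀ {A : Set} {n} {u v : Vec A n} → V.toList u ≡ V.toList v → u ≡ v
toList-inj {u = []} {[]} _ = refl
toList-inj {u = a ∷ u} {b ∷ v} eq = cong₂ _∷_ (Lₚ.∷-injectiveˡ eq) (toList-inj (Lₚ.∷-injectiveʳ eq))

∈-toList⁺ : ∀ {A : Set} {n} (v : Vec A n) i → lookup v i ∈ V.toList v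
∈-toList⁺ (a ∷ v) zero = here refl
∈-toList⁺ (a ∷ v) (suc i) = there (∈-toList⁺ v i)

∈-toList⁻ : ∀ {A : Set} {n} (v : Vec A n) {a} → a ∈ V.toList v → ∃ λ i → lookup v i ≡ a
∈-toList⁻ (a ∷ v) (here refl) = zero , refl
∈-toList⁻ (a ∷ v) (there a∈) = let i , eq = ∈-toList⁻ v a∈ in suc i , eq

-- Enumeration of families of subsets

_≢ᶠ_ : ∀ {n} → Fam n → Fam n → Set
F ≢ᶠ G = ¬ (∀ S → F S ≡ G S)

module _ {n : ℕ} where

  private
    set : Sub n → Bool → Fam n → Fam n
    set s b f x = if eqSub x s then b else f x

    set-same : ∀ s b f → set s b f s ≡ b
    set-same s b f rewrite eqSub-refl s = refl

    set-other : ∀ {s x} b f → x ≢ s → set s b f x ≡ f x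
    set-other {s} {x} b f x≢s with eqSub x s in eq
    ... | true = ⊥-elim (x≢s (eqSub⁻ eq))
    ... | false = refl

  -- `F` is an arbitrary function, while the enumerated ones are nested case distinctions over `ss`
  -- with value `false` elsewhere; agreement on the listed arguments is all that can be asked.
  funs-complete : ∀ ss (F : Fam n) → ∃ λ G → G ∈ funs ss × (∀ {s} → s ∈ ss → G s ≡ F s)
  funs-complete [] F = (λ _ → false) , here refl , λ ()
  funs-complete (s ∷ ss) F with funs-complete ss F
  ... | G , G∈ , h = set s (F s) G , ∈-concatMap⁺′ (λ f → set s false f ∷ set s true f ∷ []) G∈ (mem (F s)) , agree
    where
    mem : ∀ b → set s b G ∈ (set s false G ∷ set s true G ∷ [])
    mem false = here refl
    mem true = there (here refl)
    agree : ∀ {t} → t ∈ s ∷ ss → set s (F s) G t ≡ F t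
    agree {t} t∈ with eqSub t s in eq
    agree {t} t∈ | true = cong F (sym (eqSub⁻ eq))
    agree {t} (here refl) | false with () ← trans (sym eq) (eqSub-refl t)
    agree {t} (there t∈) | false = h t∈

  funs-distinct : ∀ {ss} → Unique ss → AllPairs (λ F G → ∃ λ s → s ∈ ss × F s ≢ G s) (funs ss)
  funs-distinct [] = [] ∷ []
  funs-distinct {s ∷ ss} (s∉ ∷ us) = go (funs-distinct us)
    where
    D : Fam n → Fam n → Set
    D F G = ∃ λ t → t ∈ s ∷ ss × F t ≢ G t
    -- `s` does not occur in `ss`, so overwriting the value at `s` leaves the old point of
    -- difference intact.
    far : ∀ {F G} b b' → (∃ λ t → t ∈ ss × F t ≢ G t) → D (set s b F) (set s b' G)
    far {F} {G} b b' (t , t∈ , ne) = t , there t∈ , λ eq → ne (trans (sym (set-other b F t≢s)) (trans eq (set-other b' G t≢s)))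
      where
      t≢s : t ≢ s
      t≢s refl = All.lookup s∉ t∈ refl
    spread : ∀ {F Gs} b → All (λ G → ∃ λ t → t ∈ ss × F t ≢ G t) Gs →
      All (D (set s b F)) (concatMap (λ f → set s false f ∷ set s true f ∷ []) Gs)
    spread b [] = []
    spread b (p ∷ ps) = far b false p ∷ far b true p ∷ spread b ps
    go : ∀ {Fs} → AllPairs (λ F G → ∃ λ t → t ∈ ss × F t ≢ G t) Fs →
      AllPairs D (concatMap (λ f → set s false f ∷ set s true f ∷ []) Fs)
    go [] = []
    go {F ∷ Fs} (p ∷ ps) =
      ((s , here refl , λ eq → case (trans (sym (set-same s false F)) (trans eq (set-same s true F)))) ∷ spread false p)
      ∷ spread true p ∷ go ps
      where
      case : false ≡ true → ⊥
      case ()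

  allFams-complete : (F : Fam n) → ∃ λ G → G ∈ allFams n × (∀ S → G S ≡ F S)
  allFams-complete F = let G , G∈ , h = funs-complete (allSubs n) F in G , G∈ , λ S → h (∈-allSubs S)

  allFams-distinct : AllPairs _≢ᶠ_ (allFams n)
  allFams-distinct = AllPairs.map (λ (s , _ , ne) eq → ne (eq s)) (funs-distinct (allSubs-unique n))

-- Words as functions of a position

-- Positions count from 1. At `k = 0` the left side would read `a` and the right side the
-- out-of-range value 0.
at-suc : ∀ a w k → 1 ≤ k → at (a ∷ w) (suc k) ≡ at w k
at-suc a w (suc k) _ = refl

∈-at⁺ : ∀ w {k} → 1 ≤ k → k ≤ L.length w → at w k ∈ w
∈-at⁺ (a ∷ w) {suc zero} _ _ = here refl
∈-at⁺ (a ∷ w) {suc (suc k)} _ (s≤s k≤) = there (∈-at⁺ w (s≤s z≤n) k≤)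

∈-at⁻ : ∀ {w a} → a ∈ w → ∃ λ k → 1 ≤ k × k ≤ L.length w × at w k ≡ a
∈-at⁻ (here refl) = 1 , s≤s z≤n , s≤s z≤n , refl
∈-at⁻ {b ∷ w} (there a∈) =
  let k , 1≤k , k≤ , eq = ∈-at⁻ a∈ in suc k , s≤s z≤n , s≤s k≤ , trans (at-suc b w k 1≤k) eq

at-ext : ∀ {w w'} → L.length w ≡ L.length w' →
  (∀ {k} → 1 ≤ k → k ≤ L.length w → at w k ≡ at w' k) → w ≡ w'
at-ext {[]} {[]} _ _ = refl
at-ext {a ∷ w} {b ∷ w'} len h = cong₂ _∷_ (h (s≤s z≤n) (s≤s z≤n))
  (at-ext (ℕₚ.suc-injective len) λ {k} 1≤k k≤ →
    trans (sym (at-suc a w k 1≤k)) (trans (h (s≤s z≤n) (s≤s k≤)) (at-suc b w' k 1≤k)))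

at-++ˡ : ∀ w w' {k} → k ≤ L.length w → 1 ≤ k → at (w ++ w') k ≡ at w k
at-++ˡ (a ∷ w) w' {suc zero} _ _ = refl
at-++ˡ (a ∷ w) w' {suc (suc k)} (s≤s k≤) _ = at-++ˡ w w' k≤ (s≤s z≤n)

at-++ʳ : ∀ w w' {k} → 1 ≤ k → at (w ++ w') (L.length w + k) ≡ at w' k
at-++ʳ [] w' _ = refl
at-++ʳ (a ∷ w) w' {k} 1≤k = trans (at-suc a (w ++ w') _ (ℕₚ.≤-trans 1≤k (ℕₚ.m≤n+m k (L.length w)))) (at-++ʳ w w' 1≤k)

at-applyUpTo : ∀ (f : ℕ → ℕ) {m k} → k < m → at (L.applyUpTo f m) (suc k) ≡ f k
at-applyUpTo f {suc m} {zero} _ = refl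
at-applyUpTo f {suc m} {suc k} (s≤s k<m) = at-applyUpTo (f ∘ suc) k<m

strictInc⁻ : ∀ w → strictIncᵇ w ≡ true → ∀ {k l} → 1 ≤ k → k < l → l ≤ L.length w → at w k < at w l
strictInc⁻ (a ∷ []) _ {suc k} {suc (suc l)} _ _ (s≤s ())
strictInc⁻ (a ∷ []) _ {suc k} {suc zero} _ (s≤s ()) _
strictInc⁻ (a ∷ b ∷ w) h {suc zero} {suc (suc zero)} _ _ _ = <ᵇ-true⁻ (proj₁ (∧-true⁻ h))
strictInc⁻ (a ∷ b ∷ w) h {suc zero} {suc (suc (suc l))} _ _ (s≤s l≤) =
  ℕₚ.<-trans (<ᵇ-true⁻ {a} (proj₁ (∧-true⁻ h)))
    (strictInc⁻ (b ∷ w) (proj₂ (∧-true⁻ {a <ᵇ b} h)) {1} {suc (suc l)} (s≤s z≤n) (s≤s (s≤s z≤n)) l≤)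
strictInc⁻ (a ∷ b ∷ w) h {suc (suc k)} {suc (suc l)} _ (s≤s k<l) (s≤s l≤) =
  strictInc⁻ (b ∷ w) (proj₂ (∧-true⁻ {a <ᵇ b} h)) (s≤s z≤n) k<l l≤
strictInc⁻ (a ∷ b ∷ w) h {suc k} {suc zero} _ (s≤s ()) _

strictInc⁺ : ∀ w → (∀ {k l} → 1 ≤ k → k < l → l ≤ L.length w → at w k < at w l) → strictIncᵇ w ≡ true
strictInc⁺ [] _ = refl
strictInc⁺ (a ∷ []) _ = refl
strictInc⁺ (a ∷ b ∷ w) h = ∧-true⁺ (<ᵇ-true⁺ (h {1} {2} (s≤s z≤n) (s≤s (s≤s z≤n)) (s≤s (s≤s z≤n))))
  (strictInc⁺ (b ∷ w) λ { {suc k} {suc l} 1≤k k<l l≤ → h {suc (suc k)} {suc (suc l)} (s≤s z≤n) (s≤s k<l) (s≤s l≤) })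

∈⇒≤maxW : ∀ {w a} → a ∈ w → a ≤ maxW w
∈⇒≤maxW {b ∷ w} (here refl) = ℕₚ.m≤m⊔n b (maxW w)
∈⇒≤maxW {b ∷ w} (there a∈) = ℕₚ.≤-trans (∈⇒≤maxW a∈) (ℕₚ.m≤n⊔m b (maxW w))

maxW∈ : ∀ w → 1 ≤ maxW w → maxW w ∈ w
maxW∈ (b ∷ w) 1≤ with ℕₚ.⊔-sel b (maxW w)
... | inj₁ eq = subst (_∈ b ∷ w) (sym eq) (here refl)
... | inj₂ eq = subst (_∈ b ∷ w) (sym eq) (there (maxW∈ w (subst (1 ≤_) eq 1≤)))

maxW≤ : ∀ {w m} → (∀ {a} → a ∈ w → a ≤ m) → maxW w ≤ m
maxW≤ {w} {m} h with 1 ℕ.≤? maxW w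
... | yes 1≤ = h (maxW∈ w 1≤)
... | no ¬1≤ = ℕₚ.≤-trans (ℕ.s≤s⁻¹ (ℕₚ.≰⇒> ¬1≤)) z≤n

memᵇ⁻ : ∀ {a w} → memᵇ a w ≡ true → a ∈ w
memᵇ⁻ {a} {w} h = let b , b∈ , eq = anyᵇ⁻ w h in subst (_∈ w) (sym (≡ᵇ-true⁻ {a} eq)) b∈

memᵇ⁺ : ∀ {a w} → a ∈ w → memᵇ a w ≡ true
memᵇ⁺ {a} a∈ = anyᵇ⁺ a∈ (≡ᵇ-true⁺ {a} refl)

-- Packed words

-- In this form packedness depends only on the set of letters, so it passes between words with the
-- same letters (`packed-resp`) without computing a maximum.
Packed : Word → Set
Packed w = (∀ {a} → a ∈ w → 1 ≤ a) × (∀ {a c} → a ∈ w → 1 ≤ c → c ≤ a → c ∈ w)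

packed-resp : ∀ {w w'} → (∀ {a} → a ∈ w → a ∈ w') → (∀ {a} → a ∈ w' → a ∈ w) → Packed w → Packed w'
packed-resp f g (pos , down) = pos ∘ g , λ a∈ 1≤c c≤a → f (down (g a∈) 1≤c c≤a)

packed-surj : ∀ {w c} → Packed w → 1 ≤ c → c ≤ maxW w → c ∈ w
packed-surj {w} (_ , down) 1≤c c≤ = down (maxW∈ w (ℕₚ.≤-trans 1≤c c≤)) 1≤c c≤

packedᵇ⁻ : ∀ {w} → packedᵇ w ≡ true → Packed w
packedᵇ⁻ {w} h = let p , q = ∧-true⁻ {allᵇ (λ a → 1 ≤ᵇ a) w} h in
  (λ a∈ → ≤ᵇ-true⁻ (allᵇ⁻ p a∈)) ,
  (λ a∈ 1≤c c≤a → memᵇ⁻ (allᵇ⁻ q (∈-range1⁺ 1≤c (ℕₚ.≤-trans c≤a (∈⇒≤maxW a∈)))))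

packedᵇ⁺ : ∀ {w} → Packed w → packedᵇ w ≡ true
packedᵇ⁺ {w} P = ∧-true⁺ (allᵇ⁺ w (λ a∈ → ≤ᵇ-true⁺ (proj₁ P a∈)))
  (allᵇ⁺ (range1 (maxW w)) λ a∈ → let 1≤a , a≤ = ∈-range1⁻ a∈ in memᵇ⁺ (packed-surj P 1≤a a≤))

-- Pigeonhole: the letters 1, ..., `a` all occur, at distinct positions. This places every packed
-- word of length `n` in the finite enumeration of words over 1, ..., `n`.
packed-≤length : ∀ {w a} → Packed w → a ∈ w → a ≤ L.length w
packed-≤length {w} {a} (_ , down) a∈ = Finₚ.injective⇒≤ {f = f} f-inj
  where
  loc : (k : Fin a) → suc (toℕ k) ∈ w
  loc k = down a∈ (s≤s z≤n) (toℕ<n k)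
  f : Fin a → Fin (L.length w)
  f k = Any.index (loc k)
  f-val : ∀ k → suc (toℕ k) ≡ L.lookup w (f k)
  f-val k = Anyₚ.lookup-index (loc k)
  f-inj : ∀ {k l} → f k ≡ f l → k ≡ l
  f-inj {k} {l} eq = toℕ-injective (ℕₚ.suc-injective (trans (f-val k) (trans (cong (L.lookup w) eq) (sym (f-val l)))))

module _ {n : ℕ} where

  packed-pos : ∀ {v : Vec ℕ n} → Packed (V.toList v) → ∀ i → 1 ≤ lookup v i
  packed-pos {v} (pos , _) i = pos (∈-toList⁺ v i)

  packed-at : ∀ {v : Vec ℕ n} {c} → Packed (V.toList v) → 1 ≤ c → c ≤ maxW (V.toList v) → ∃ λ i → lookup v i ≡ c
  packed-at {v} P 1≤c c≤ = ∈-toList⁻ v (packed-surj P 1≤c c≤)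

  lookup≤maxW : ∀ (v : Vec ℕ n) i → lookup v i ≤ maxW (V.toList v)
  lookup≤maxW v i = ∈⇒≤maxW (∈-toList⁺ v i)

  OrderPreserving : Vec ℕ n → Vec ℕ n → Set
  OrderPreserving u v = ∀ i j → lookup u i < lookup u j → lookup v i < lookup v j

  -- Induction on the letter: when c + 1 occurs with c positive, c occurs too, and at its position
  -- the other word is strictly smaller. Used in both directions, this is the source of the rigidity
  -- of packed words.
  packed-minimal : ∀ {u v : Vec ℕ n} → Packed (V.toList u) → (∀ i → 1 ≤ lookup v i) →
    OrderPreserving u v → ∀ i → lookup u i ≤ lookup v i
  packed-minimal {u} {v} P pos mono i = go (lookup u i) i refl
    where
    go : ∀ c i → lookup u i ≡ c → c ≤ lookup v i
    go zero i eq = z≤n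
    go (suc zero) i eq = pos i
    go (suc (suc c)) i eq =
      let j , eqj = ∈-toList⁻ u (proj₂ P (∈-toList⁺ u i) (s≤s z≤n) (subst (suc c ≤_) (sym eq) (ℕₚ.n≤1+n _)))
      in ℕₚ.≤-<-trans (go (suc c) j eqj) (mono j i (subst₂ _<_ (sym eqj) (sym eq) ℕₚ.≤-refl))

  packed-unique : ∀ {u v : Vec ℕ n} → Packed (V.toList u) → Packed (V.toList v) →
    OrderPreserving u v → OrderPreserving v u → u ≡ v
  packed-unique {u} {v} P Q f g = vec-ext λ i → ℕₚ.≤-antisym
    (packed-minimal {u} {v} P (packed-pos {v} Q) f i) (packed-minimal {v} {u} Q (packed-pos {u} P) g i)

  reflect-≡ : ∀ (u v : Vec ℕ n) → OrderPreserving v u → ∀ i j → lookup u i ≡ lookup u j → lookup v i ≡ lookup v j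
  reflect-≡ u v g i j eq = ℕₚ.≤-antisym (ℕₚ.≮⇒≥ λ lt → ℕₚ.<⇒≢ (g j i lt) (sym eq)) (ℕₚ.≮⇒≥ λ lt → ℕₚ.<⇒≢ (g i j lt) eq)

-- Ranks and packing

module _ (w : Word) where

  private
    count : List ℕ → ℕ
    count = L.length ∘ filterᵇ (λ c → memᵇ c w)

  rank-suc : ∀ a → rank w (suc a) ≡ rank w a + count (suc a ∷ [])
  rank-suc a = trans (cong count split) (trans (cong L.length (filterᵇ-++ (range1 a) _)) (Lₚ.length-++ (filterᵇ (λ c → memᵇ c w) (range1 a))))
    where
    split : range1 (suc a) ≡ range1 a ++ suc a ∷ []
    split = trans (cong (L.map suc) (sym (Lₚ.upTo-∷ʳ a))) (Lₚ.map-++ suc (L.upTo a) (a ∷ []))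

  rank-suc-∈ : ∀ {a} → suc a ∈ w → rank w (suc a) ≡ suc (rank w a)
  rank-suc-∈ {a} a∈ = trans (rank-suc a) (trans (cong (rank w a +_) one) (ℕₚ.+-comm (rank w a) 1))
    where
    one : count (suc a ∷ []) ≡ 1
    one rewrite memᵇ⁺ a∈ = refl

  rank-mono : ∀ {a b} → a ≤ b → rank w a ≤ rank w b
  rank-mono {a} {zero} z≤n = ℕₚ.≤-refl
  rank-mono {a} {suc b} a≤ with ℕₚ.m≤n⇒m<n∨m≡n a≤
  ... | inj₂ refl = ℕₚ.≤-refl
  ... | inj₁ (s≤s a≤b) = ℕₚ.≤-trans (rank-mono a≤b) (subst (rank w b ≤_) (sym (rank-suc b)) (ℕₚ.m≤m+n _ _))

  rank-mono-< : ∀ {a b} → b ∈ w → a < b → rank w a < rank w b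
  rank-mono-< {a} {suc b} b∈ (s≤s a≤b) = subst (rank w a <_) (sym (rank-suc-∈ b∈)) (s≤s (rank-mono a≤b))

  -- `rank w` climbs by at most one from `a` to `suc a`, and only if `suc a` is a letter; no value
  -- is skipped and each positive value is attained at a letter.
  rank-down : ∀ a {c} → 1 ≤ c → c ≤ rank w a → ∃ λ b → b ∈ w × rank w b ≡ c
  rank-down zero (s≤s z≤n) ()
  rank-down (suc a) {c} 1≤c c≤ with memᵇ (suc a) w in eq
  ... | false = rank-down a 1≤c (subst (c ≤_) (trans (rank-suc a) (trans (cong (rank w a +_) none) (ℕₚ.+-identityʳ _))) c≤)
    where
    none : count (suc a ∷ []) ≡ 0
    none rewrite eq = refl
  ... | true with ℕₚ.m≤n⇒m<n∨m≡n (subst (c ≤_) (rank-suc-∈ (memᵇ⁻ eq)) c≤)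
  ... | inj₁ (s≤s c≤') = rank-down a 1≤c c≤'
  ... | inj₂ refl = suc a , memᵇ⁻ eq , rank-suc-∈ (memᵇ⁻ eq)

  pack-packed : (∀ {a} → a ∈ w → 1 ≤ a) → Packed (pack w)
  pack-packed pos = (λ a∈ → let b , b∈ , eq = ∈-map⁻ (rank w) a∈ in subst (1 ≤_) (sym eq) (rank-mono-< b∈ (pos b∈))) ,
    λ a∈ 1≤c c≤a → let b , b∈ , eq = ∈-map⁻ (rank w) a∈
                       d , d∈ , eq' = rank-down b 1≤c (subst (_ ≤_) eq c≤a)
                   in subst (_∈ pack w) eq' (∈-map⁺ (rank w) d∈)

module _ {n : ℕ} (v : Vec ℕ n) where

  packV : Vec ℕ n
  packV = V.map (rank (V.toList v)) v

  toList-packV : V.toList packV ≡ pack (V.toList v)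
  toList-packV = Vₚ.toList-map (rank (V.toList v)) v

  packV-packed : (∀ i → 1 ≤ lookup v i) → Packed (V.toList packV)
  packV-packed pos = subst Packed (sym toList-packV)
    (pack-packed (V.toList v) λ a∈ → let i , eq = ∈-toList⁻ v a∈ in subst (1 ≤_) eq (pos i))

  packV-preserves : OrderPreserving v packV
  packV-preserves i j lt rewrite Vₚ.lookup-map i (rank (V.toList v)) v | Vₚ.lookup-map j (rank (V.toList v)) v =
    rank-mono-< (V.toList v) (∈-toList⁺ v j) lt

  packV-reflects : OrderPreserving packV v
  packV-reflects i j lt = ℕₚ.≰⇒> λ le → ℕₚ.<⇒≱ lt
    (subst₂ _≤_ (sym (Vₚ.lookup-map j _ v)) (sym (Vₚ.lookup-map i _ v)) (rank-mono (V.toList v) le))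

  packV-unique : ∀ {u : Vec ℕ n} → (∀ i → 1 ≤ lookup v i) → Packed (V.toList u) →
    OrderPreserving v u → OrderPreserving u v → packV ≡ u
  packV-unique pos P f g = packed-unique (packV-packed pos) P
    (λ i j → f i j ∘ packV-reflects i j) (λ i j → packV-preserves i j ∘ g i j)

-- Factoring words through a packed word

module _ {n : ℕ} (u : Vec ℕ n) (Pu : Packed (V.toList u)) where

  private
    m : ℕ
    m = maxW (V.toList u)

  image : ∀ w {c} → L.length w ≡ m → c ∈ w → ∃ λ i → at w (lookup u i) ≡ c
  image w len c∈ =
    let k , 1≤k , k≤ , eq = ∈-at⁻ c∈
        i , eqi = packed-at {v = u} Pu 1≤k (subst (k ≤_) len k≤)
    in i , trans (cong (at w) eqi) eq

  at-∈ : ∀ w → L.length w ≡ m → ∀ i → at w (lookup u i) ∈ w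
  at-∈ w len i = ∈-at⁺ w (packed-pos {v = u} Pu i) (subst (lookup u i ≤_) (sym len) (lookup≤maxW u i))

  ∈-compose⁺ : ∀ w {c} → L.length w ≡ m → c ∈ w → c ∈ V.toList (V.map (at w) u)
  ∈-compose⁺ w len c∈ = let i , eq = image w len c∈ in
    subst (_∈ V.toList (V.map (at w) u)) (trans (Vₚ.lookup-map i (at w) u) eq) (∈-toList⁺ (V.map (at w) u) i)

  ∈-compose⁻ : ∀ w {c} → L.length w ≡ m → c ∈ V.toList (V.map (at w) u) → c ∈ w
  ∈-compose⁻ w len c∈ = let i , eq = ∈-toList⁻ (V.map (at w) u) c∈ in
    subst (_∈ w) (trans (sym (Vₚ.lookup-map i (at w) u)) eq) (at-∈ w len i)

  compose-injective : ∀ w w' → L.length w ≡ m → L.length w' ≡ m →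
    (∀ i → at w (lookup u i) ≡ at w' (lookup u i)) → w ≡ w'
  compose-injective w w' len len' h = at-ext (trans len (sym len')) λ {k} 1≤k k≤ →
    let i , eq = packed-at {v = u} Pu 1≤k (subst (k ≤_) len k≤) in subst (λ c → at w c ≡ at w' c) eq (h i)

  -- Since `u` takes every value 1, ..., `m`, a word constant on the fibres of `u` is a function of
  -- the letter of `u`. This inverts relabelling and produces quasi-shuffles and block words from
  -- the words they relabel to.
  factor : (x : Vec ℕ n) → (∀ i j → lookup u i ≡ lookup u j → lookup x i ≡ lookup x j) →
    ∃ λ w → L.length w ≡ m × (∀ i → at w (lookup u i) ≡ lookup x i)
  factor x cons = L.applyUpTo g m , Lₚ.length-applyUpTo g m , λ i → at-g (lookup u i) i refl
    where
    val : ∀ {n} → Vec ℕ n → Vec ℕ n → ℕ → ℕ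
    -- A default that is never reached: every k from 1 to `m` is a letter of `u`.
    val [] [] k = 0
    val (a ∷ u) (b ∷ x) k = if a ≡ᵇ k then b else val u x k
    val-lookup : ∀ {n} (u x : Vec ℕ n) → (∀ i j → lookup u i ≡ lookup u j → lookup x i ≡ lookup x j) →
      ∀ i → val u x (lookup u i) ≡ lookup x i
    val-lookup (a ∷ u) (b ∷ x) cons i with a ≡ᵇ lookup (a ∷ u) i in eq
    ... | true = cons zero i (≡ᵇ-true⁻ eq)
    val-lookup (a ∷ u) (b ∷ x) cons zero | false with () ← trans (sym eq) (≡ᵇ-true⁺ {a} refl)
    val-lookup (a ∷ u) (b ∷ x) cons (suc i) | false = val-lookup u x (λ i j → cons (suc i) (suc j)) i
    -- `applyUpTo` counts from 0, letters and positions from 1.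
    g : ℕ → ℕ
    g k = val u x (suc k)
    at-g : ∀ c i → lookup u i ≡ c → at (L.applyUpTo g m) c ≡ lookup x i
    at-g zero i eq with () ← subst (1 ≤_) eq (packed-pos {v = u} Pu i)
    at-g (suc k) i eq = trans (at-applyUpTo g (subst (_≤ m) eq (lookup≤maxW u i)))
      (trans (cong (val u x) (sym eq)) (val-lookup u x cons i))

-- Membership in the list of quasi-shuffles

∈-allWords⁻ : ∀ {n k w} → w ∈ allWords n k → L.length w ≡ n
∈-allWords⁻ w∈ with ∈-map⁻ V.toList w∈
... | v , _ , refl = Vₚ.length-toList v

∈-allWords⁺ : ∀ {k w} → (∀ {a} → a ∈ w → 1 ≤ a × a ≤ k) → w ∈ allWords (L.length w) k
∈-allWords⁺ {k} {w} h = subst (_∈ allWords (L.length w) k) (Vₚ.toList∘fromList w)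
  (∈-map⁺ V.toList (∈-allVecs⁺ λ i → h (subst (lookup (V.fromList w) i ∈_) (Vₚ.toList∘fromList w) (∈-toList⁺ (V.fromList w) i))))

∈-QSh⁻ : ∀ is {w} → w ∈ QSh is → L.length w ≡ sum is × Packed w × blocksIncᵇ is w ≡ true
∈-QSh⁻ is {w} w∈ =
  let p , q = ∈-filterᵇ⁻ {p = λ u → packedᵇ u ∧ blocksIncᵇ is u} {allWords (sum is) (sum is)} w∈
      r , s = ∧-true⁻ {packedᵇ w} q
  in ∈-allWords⁻ {k = sum is} p , packedᵇ⁻ r , s

∈-QSh⁺ : ∀ is {w} → L.length w ≡ sum is → Packed w → blocksIncᵇ is w ≡ true → w ∈ QSh is
∈-QSh⁺ is {w} len P b = ∈-filterᵇ⁺ {p = λ u → packedᵇ u ∧ blocksIncᵇ is u}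
  (subst (λ n → w ∈ allWords n (sum is)) len
    (∈-allWords⁺ λ a∈ → proj₁ P a∈ , subst (_ ≤_) len (packed-≤length P a∈)))
  (∧-true⁺ (packedᵇ⁺ P) b)

QSh-unique : ∀ is → Unique (QSh is)
QSh-unique is = filterᵇ-AllPairs (Uniqueₚ.map⁺ toList-inj (allVecs-unique (sum is) (sum is)))

-- Compatible words

-- Stated for an arbitrary relation, so that it can be pulled back along maps of positions and
-- serves a topology, its restrictions and its quotients alike.
Compat : ∀ {n} → Rel n → Vec ℕ n → Set
Compat R v = ∀ i j → (R i j ≡ true → R j i ≢ true → lookup v i < lookup v j)
                   × (R i j ≡ true → R j i ≡ true → lookup v i ≡ lookup v j)

compat-≤ : ∀ {n} {R : Rel n} {v} → Compat R v → ∀ {i j} → R i j ≡ true → lookup v i ≤ lookup v j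
compat-≤ {R = R} C {i} {j} rij with R j i ≟ᴮ true
... | yes rji = ℕₚ.≤-reflexive (proj₂ (C i j) rij rji)
... | no ¬rji = ℕₚ.<⇒≤ (proj₁ (C i j) rij ¬rji)

-- One transport principle for three situations: the two factors of a product, the restriction to a
-- subset, and a word replaced by another with the same order (`e = id`).
compat-pullback : ∀ {n m} {R : Rel n} {R' : Rel m} (v : Vec ℕ n) (v' : Vec ℕ m) (e : Fin m → Fin n) →
  (∀ i j → R' i j ≡ R (e i) (e j)) →
  (∀ i j → lookup v (e i) < lookup v (e j) → lookup v' i < lookup v' j) →
  (∀ i j → lookup v (e i) ≡ lookup v (e j) → lookup v' i ≡ lookup v' j) →
  Compat R v → Compat R' v'
compat-pullback v v' e RR lt eq C i j rewrite RR i j | RR j i =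
  (λ p q → lt i j (proj₁ (C (e i) (e j)) p q)) , (λ p q → eq i j (proj₂ (C (e i) (e j)) p q))

compatᵇ⁻ : ∀ {n} {T : Fam n} {v} → compatᵇ T v ≡ true → Compat (leqᵀ T) v
compatᵇ⁻ {n} {T} {v} h i j = let p , q = ∧-true⁻ (allᵇ⁻ (allᵇ⁻ h (∈-allFin i)) (∈-allFin j)) in
  (λ a b → <ᵇ-true⁻ (⇒-true⁻ p (∧-true⁺ a (not-true⁺ b)))) , (λ a b → ≡ᵇ-true⁻ (⇒-true⁻ q (∧-true⁺ a b)))

compatᵇ⁺ : ∀ {n} {T : Fam n} {v} → Compat (leqᵀ T) v → compatᵇ T v ≡ true
compatᵇ⁺ {n} {T} {v} C = allᵇ⁺ (L.allFin n) λ {i} _ → allᵇ⁺ (L.allFin n) λ {j} _ → ∧-true⁺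
  (⇒-true⁺ λ h → let a , b = ∧-true⁻ {leqᵀ T i j} h in <ᵇ-true⁺ (proj₁ (C i j) a (not-true⁻ b)))
  (⇒-true⁺ λ h → let a , b = ∧-true⁻ {leqᵀ T i j} h in ≡ᵇ-true⁺ (proj₂ (C i j) a b))

-- Keeps the vector underlying the list: matching on the equation makes the positions available as
-- elements of `Fin n`.
Extension : ∀ {n} → Fam n → Word → Set
Extension T w = ∃ λ v → w ≡ V.toList v × Packed (V.toList v) × Compat (leqᵀ T) v

ΛV : ∀ n → Fam n → List (Vec ℕ n)
ΛV n T = filterᵇ (λ v → packedᵇ (V.toList v) ∧ compatᵇ T v) (allVecs n n)

module _ {n : ℕ} {T : Fam n} where

  ∈-ΛV⁻ : ∀ {v} → v ∈ ΛV n T → Packed (V.toList v) × Compat (leqᵀ T) v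
  ∈-ΛV⁻ {v} v∈ = let _ , h = ∈-filterᵇ⁻ {p = λ v → packedᵇ (V.toList v) ∧ compatᵇ T v} {allVecs n n} v∈
                     p , q = ∧-true⁻ {packedᵇ (V.toList v)} h in packedᵇ⁻ p , compatᵇ⁻ {T = T} {v} q

  ∈-ΛV⁺ : ∀ {v} → Packed (V.toList v) → Compat (leqᵀ T) v → v ∈ ΛV n T
  ∈-ΛV⁺ {v} P C = ∈-filterᵇ⁺ {p = λ v → packedᵇ (V.toList v) ∧ compatᵇ T v}
    (∈-allVecs⁺ λ i → packed-pos {v = v} P i , subst (lookup v i ≤_) (Vₚ.length-toList v) (packed-≤length P (∈-toList⁺ v i)))
    (∧-true⁺ (packedᵇ⁺ P) (compatᵇ⁺ {T = T} {v} C))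

  ∈-Λ⁻ : ∀ {w} → w ∈ Λ n T → Extension T w
  ∈-Λ⁻ w∈ = let v , v∈ , eq = ∈-map⁻ V.toList w∈ in v , eq , ∈-ΛV⁻ v∈

  ∈-Λ⁺ : ∀ {v} → Packed (V.toList v) → Compat (leqᵀ T) v → V.toList v ∈ Λ n T
  ∈-Λ⁺ P C = ∈-map⁺ V.toList (∈-ΛV⁺ P C)

  ΛV-unique : Unique (ΛV n T)
  ΛV-unique = filterᵇ-AllPairs (allVecs-unique n n)

  Λ-unique : Unique (Λ n T)
  Λ-unique = Uniqueₚ.map⁺ toList-inj ΛV-unique

-- Topologies and their quasi-orders

module _ {n : ℕ} {T : Fam n} where

  leq⁻ : ∀ {x y} → leqᵀ T x y ≡ true → ∀ {Y} → T Y ≡ true → (x ∈ˢ Y) ≡ true → (y ∈ˢ Y) ≡ true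
  leq⁻ h {Y} oY x∈ = ⇒-true⁻ (allᵇ⁻ h (∈-allSubs Y)) (∧-true⁺ oY x∈)

  leq⁺ : ∀ {x y} → (∀ {Y} → T Y ≡ true → (x ∈ˢ Y) ≡ true → (y ∈ˢ Y) ≡ true) → leqᵀ T x y ≡ true
  leq⁺ h = allᵇ⁺ (allSubs n) λ {Y} _ → ⇒-true⁺ λ p → let q , r = ∧-true⁻ {T Y} p in h {Y} q r

  leq-refl : ∀ x → leqᵀ T x x ≡ true
  leq-refl x = leq⁺ λ _ x∈ → x∈

  leq-trans : ∀ {x y z} → leqᵀ T x y ≡ true → leqᵀ T y z ≡ true → leqᵀ T x z ≡ true
  leq-trans p q = leq⁺ λ {Y} oY x∈ → leq⁻ q {Y} oY (leq⁻ p {Y} oY x∈)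

  UpClosed : Sub n → Set
  UpClosed Y = ∀ {x y} → (x ∈ˢ Y) ≡ true → leqᵀ T x y ≡ true → (y ∈ˢ Y) ≡ true

  -- An up-closed set is the union of the least neighbourhoods of its points.
  upClosed⇒open : IsTopology T → ∀ {Y} → UpClosed Y → T Y ≡ true
  upClosed⇒open (o∅ , ofull , o∪ , o∩) {Y} up = subst (λ S → T S ≡ true) (vec-ext union≡Y) (union-open (L.allFin n))
    where
    nbhd : Fin n → List (Sub n) → Sub n
    nbhd x [] = fullˢ
    nbhd x (W ∷ Ws) = if T W ∧ (x ∈ˢ W) then W ∩ˢ nbhd x Ws else nbhd x Ws

    nbhd-open : ∀ x Ws → T (nbhd x Ws) ≡ true
    nbhd-open x [] = ofull
    nbhd-open x (W ∷ Ws) with T W in oW | x ∈ˢ W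
    ... | true | true = o∩ W (nbhd x Ws) oW (nbhd-open x Ws)
    ... | true | false = nbhd-open x Ws
    ... | false | _ = nbhd-open x Ws

    -- For `Ws = allSubs n` the right-hand side is `leqᵀ T x y` by definition.
    ∈-nbhd : ∀ x Ws y → (y ∈ˢ nbhd x Ws) ≡ allᵇ (λ W → (T W ∧ (x ∈ˢ W)) ⇒ᵇ (y ∈ˢ W)) Ws
    ∈-nbhd x [] y = Vₚ.lookup-replicate y true
    ∈-nbhd x (W ∷ Ws) y with T W ∧ (x ∈ˢ W)
    ... | true = trans (Vₚ.lookup-zipWith _∧_ y W (nbhd x Ws)) (cong ((y ∈ˢ W) ∧_) (∈-nbhd x Ws y))
    ... | false = ∈-nbhd x Ws y

    union : List (Fin n) → Sub n
    union [] = ∅ˢ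
    union (x ∷ xs) = if x ∈ˢ Y then nbhd x (allSubs n) ∪ˢ union xs else union xs

    union-open : ∀ xs → T (union xs) ≡ true
    union-open [] = o∅
    union-open (x ∷ xs) with x ∈ˢ Y
    ... | true = o∪ (nbhd x (allSubs n)) (union xs) (nbhd-open x (allSubs n)) (union-open xs)
    ... | false = union-open xs

    ∈-union : ∀ xs y → (y ∈ˢ union xs) ≡ anyᵇ (λ x → (x ∈ˢ Y) ∧ leqᵀ T x y) xs
    ∈-union [] y = Vₚ.lookup-replicate y false
    ∈-union (x ∷ xs) y with x ∈ˢ Y
    ... | true = trans (Vₚ.lookup-zipWith _∨_ y (nbhd x (allSubs n)) (union xs))
                       (cong₂ _∨_ (∈-nbhd x (allSubs n) y) (∈-union xs y))
    ... | false = ∈-union xs y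

    union≡Y : ∀ y → (y ∈ˢ union (L.allFin n)) ≡ (y ∈ˢ Y)
    union≡Y y = trans (∈-union (L.allFin n) y) (bool-ext
      (λ h → let x , _ , p = anyᵇ⁻ (L.allFin n) h
                 x∈ , le = ∧-true⁻ {x ∈ˢ Y} p in up x∈ le)
      (λ y∈ → anyᵇ⁺ (∈-allFin y) (∧-true⁺ y∈ (leq-refl y))))

leq-cong : ∀ {n} {F G : Fam n} → (∀ S → F S ≡ G S) → ∀ x y → leqᵀ F x y ≡ leqᵀ G x y
leq-cong {F = F} {G} h x y = bool-ext
  (λ p → leq⁺ λ {Y} oY → leq⁻ {T = F} p {Y} (trans (h Y) oY))
  (λ p → leq⁺ λ {Y} oY → leq⁻ {T = G} p {Y} (trans (sym (h Y)) oY))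

-- Counit

εW-Λ : ∀ n (T : Fam n) → εW (Λ n T) ≡ εT n
εW-Λ zero T = refl
εW-Λ (suc n) T = none (ΛV (suc n) T)
  where
  none : ∀ (vs : List (Vec ℕ (suc n))) → εW (L.map V.toList vs) ≡ 0
  none [] = refl
  none ((a ∷ v) ∷ vs) = none vs

-- Product

split : ∀ n {m} (i : Fin (n + m)) → (∃ λ j → i ≡ j ↑ˡ m) ⊎ (∃ λ j → i ≡ n ↑ʳ j)
split n i with splitAt n i in eq
... | inj₁ j = inj₁ (j , sym (Finₚ.splitAt⁻¹-↑ˡ eq))
... | inj₂ j = inj₂ (j , sym (Finₚ.splitAt⁻¹-↑ʳ eq))

module _ {n m : ℕ} {T : Fam n} {T' : Fam m} where

  prodT-++ : ∀ A B → prodT T T' (A V.++ B) ≡ (T A ∧ T' B)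
  prodT-++ A B = let p , q = Vₚ.++-injective (V.take n (A V.++ B)) A (Vₚ.take++drop≡id n (A V.++ B))
                 in cong₂ (λ X Y → T X ∧ T' Y) p q

  module _ (top : IsTopology T) (top' : IsTopology T') where

    private
      ∅-open : T ∅ˢ ≡ true
      ∅-open = proj₁ top
      full-open : T fullˢ ≡ true
      full-open = proj₁ (proj₂ top)
      ∅-open' : T' ∅ˢ ≡ true
      ∅-open' = proj₁ top'
      full-open' : T' fullˢ ≡ true
      full-open' = proj₁ (proj₂ top')

    leq-prodˡ : ∀ i j → leqᵀ T i j ≡ leqᵀ (prodT T T') (i ↑ˡ m) (j ↑ˡ m)
    leq-prodˡ i j = bool-ext
      (λ le → leq⁺ λ {Z} → from le Z (V.splitAt n Z))
      -- An open set of one factor becomes open in the product once it is completed by the full set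
      -- of the other.
      (λ le → leq⁺ λ {A} oA i∈ → trans (sym (Vₚ.lookup-++ˡ A fullˢ j))
        (leq⁻ {T = prodT T T'} le {A V.++ fullˢ} (trans (prodT-++ A fullˢ) (∧-true⁺ oA full-open')) (trans (Vₚ.lookup-++ˡ A fullˢ i) i∈)))
      where
      from : leqᵀ T i j ≡ true → ∀ Z → (∃ λ A → ∃ λ B → Z ≡ A V.++ B) → prodT T T' Z ≡ true → lookup Z (i ↑ˡ m) ≡ true → lookup Z (j ↑ˡ m) ≡ true
      from le Z (A , B , refl) oZ i∈ = trans (Vₚ.lookup-++ˡ A B j)
        (leq⁻ {T = T} le {A} (proj₁ (∧-true⁻ (trans (sym (prodT-++ A B)) oZ))) (trans (sym (Vₚ.lookup-++ˡ A B i)) i∈))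

    leq-prodʳ : ∀ i j → leqᵀ T' i j ≡ leqᵀ (prodT T T') (n ↑ʳ i) (n ↑ʳ j)
    leq-prodʳ i j = bool-ext
      (λ le → leq⁺ λ {Z} → from le Z (V.splitAt n Z))
      (λ le → leq⁺ λ {B} oB i∈ → trans (sym (Vₚ.lookup-++ʳ (fullˢ {n}) B j))
        (leq⁻ {T = prodT T T'} le {fullˢ {n} V.++ B} (trans (prodT-++ fullˢ B) (∧-true⁺ full-open oB)) (trans (Vₚ.lookup-++ʳ (fullˢ {n}) B i) i∈)))
      where
      from : leqᵀ T' i j ≡ true → ∀ Z → (∃ λ A → ∃ λ B → Z ≡ A V.++ B) → prodT T T' Z ≡ true → lookup Z (n ↑ʳ i) ≡ true → lookup Z (n ↑ʳ j) ≡ true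
      from le Z (A , B , refl) oZ i∈ = trans (Vₚ.lookup-++ʳ A B j)
        (leq⁻ {T = T'} le {B} (proj₂ (∧-true⁻ {T A} (trans (sym (prodT-++ A B)) oZ))) (trans (sym (Vₚ.lookup-++ʳ A B i)) i∈))

    -- The open set `fullˢ ++ ∅ˢ` contains the left block and misses the right one.
    leq-prod-lr : ∀ i j → leqᵀ (prodT T T') (i ↑ˡ m) (n ↑ʳ j) ≢ true
    leq-prod-lr i j le with () ← trans (sym (trans (Vₚ.lookup-++ʳ (fullˢ {n}) (∅ˢ {m}) j) (Vₚ.lookup-replicate j false)))
      (leq⁻ {T = prodT T T'} le {fullˢ {n} V.++ ∅ˢ {m}} (trans (prodT-++ (fullˢ {n}) (∅ˢ {m})) (∧-true⁺ full-open ∅-open'))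
        (trans (Vₚ.lookup-++ˡ (fullˢ {n}) (∅ˢ {m}) i) (Vₚ.lookup-replicate i true)))

    leq-prod-rl : ∀ i j → leqᵀ (prodT T T') (n ↑ʳ i) (j ↑ˡ m) ≢ true
    leq-prod-rl i j le with () ← trans (sym (trans (Vₚ.lookup-++ˡ (∅ˢ {n}) (fullˢ {m}) j) (Vₚ.lookup-replicate j false)))
      (leq⁻ {T = prodT T T'} le {∅ˢ {n} V.++ fullˢ {m}} (trans (prodT-++ (∅ˢ {n}) (fullˢ {m})) (∧-true⁺ ∅-open full-open'))
        (trans (Vₚ.lookup-++ʳ (∅ˢ {n}) (fullˢ {m}) i) (Vₚ.lookup-replicate i true)))

    -- No relation links the two blocks, so the mixed cases impose nothing: letters of `a` and `b`
    -- may interleave or coincide, which is exactly the freedom of a quasi-shuffle.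
    compat-++⁺ : ∀ a b → Compat (leqᵀ T) a → Compat (leqᵀ T') b → Compat (leqᵀ (prodT T T')) (a V.++ b)
    compat-++⁺ a b C D i j with split n i | split n j
    ... | inj₁ (i , refl) | inj₁ (j , refl)
      rewrite sym (leq-prodˡ i j) | sym (leq-prodˡ j i) | Vₚ.lookup-++ˡ a b i | Vₚ.lookup-++ˡ a b j = C i j
    ... | inj₂ (i , refl) | inj₂ (j , refl)
      rewrite sym (leq-prodʳ i j) | sym (leq-prodʳ j i) | Vₚ.lookup-++ʳ a b i | Vₚ.lookup-++ʳ a b j = D i j
    ... | inj₁ (i , refl) | inj₂ (j , refl) = (λ le → ⊥-elim (leq-prod-lr i j le)) , (λ le → ⊥-elim (leq-prod-lr i j le))
    ... | inj₂ (i , refl) | inj₁ (j , refl) = (λ le → ⊥-elim (leq-prod-rl i j le)) , (λ le → ⊥-elim (leq-prod-rl i j le))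

    compat-++⁻ˡ : ∀ a b → Compat (leqᵀ (prodT T T')) (a V.++ b) → Compat (leqᵀ T) a
    compat-++⁻ˡ a b = compat-pullback (a V.++ b) a (_↑ˡ m) leq-prodˡ
      (λ i j → subst₂ _<_ (Vₚ.lookup-++ˡ a b i) (Vₚ.lookup-++ˡ a b j))
      (λ i j → subst₂ _≡_ (Vₚ.lookup-++ˡ a b i) (Vₚ.lookup-++ˡ a b j))

    compat-++⁻ʳ : ∀ a b → Compat (leqᵀ (prodT T T')) (a V.++ b) → Compat (leqᵀ T') b
    compat-++⁻ʳ a b = compat-pullback (a V.++ b) b (n ↑ʳ_) leq-prodʳ
      (λ i j → subst₂ _<_ (Vₚ.lookup-++ʳ a b i) (Vₚ.lookup-++ʳ a b j))
      (λ i j → subst₂ _≡_ (Vₚ.lookup-++ʳ a b i) (Vₚ.lookup-++ʳ a b j))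

compat-reorder : ∀ {n} {R : Rel n} (u v : Vec ℕ n) → OrderPreserving u v → OrderPreserving v u → Compat R u → Compat R v
compat-reorder u v f g = compat-pullback u v id (λ _ _ → refl) f (reflect-≡ u v g)

module _ {n : ℕ} (u : Vec ℕ n) (Pu : Packed (V.toList u)) (w : Word) (len : L.length w ≡ maxW (V.toList u))
  (inc : strictIncᵇ w ≡ true) where

  strictInc-preserves : OrderPreserving u (V.map (at w) u)
  strictInc-preserves i j lt rewrite Vₚ.lookup-map i (at w) u | Vₚ.lookup-map j (at w) u =
    strictInc⁻ w inc (packed-pos {v = u} Pu i) lt (subst (lookup u j ≤_) (sym len) (lookup≤maxW u j))

  strictInc-reflects : OrderPreserving (V.map (at w) u) u
  strictInc-reflects i j lt = ℕₚ.≰⇒> λ le → case (ℕₚ.m≤n⇒m<n∨m≡n le)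
    where
    case : lookup u j < lookup u i ⊎ lookup u j ≡ lookup u i → ⊥
    case (inj₁ lt') = ℕₚ.<-asym lt (strictInc-preserves j i lt')
    case (inj₂ eq) = ℕₚ.<⇒≢ lt (trans (Vₚ.lookup-map i (at w) u) (trans (cong (at w) (sym eq)) (sym (Vₚ.lookup-map j (at w) u))))

factor-strictInc : ∀ {n} (u x : Vec ℕ n) w → Packed (V.toList u) → OrderPreserving u x →
  L.length w ≡ maxW (V.toList u) → (∀ i → at w (lookup u i) ≡ lookup x i) → strictIncᵇ w ≡ true
factor-strictInc u x w Pu mono len fac = strictInc⁺ w λ {k} {l} 1≤k k<l l≤ →
  let l≤m = subst (l ≤_) len l≤
      i , eqi = packed-at {v = u} Pu 1≤k (ℕₚ.≤-trans (ℕₚ.<⇒≤ k<l) l≤m)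
      j , eqj = packed-at {v = u} Pu (ℕₚ.≤-trans 1≤k (ℕₚ.<⇒≤ k<l)) l≤m
  in subst₂ _<_ (trans (sym (fac i)) (cong (at w) eqi)) (trans (sym (fac j)) (cong (at w) eqj))
       (mono i j (subst₂ _<_ (sym eqi) (sym eqj) k<l))

∈-vec-++⁻ : ∀ {n m} (a : Vec ℕ n) (b : Vec ℕ m) {c} → c ∈ V.toList (a V.++ b) → c ∈ V.toList a ⊎ c ∈ V.toList b
∈-vec-++⁻ a b c∈ = ∈-++⁻ (V.toList a) (subst (_ ∈_) (Vₚ.toList-++ a b) c∈)

∈-vec-++⁺ˡ : ∀ {n m} (a : Vec ℕ n) (b : Vec ℕ m) {c} → c ∈ V.toList a → c ∈ V.toList (a V.++ b)
∈-vec-++⁺ˡ a b c∈ = subst (_ ∈_) (sym (Vₚ.toList-++ a b)) (∈-++⁺ˡ c∈)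

∈-vec-++⁺ʳ : ∀ {n m} (a : Vec ℕ n) (b : Vec ℕ m) {c} → c ∈ V.toList b → c ∈ V.toList (a V.++ b)
∈-vec-++⁺ʳ a b c∈ = subst (_ ∈_) (sym (Vₚ.toList-++ a b)) (∈-++⁺ʳ (V.toList a) c∈)

take-length-++ : ∀ {A : Set} (xs ys : List A) → L.take (L.length xs) (xs ++ ys) ≡ xs
take-length-++ [] ys = refl
take-length-++ (x ∷ xs) ys = cong (x ∷_) (take-length-++ xs ys)

drop-length-++ : ∀ {A : Set} (xs ys : List A) → L.drop (L.length xs) (xs ++ ys) ≡ ys
drop-length-++ [] ys = refl
drop-length-++ (x ∷ xs) ys = drop-length-++ xs ys

module _ {n m : ℕ} {u : Vec ℕ n} {u' : Vec ℕ m} (Pu : Packed (V.toList u)) (Pu' : Packed (V.toList u')) where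

  private
    p q : ℕ
    p = maxW (V.toList u)
    q = maxW (V.toList u')

  -- Cut after its first `p` letters, a quasi-shuffle becomes two increasing relabellings, one for
  -- each factor; joint packedness is the only condition that ties them together.
  record Shuffle (w₁ w₂ : Word) : Set where
    field
      len₁ : L.length w₁ ≡ p
      len₂ : L.length w₂ ≡ q
      packed : Packed (w₁ ++ w₂)
      inc₁ : strictIncᵇ w₁ ≡ true
      inc₂ : strictIncᵇ w₂ ≡ true

  -- The shift `p` equals the length of `w₁`, so a shifted letter skips the first block and reads
  -- `w₂`.
  compose-++ : ∀ w₁ w₂ → L.length w₁ ≡ p →
    compose (w₁ ++ w₂) (V.toList u ++ shift p (V.toList u')) ≡ V.toList (V.map (at w₁) u V.++ V.map (at w₂) u')
  compose-++ w₁ w₂ len = trans (Lₚ.map-++ (at (w₁ ++ w₂)) (V.toList u) _)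
    (trans (cong₂ _++_ left right) (sym (Vₚ.toList-++ (V.map (at w₁) u) (V.map (at w₂) u'))))
    where
    left : L.map (at (w₁ ++ w₂)) (V.toList u) ≡ V.toList (V.map (at w₁) u)
    left = trans (sym (Vₚ.toList-map (at (w₁ ++ w₂)) u)) (cong V.toList (vec-ext λ i →
      trans (Vₚ.lookup-map i _ u) (trans (at-++ˡ w₁ w₂ (subst (lookup u i ≤_) (sym len) (lookup≤maxW u i)) (packed-pos {v = u} Pu i))
        (sym (Vₚ.lookup-map i _ u)))))
    right : L.map (at (w₁ ++ w₂)) (shift p (V.toList u')) ≡ V.toList (V.map (at w₂) u')
    right = trans (sym (Lₚ.map-∘ (V.toList u'))) (trans (sym (Vₚ.toList-map _ u')) (cong V.toList (vec-ext λ i →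
      trans (Vₚ.lookup-map i _ u') (trans (trans (cong (λ z → at (w₁ ++ w₂) (z + lookup u' i)) (sym len))
        (at-++ʳ w₁ w₂ (packed-pos {v = u'} Pu' i))) (sym (Vₚ.lookup-map i _ u'))))))

  ∈-QSh₂⁻ : ∀ {w} → w ∈ QSh (p ∷ q ∷ []) → ∃ λ w₁ → ∃ λ w₂ → w ≡ w₁ ++ w₂ × Shuffle w₁ w₂
  ∈-QSh₂⁻ {w} w∈ with ∈-QSh⁻ (p ∷ q ∷ []) w∈
  ... | len , P , inc = L.take p w , L.drop p w , sym (Lₚ.take++drop≡id p w) , record
    { len₁ = trans (Lₚ.length-take p w) (ℕₚ.m≤n⇒m⊓n≡m (subst (p ≤_) (sym len) (ℕₚ.m≤m+n p _)))
    ; len₂ = len₂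
    ; packed = subst Packed (sym (Lₚ.take++drop≡id p w)) P
    ; inc₁ = proj₁ (∧-true⁻ inc)
    ; inc₂ = subst (λ z → strictIncᵇ z ≡ true) (Lₚ.take-all q (L.drop p w) (ℕₚ.≤-reflexive len₂))
        (proj₁ (∧-true⁻ (proj₂ (∧-true⁻ {strictIncᵇ (L.take p w)} inc))))
    }
    where
    len₂ : L.length (L.drop p w) ≡ q
    len₂ = trans (Lₚ.length-drop p w) (trans (cong (_∸ p) len) (trans (ℕₚ.m+n∸m≡n p (q + 0)) (ℕₚ.+-identityʳ q)))

  ∈-QSh₂⁺ : ∀ w₁ w₂ → Shuffle w₁ w₂ → w₁ ++ w₂ ∈ QSh (p ∷ q ∷ [])
  ∈-QSh₂⁺ w₁ w₂ s = ∈-QSh⁺ (p ∷ q ∷ []) (trans (Lₚ.length-++ w₁) (cong₂ _+_ len₁ (trans len₂ (sym (ℕₚ.+-identityʳ q))))) packed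
    (subst₂ (λ x y → (strictIncᵇ x ∧ (strictIncᵇ (L.take q y) ∧ true)) ≡ true) (sym take≡) (sym drop≡)
      (∧-true⁺ inc₁ (∧-true⁺ (subst (λ z → strictIncᵇ z ≡ true) (sym (Lₚ.take-all q w₂ (ℕₚ.≤-reflexive len₂))) inc₂) refl)))
    where
    open Shuffle s
    take≡ : L.take p (w₁ ++ w₂) ≡ w₁
    take≡ = trans (cong (λ k → L.take k (w₁ ++ w₂)) (sym len₁)) (take-length-++ w₁ w₂)
    drop≡ : L.drop p (w₁ ++ w₂) ≡ w₂
    drop≡ = trans (cong (λ k → L.drop k (w₁ ++ w₂)) (sym len₁)) (drop-length-++ w₁ w₂)

  ∈-multW⁻ : ∀ {x} → x ∈ multW (V.toList u) (V.toList u') →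
    ∃ λ w₁ → ∃ λ w₂ → x ≡ V.toList (V.map (at w₁) u V.++ V.map (at w₂) u') × Shuffle w₁ w₂
  ∈-multW⁻ x∈ with ∈-map⁻ (λ w → compose w (V.toList u ++ shift p (V.toList u'))) x∈
  ... | w , w∈ , refl with ∈-QSh₂⁻ w∈
  ... | w₁ , w₂ , refl , s = w₁ , w₂ , compose-++ w₁ w₂ (Shuffle.len₁ s) , s

  ∈-multW⁺ : ∀ w₁ w₂ → Shuffle w₁ w₂ → V.toList (V.map (at w₁) u V.++ V.map (at w₂) u') ∈ multW (V.toList u) (V.toList u')
  ∈-multW⁺ w₁ w₂ s = subst (_∈ multW (V.toList u) (V.toList u')) (compose-++ w₁ w₂ (Shuffle.len₁ s))
    (∈-map⁺ (λ w → compose w (V.toList u ++ shift p (V.toList u'))) (∈-QSh₂⁺ w₁ w₂ s))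

  multW-unique : Unique (multW (V.toList u) (V.toList u'))
  multW-unique = map-unique (QSh-unique (p ∷ q ∷ [])) λ w∈ w'∈ eq → inj (∈-QSh₂⁻ w∈) (∈-QSh₂⁻ w'∈) eq
    where
    inj : ∀ {w w'} → (∃ λ w₁ → ∃ λ w₂ → w ≡ w₁ ++ w₂ × Shuffle w₁ w₂) →
      (∃ λ w₁ → ∃ λ w₂ → w' ≡ w₁ ++ w₂ × Shuffle w₁ w₂) →
      compose w (V.toList u ++ shift p (V.toList u')) ≡ compose w' (V.toList u ++ shift p (V.toList u')) → w ≡ w'
    inj (w₁ , w₂ , refl , s) (w₁' , w₂' , refl , s') eq = cong₂ _++_
      (compose-injective u Pu w₁ w₁' (Shuffle.len₁ s) (Shuffle.len₁ s') (pointwise u w₁ w₁' (proj₁ parts)))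
      (compose-injective u' Pu' w₂ w₂' (Shuffle.len₂ s) (Shuffle.len₂ s') (pointwise u' w₂ w₂' (proj₂ parts)))
      where
      parts : V.map (at w₁) u ≡ V.map (at w₁') u × V.map (at w₂) u' ≡ V.map (at w₂') u'
      parts = Vₚ.++-injective (V.map (at w₁) u) (V.map (at w₁') u)
        (toList-inj (trans (sym (compose-++ w₁ w₂ (Shuffle.len₁ s))) (trans eq (compose-++ w₁' w₂' (Shuffle.len₁ s')))))
      pointwise : ∀ {k} (v : Vec ℕ k) w w' → V.map (at w) v ≡ V.map (at w') v → ∀ i → at w (lookup v i) ≡ at w' (lookup v i)
      pointwise v w w' e i = trans (sym (Vₚ.lookup-map i (at w) v)) (trans (cong (λ z → lookup z i) e) (Vₚ.lookup-map i (at w') v))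

-- u is recovered from its strictly increasing relabelling w ∘ u as the packing of the latter.
strictInc-injective : ∀ {n} {u u' : Vec ℕ n} w w' → Packed (V.toList u) → Packed (V.toList u') →
  L.length w ≡ maxW (V.toList u) → L.length w' ≡ maxW (V.toList u') →
  strictIncᵇ w ≡ true → strictIncᵇ w' ≡ true → V.map (at w) u ≡ V.map (at w') u' → u ≡ u'
strictInc-injective {u = u} {u'} w w' Pu Pu' len len' inc inc' eq = packed-unique Pu Pu'
  (λ i j → strictInc-reflects u' Pu' w' len' inc' i j ∘ subst (λ z → lookup z i < lookup z j) eq ∘ strictInc-preserves u Pu w len inc i j)
  (λ i j → strictInc-reflects u Pu w len inc i j ∘ subst (λ z → lookup z i < lookup z j) (sym eq) ∘ strictInc-preserves u' Pu' w' len' inc' i j)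

module _ {n m : ℕ} {T : Fam n} {T' : Fam m} where

  -- Both factors can be read off from a product word by packing its two segments, so no two pairs
  -- (u , v) share a term.
  product-unique : Unique (Λ n T *W Λ m T')
  product-unique = concatMap-unique-by Λ-unique
    (λ u∈ → concatMap-unique-by Λ-unique (λ v∈ → inner (∈-Λ⁻ u∈) (∈-Λ⁻ v∈))
      λ {v} {v'} v∈ v'∈ x∈ x∈' → proj₂ (outer (∈-Λ⁻ u∈) (∈-Λ⁻ v∈) (∈-Λ⁻ u∈) (∈-Λ⁻ v'∈) x∈ x∈'))
    λ {u} {u'} u∈ u'∈ x∈ x∈' →
      let v , v∈ , y∈ = ∈-concatMap⁻′ (multW u) (Λ m T') x∈
          v' , v'∈ , y∈' = ∈-concatMap⁻′ (multW u') (Λ m T') x∈'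
      in proj₁ (outer (∈-Λ⁻ u∈) (∈-Λ⁻ v∈) (∈-Λ⁻ u'∈) (∈-Λ⁻ v'∈) y∈ y∈')
    where
    inner : ∀ {u v} → Extension T u → Extension T' v → Unique (multW u v)
    inner (u , refl , Pu , _) (v , refl , Pv , _) = multW-unique {u = u} {v} Pu Pv
    outer : ∀ {u v u' v' x} → Extension T u → Extension T' v → Extension T u' → Extension T' v' → x ∈ multW u v → x ∈ multW u' v' → u ≡ u' × v ≡ v'
    outer (u , refl , Pu , _) (v , refl , Pv , _) (u' , refl , Pu' , _) (v' , refl , Pv' , _) x∈ x∈'
      with ∈-multW⁻ {u = u} {v} Pu Pv x∈ | ∈-multW⁻ {u = u'} {v'} Pu' Pv' x∈'
    ... | w₁ , w₂ , eq , s | w₁' , w₂' , eq' , s' =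
      cong V.toList (strictInc-injective w₁ w₁' Pu Pu' (S.len₁ s) (S.len₁ s') (S.inc₁ s) (S.inc₁ s') (proj₁ parts)) ,
      cong V.toList (strictInc-injective w₂ w₂' Pv Pv' (S.len₂ s) (S.len₂ s') (S.inc₂ s) (S.inc₂ s') (proj₂ parts))
      where
      module S = Shuffle
      parts : V.map (at w₁) u ≡ V.map (at w₁') u' × V.map (at w₂) v ≡ V.map (at w₂') v'
      parts = Vₚ.++-injective (V.map (at w₁) u) (V.map (at w₁') u') (toList-inj (trans (sym eq) eq'))

  product-⊆ : IsTopology T → IsTopology T' → ∀ {x} → x ∈ Λ (n + m) (prodT T T') → x ∈ (Λ n T *W Λ m T')
  product-⊆ top top' x∈ with ∈-Λ⁻ {T = prodT T T'} x∈
  ... | v , refl , P , C with V.splitAt n v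
  ... | a , b , refl = ∈-concatMap⁺′ (λ u → concatMap (multW u) (Λ m T'))
      (∈-Λ⁺ {T = T} Pu (compat-reorder a u (packV-preserves a) (packV-reflects a) (compat-++⁻ˡ {T = T} {T'} top top' a b C)))
      (∈-concatMap⁺′ (multW (V.toList u))
        (∈-Λ⁺ {T = T'} Pu' (compat-reorder b u' (packV-preserves b) (packV-reflects b) (compat-++⁻ʳ {T = T} {T'} top top' a b C)))
        (subst (λ z → V.toList z ∈ multW (V.toList u) (V.toList u')) (cong₂ V._++_ a≡ b≡)
          (∈-multW⁺ {u = u} {u'} Pu Pu' w₁ w₂ record
            { len₁ = len₁ ; len₂ = len₂
            ; packed = packed-resp {w' = w₁ ++ w₂} to from P
            ; inc₁ = factor-strictInc u a w₁ Pu (packV-reflects a) len₁ fac₁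
            ; inc₂ = factor-strictInc u' b w₂ Pu' (packV-reflects b) len₂ fac₂ })))
    where
    u = packV a
    u' = packV b
    Pu : Packed (V.toList u)
    Pu = packV-packed a λ i → proj₁ P (∈-vec-++⁺ˡ a b (∈-toList⁺ a i))
    Pu' : Packed (V.toList u')
    Pu' = packV-packed b λ i → proj₁ P (∈-vec-++⁺ʳ a b (∈-toList⁺ b i))
    -- Packing preserves strict inequalities, hence letters of equal rank are equal and `a` factors
    -- through `u`.
    F₁ = factor u Pu a (reflect-≡ u a (packV-preserves a))
    F₂ = factor u' Pu' b (reflect-≡ u' b (packV-preserves b))
    w₁ = proj₁ F₁
    w₂ = proj₁ F₂
    len₁ : L.length w₁ ≡ maxW (V.toList u)
    len₁ = proj₁ (proj₂ F₁)
    len₂ : L.length w₂ ≡ maxW (V.toList u')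
    len₂ = proj₁ (proj₂ F₂)
    fac₁ : ∀ i → at w₁ (lookup u i) ≡ lookup a i
    fac₁ = proj₂ (proj₂ F₁)
    fac₂ : ∀ i → at w₂ (lookup u' i) ≡ lookup b i
    fac₂ = proj₂ (proj₂ F₂)
    a≡ : V.map (at w₁) u ≡ a
    a≡ = vec-ext λ i → trans (Vₚ.lookup-map i (at w₁) u) (fac₁ i)
    b≡ : V.map (at w₂) u' ≡ b
    b≡ = vec-ext λ i → trans (Vₚ.lookup-map i (at w₂) u') (fac₂ i)
    to : ∀ {c} → c ∈ V.toList (a V.++ b) → c ∈ w₁ ++ w₂
    to c∈ with ∈-vec-++⁻ a b c∈
    ... | inj₁ p = ∈-++⁺ˡ (∈-compose⁻ u Pu w₁ len₁ (subst (λ z → _ ∈ V.toList z) (sym a≡) p))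
    ... | inj₂ p = ∈-++⁺ʳ w₁ (∈-compose⁻ u' Pu' w₂ len₂ (subst (λ z → _ ∈ V.toList z) (sym b≡) p))
    from : ∀ {c} → c ∈ w₁ ++ w₂ → c ∈ V.toList (a V.++ b)
    from c∈ with ∈-++⁻ w₁ c∈
    ... | inj₁ p = ∈-vec-++⁺ˡ a b (subst (λ z → _ ∈ V.toList z) a≡ (∈-compose⁺ u Pu w₁ len₁ p))
    ... | inj₂ p = ∈-vec-++⁺ʳ a b (subst (λ z → _ ∈ V.toList z) b≡ (∈-compose⁺ u' Pu' w₂ len₂ p))

  product-⊇ : IsTopology T → IsTopology T' → ∀ {x} → x ∈ (Λ n T *W Λ m T') → x ∈ Λ (n + m) (prodT T T')
  product-⊇ top top' x∈ with ∈-concatMap⁻′ (λ u → concatMap (multW u) (Λ m T')) (Λ n T) x∈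
  ... | u , u∈ , y∈ with ∈-concatMap⁻′ (multW u) (Λ m T') y∈
  ... | v , v∈ , z∈ with ∈-Λ⁻ {T = T} u∈ | ∈-Λ⁻ {T = T'} v∈
  ... | u , refl , Pu , C | v , refl , Pv , D with ∈-multW⁻ {u = u} {v} Pu Pv z∈
  ... | w₁ , w₂ , refl , s = ∈-Λ⁺ {T = prodT T T'}
      (packed-resp {w₁ ++ w₂} to from packed)
      (compat-++⁺ {T = T} {T'} top top' a b
        (compat-reorder u a (strictInc-preserves u Pu w₁ len₁ inc₁) (strictInc-reflects u Pu w₁ len₁ inc₁) C)
        (compat-reorder v b (strictInc-preserves v Pv w₂ len₂ inc₂) (strictInc-reflects v Pv w₂ len₂ inc₂) D))
    where
    open Shuffle s
    a = V.map (at w₁) u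
    b = V.map (at w₂) v
    to : ∀ {c} → c ∈ w₁ ++ w₂ → c ∈ V.toList (a V.++ b)
    to c∈ with ∈-++⁻ w₁ c∈
    ... | inj₁ p = ∈-vec-++⁺ˡ a b (∈-compose⁺ u Pu w₁ len₁ p)
    ... | inj₂ p = ∈-vec-++⁺ʳ a b (∈-compose⁺ v Pv w₂ len₂ p)
    from : ∀ {c} → c ∈ V.toList (a V.++ b) → c ∈ w₁ ++ w₂
    from c∈ with ∈-vec-++⁻ a b c∈
    ... | inj₁ p = ∈-++⁺ˡ (∈-compose⁻ u Pu w₁ len₁ p)
    ... | inj₂ p = ∈-++⁺ʳ w₁ (∈-compose⁻ v Pv w₂ len₂ p)

  Λ-product : IsTopology T → IsTopology T' → Λ (n + m) (prodT T T') ↭ (Λ n T *W Λ m T')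
  Λ-product top top' = unique-↭ Λ-unique product-unique (product-⊆ top top') (product-⊇ top top')

-- Restriction to a subset

emb : ∀ {n} (Y : Sub n) → Fin (size Y) → Fin n
emb (true ∷ Y) zero = zero
emb (true ∷ Y) (suc i) = suc (emb Y i)
emb (false ∷ Y) i = suc (emb Y i)

select : ∀ {A : Set} {n} (Y : Sub n) → Vec A n → Vec A (size Y)
select [] [] = []
select (true ∷ Y) (a ∷ v) = a ∷ select Y v
select (false ∷ Y) (a ∷ v) = select Y v

emb-∈ : ∀ {n} (Y : Sub n) i → (emb Y i ∈ˢ Y) ≡ true
emb-∈ (true ∷ Y) zero = refl
emb-∈ (true ∷ Y) (suc i) = emb-∈ Y i
emb-∈ (false ∷ Y) i = emb-∈ Y i

emb-surjective : ∀ {n} (Y : Sub n) x → (x ∈ˢ Y) ≡ true → ∃ λ i → emb Y i ≡ x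
emb-surjective (true ∷ Y) zero _ = zero , refl
emb-surjective (true ∷ Y) (suc x) x∈ = let i , eq = emb-surjective Y x x∈ in suc i , cong suc eq
emb-surjective (false ∷ Y) (suc x) x∈ = let i , eq = emb-surjective Y x x∈ in i , cong suc eq

lookup-select : ∀ {A : Set} {n} (Y : Sub n) (v : Vec A n) i → lookup (select Y v) i ≡ lookup v (emb Y i)
lookup-select (true ∷ Y) (a ∷ v) zero = refl
lookup-select (true ∷ Y) (a ∷ v) (suc i) = lookup-select Y v i
lookup-select (false ∷ Y) (a ∷ v) i = lookup-select Y v i

lookup-embed : ∀ {n} (Y : Sub n) S i → lookup (embed Y S) (emb Y i) ≡ lookup S i
lookup-embed (true ∷ Y) (b ∷ S) zero = refl
lookup-embed (true ∷ Y) (b ∷ S) (suc i) = lookup-embed Y S i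
lookup-embed (false ∷ Y) S i = lookup-embed Y S i

embed-⊆ : ∀ {n} (Y : Sub n) S x → lookup (embed Y S) x ≡ true → (x ∈ˢ Y) ≡ true
embed-⊆ (true ∷ Y) (b ∷ S) zero _ = refl
embed-⊆ (true ∷ Y) (b ∷ S) (suc x) h = embed-⊆ Y S x h
embed-⊆ (false ∷ Y) S (suc x) h = embed-⊆ Y S x h

embed-select : ∀ {n} (Y W : Sub n) → W ∩ˢ Y ≡ embed Y (select Y W)
embed-select [] [] = refl
embed-select (true ∷ Y) (true ∷ W) = cong (true ∷_) (embed-select Y W)
embed-select (true ∷ Y) (false ∷ W) = cong (false ∷_) (embed-select Y W)
embed-select (false ∷ Y) (true ∷ W) = cong (false ∷_) (embed-select Y W)
embed-select (false ∷ Y) (false ∷ W) = cong (false ∷_) (embed-select Y W)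

select-embed : ∀ {n} (Y : Sub n) S → select Y (embed Y S) ≡ S
select-embed Y S = vec-ext λ i → trans (lookup-select Y (embed Y S) i) (lookup-embed Y S i)

select-∩ : ∀ {n} (Y W : Sub n) → select Y (W ∩ˢ Y) ≡ select Y W
select-∩ Y W = trans (cong (select Y) (embed-select Y W)) (select-embed Y (select Y W))

module _ {n : ℕ} {T : Fam n} {Y : Sub n} where

  restrict⁻ : ∀ {S} → restrict T Y S ≡ true → ∃ λ W → T W ≡ true × S ≡ select Y W
  restrict⁻ {S} h = let W , _ , p = anyᵇ⁻ (allSubs n) h
                        oW , eq = ∧-true⁻ {T W} p
                    in W , oW , trans (sym (select-embed Y S)) (trans (cong (select Y) (sym (eqSub⁻ eq))) (select-∩ Y W))

  restrict⁺ : ∀ {W} → T W ≡ true → restrict T Y (select Y W) ≡ true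
  restrict⁺ {W} oW = anyᵇ⁺ (∈-allSubs W) (∧-true⁺ oW
    (subst (λ Z → eqSub (W ∩ˢ Y) Z ≡ true) (embed-select Y W) (eqSub-refl (W ∩ˢ Y))))

  leq-restrict : ∀ i j → leqᵀ (restrict T Y) i j ≡ leqᵀ T (emb Y i) (emb Y j)
  leq-restrict i j = bool-ext
    (λ le → leq⁺ λ {W} oW i∈ → trans (sym (lookup-select Y W j))
      (leq⁻ {T = restrict T Y} le {select Y W} (restrict⁺ oW) (trans (lookup-select Y W i) i∈)))
    (λ le → leq⁺ λ {S} oS i∈ → from le S (restrict⁻ oS) i∈)
    where
    from : leqᵀ T (emb Y i) (emb Y j) ≡ true → ∀ S → (∃ λ W → T W ≡ true × S ≡ select Y W) →
      lookup S i ≡ true → lookup S j ≡ true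
    from le _ (W , oW , refl) i∈ = trans (lookup-select Y W j) (leq⁻ {T = T} le {W} oW (trans (sym (lookup-select Y W i)) i∈))

compat-restrict : ∀ {n} {T : Fam n} (Y : Sub n) (v : Vec ℕ n) → Compat (leqᵀ T) v → Compat (leqᵀ (restrict T Y)) (select Y v)
compat-restrict {T = T} Y v = compat-pullback v (select Y v) (emb Y) (leq-restrict {T = T} {Y})
  (λ i j → subst₂ _<_ (sym (lookup-select Y v i)) (sym (lookup-select Y v j)))
  (λ i j → subst₂ _≡_ (sym (lookup-select Y v i)) (sym (lookup-select Y v j)))

-- Splitting and merging along a subset

merge : ∀ {A : Set} {n} (Y : Sub n) → Vec A (size (∁ˢ Y)) → Vec A (size Y) → Vec A n
merge [] [] [] = []
merge (true ∷ Y) p (b ∷ q) = b ∷ merge Y p q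
merge (false ∷ Y) (a ∷ p) q = a ∷ merge Y p q

-- Each case carries the preimage: matching on its equation turns `x` into an embedded position, to
-- which the lookup equations of a merged word apply.
data Position {n} (Y : Sub n) (x : Fin n) : Set where
  inside : ∀ i → emb Y i ≡ x → Position Y x
  outside : ∀ i → emb (∁ˢ Y) i ≡ x → Position Y x

position : ∀ {n} (Y : Sub n) x → Position Y x
position Y x with x ∈ˢ Y in eq
... | true = let i , e = emb-surjective Y x eq in inside i e
... | false = let i , e = emb-surjective (∁ˢ Y) x (trans (Vₚ.lookup-map x not Y) (cong not eq)) in outside i e

module _ {A : Set} where

  select-mergeʳ : ∀ {n} (Y : Sub n) (p : Vec A (size (∁ˢ Y))) q → select Y (merge Y p q) ≡ q
  select-mergeʳ [] [] [] = refl
  select-mergeʳ (true ∷ Y) p (b ∷ q) = cong (b ∷_) (select-mergeʳ Y p q)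
  select-mergeʳ (false ∷ Y) (a ∷ p) q = select-mergeʳ Y p q

  select-mergeˡ : ∀ {n} (Y : Sub n) (p : Vec A (size (∁ˢ Y))) q → select (∁ˢ Y) (merge Y p q) ≡ p
  select-mergeˡ [] [] [] = refl
  select-mergeˡ (true ∷ Y) p (b ∷ q) = select-mergeˡ Y p q
  select-mergeˡ (false ∷ Y) (a ∷ p) q = cong (a ∷_) (select-mergeˡ Y p q)

  merge-select : ∀ {n} (Y : Sub n) (v : Vec A n) → merge Y (select (∁ˢ Y) v) (select Y v) ≡ v
  merge-select [] [] = refl
  merge-select (true ∷ Y) (a ∷ v) = cong (a ∷_) (merge-select Y v)
  merge-select (false ∷ Y) (a ∷ v) = cong (a ∷_) (merge-select Y v)

  -- Links two descriptions of a subword: letters kept by a test, as in `ΔW`, and positions kept by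
  -- a subset, as in `restrict`.
  filter-select : ∀ {n} (P : A → Bool) (Y : Sub n) (v : Vec A n) → (∀ i → lookup Y i ≡ P (lookup v i)) →
    filterᵇ P (V.toList v) ≡ V.toList (select Y v)
  filter-select P [] [] _ = refl
  filter-select P (b ∷ Y) (a ∷ v) h with P a | h zero
  ... | true | refl = cong (a ∷_) (filter-select P Y v (h ∘ suc))
  ... | false | refl = filter-select P Y v (h ∘ suc)

-- Coproduct

above : ∀ {n} → ℕ → Vec ℕ n → Sub n
above k v = V.map (k <ᵇ_) v

module _ {n : ℕ} (k : ℕ) (v : Vec ℕ n) where

  filter-above : filterᵇ (λ a → k <ᵇ a) (V.toList v) ≡ V.toList (select (above k v) v)
  filter-above = filter-select _ (above k v) v λ i → Vₚ.lookup-map i _ v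

  filter-below : filterᵇ (λ a → a ≤ᵇ k) (V.toList v) ≡ V.toList (select (∁ˢ (above k v)) v)
  filter-below = filter-select _ (∁ˢ (above k v)) v λ i →
    trans (Vₚ.lookup-map i not (above k v)) (trans (cong not (Vₚ.lookup-map i _ v)) (not-<ᵇ (lookup v i)))
    where
    not-<ᵇ : ∀ a → not (k <ᵇ a) ≡ (a ≤ᵇ k)
    not-<ᵇ a = bool-ext
      (λ h → ≤ᵇ-true⁺ {a} {k} (ℕₚ.≮⇒≥ λ lt → not-true⁻ h (<ᵇ-true⁺ {k} {a} lt)))
      (λ h → not-true⁺ λ lt → ℕₚ.<⇒≱ (<ᵇ-true⁻ lt) (≤ᵇ-true⁻ {a} h))

  select-above-> : ∀ i → k < lookup (select (above k v) v) i
  select-above-> i = subst (k <_) (sym (lookup-select (above k v) v i))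
    (<ᵇ-true⁻ (trans (sym (Vₚ.lookup-map (emb (above k v) i) _ v)) (emb-∈ (above k v) i)))

  module _ (P : Packed (V.toList v)) where

    below-packed : Packed (filterᵇ (λ a → a ≤ᵇ k) (V.toList v))
    below-packed = (λ a∈ → proj₁ P (proj₁ (∈-filterᵇ⁻ {xs = V.toList v} a∈))) ,
      λ {a} a∈ 1≤c c≤a → let a∈v , a≤k = ∈-filterᵇ⁻ {xs = V.toList v} a∈ in
        ∈-filterᵇ⁺ (proj₂ P a∈v 1≤c c≤a) (≤ᵇ-true⁺ (ℕₚ.≤-trans c≤a (≤ᵇ-true⁻ {a} a≤k)))

    -- Packedness makes `k` itself a letter unless it is 0, the maximum of the empty word. The
    -- height of a cut is thereby recovered from its lower part.
    maxW-below : k ≤ maxW (V.toList v) → maxW (filterᵇ (λ a → a ≤ᵇ k) (V.toList v)) ≡ k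
    maxW-below k≤ = ℕₚ.≤-antisym
      (maxW≤ λ {a} a∈ → ≤ᵇ-true⁻ {a} (proj₂ (∈-filterᵇ⁻ {xs = V.toList v} a∈)))
      (attained k≤ refl)
      where
      attained : ∀ {c} → c ≤ maxW (V.toList v) → c ≡ k → c ≤ maxW (filterᵇ (λ a → a ≤ᵇ k) (V.toList v))
      attained {zero} _ _ = z≤n
      attained {suc c} c≤ eq = ∈⇒≤maxW (∈-filterᵇ⁺ (packed-surj P (s≤s z≤n) c≤) (≤ᵇ-true⁺ (ℕₚ.≤-reflexive eq)))

    -- The letters of a packed word above `k` leave no gap after `k`, so packing them is subtracting
    -- `k`.
    shift-packV-above : V.map (k +_) (packV (select (above k v) v)) ≡ select (above k v) v
    shift-packV-above = trans (cong (V.map (k +_)) (packV-unique s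
        (λ i → ℕₚ.≤-trans (s≤s z≤n) (select-above-> i)) s'-packed
        (λ i j lt → subst₂ _<_ (sym (s'-lookup i)) (sym (s'-lookup j)) (ℕₚ.∸-monoˡ-< lt (ℕₚ.<⇒≤ (select-above-> i))))
        λ i j lt → ℕₚ.≰⇒> λ le → ℕₚ.<⇒≱ lt (subst₂ _≤_ (sym (s'-lookup j)) (sym (s'-lookup i)) (ℕₚ.∸-monoˡ-≤ k le))))
      (vec-ext λ i → trans (Vₚ.lookup-map i (k +_) s') (trans (cong (k +_) (s'-lookup i)) (ℕₚ.m+[n∸m]≡n (ℕₚ.<⇒≤ (select-above-> i)))))
      where
      Y = above k v
      s = select Y v
      s' = V.map (_∸ k) s
      s'-lookup : ∀ i → lookup s' i ≡ lookup s i ∸ k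
      s'-lookup i = Vₚ.lookup-map i (_∸ k) s
      s'-packed : Packed (V.toList s')
      s'-packed = (λ a∈ → let i , eq = ∈-toList⁻ s' a∈ in subst (1 ≤_) (trans (sym (s'-lookup i)) eq) (ℕₚ.m<n⇒0<n∸m (select-above-> i))) ,
        -- The letter `c` comes from the letter `k + c` of `v`, which occurs because `v` is packed,
        -- at a position in `Y` because `c` is positive.
        λ {a} {c} a∈ 1≤c c≤a →
          let i , eq = ∈-toList⁻ s' a∈
              le = subst (k + c ≤_) (trans (cong (k +_) (trans (sym eq) (s'-lookup i))) (trans (ℕₚ.m+[n∸m]≡n (ℕₚ.<⇒≤ (select-above-> i))) (lookup-select Y v i)))
                     (ℕₚ.+-monoʳ-≤ k c≤a)
              x , eqx = ∈-toList⁻ v (proj₂ P (∈-toList⁺ v (emb Y i)) (ℕₚ.≤-trans 1≤c (ℕₚ.m≤n+m c k)) le)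
              x∈Y = trans (Vₚ.lookup-map x (k <ᵇ_) v) (<ᵇ-true⁺ (subst (k <_) (sym eqx) (subst (_≤ k + c) (ℕₚ.+-comm k 1) (ℕₚ.+-monoʳ-≤ k 1≤c))))
              j , eqj = emb-surjective Y x x∈Y
          in subst (_∈ V.toList s') (trans (s'-lookup j) (trans (cong (_∸ k) (trans (lookup-select Y v j) (trans (cong (lookup v) eqj) eqx))) (ℕₚ.m+n∸m≡n k c)))
               (∈-toList⁺ s' j)

module _ {n : ℕ} {Y : Sub n} {v v' : Vec ℕ n} {k k' : ℕ} (P : Packed (V.toList v)) (P' : Packed (V.toList v'))
  (k≤ : k ≤ maxW (V.toList v)) (k'≤ : k' ≤ maxW (V.toList v')) (Y≡ : Y ≡ above k v) (Y≡' : Y ≡ above k' v')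
  (low : filterᵇ (λ a → a ≤ᵇ k) (V.toList v) ≡ filterᵇ (λ a → a ≤ᵇ k') (V.toList v'))
  (high : pack (filterᵇ (λ a → k <ᵇ a) (V.toList v)) ≡ pack (filterᵇ (λ a → k' <ᵇ a) (V.toList v'))) where

  cut-unique : k ≡ k'
  cut-unique = trans (sym (maxW-below k v P k≤)) (trans (cong maxW low) (maxW-below k' v' P' k'≤))

  -- The two parts of a cut fix the letters but not their positions; `Y` supplies the positions, and
  -- `cut-unique` the amount by which the packed upper part is raised.
  word-unique : v ≡ v'
  word-unique = trans (sym (merge-select Y v)) (trans (cong₂ (merge Y) p≡ q≡) (merge-select Y v'))
    where
    below≡ : ∀ {k v} → Y ≡ above k v → filterᵇ (λ a → a ≤ᵇ k) (V.toList v) ≡ V.toList (select (∁ˢ Y) v)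
    below≡ {k} {v} refl = filter-below k v
    above≡ : ∀ {k v} → Y ≡ above k v → pack (filterᵇ (λ a → k <ᵇ a) (V.toList v)) ≡ V.toList (packV (select Y v))
    above≡ {k} {v} refl = trans (cong pack (filter-above k v)) (sym (toList-packV (select (above k v) v)))
    unshift : ∀ {k v} → Packed (V.toList v) → Y ≡ above k v → V.map (k +_) (packV (select Y v)) ≡ select Y v
    unshift {k} {v} P refl = shift-packV-above k v P
    p≡ : select (∁ˢ Y) v ≡ select (∁ˢ Y) v'
    p≡ = toList-inj (trans (sym (below≡ Y≡)) (trans low (below≡ Y≡')))
    packed≡ : packV (select Y v) ≡ packV (select Y v')
    packed≡ = toList-inj (trans (sym (above≡ Y≡)) (trans high (above≡ Y≡')))
    q≡ : select Y v ≡ select Y v'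
    q≡ = trans (sym (unshift P Y≡)) (trans (cong₂ (λ c → V.map (c +_)) cut-unique packed≡) (unshift P' Y≡'))

pairs : ∀ {A B : Set} → List A → List B → List (A × B)
pairs xs ys = concatMap (λ u → L.map (u ,_) ys) xs

pairs≡× : ∀ {A B : Set} (xs : List A) (ys : List B) → pairs xs ys ≡ L.cartesianProduct xs ys
pairs≡× [] ys = refl
pairs≡× (x ∷ xs) ys = cong (L.map (x ,_) ys ++_) (pairs≡× xs ys)

pairs-unique : ∀ {A B : Set} {xs : List A} {ys : List B} → Unique xs → Unique ys → Unique (pairs xs ys)
pairs-unique {xs = xs} {ys} ux uy = subst Unique (sym (pairs≡× xs ys)) (Uniqueₚ.cartesianProduct⁺ ux uy)

∈-pairs⁻ : ∀ {A B : Set} (xs : List A) (ys : List B) {a b} → (a , b) ∈ pairs xs ys → a ∈ xs × b ∈ ys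
∈-pairs⁻ xs ys h = ∈ₚ.∈-cartesianProduct⁻ xs ys (subst (_ ∈_) (pairs≡× xs ys) h)

∈-pairs⁺ : ∀ {A B : Set} {xs : List A} {ys : List B} {a b} → a ∈ xs → b ∈ ys → (a , b) ∈ pairs xs ys
∈-pairs⁺ {xs = xs} {ys} p q = subst (_ ∈_) (sym (pairs≡× xs ys)) (∈ₚ.∈-cartesianProduct⁺ p q)

-- The pairs in the two coproducts occur with multiplicities, so each is tagged with the open set it comes from.
module _ {n : ℕ} (T : Fam n) where

  private
    Tagged : Set
    Tagged = Sub n × Word × Word

  cutAt : Vec ℕ n → ℕ → Tagged
  cutAt v k = above k v , filterᵇ (λ a → a ≤ᵇ k) (V.toList v) , pack (filterᵇ (λ a → k <ᵇ a) (V.toList v))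

  cuts : Vec ℕ n → List Tagged
  cuts v = L.map (cutAt v) (L.upTo (suc (maxW (V.toList v))))

  opens : Sub n → List Tagged
  opens Y = if T Y then L.map (Y ,_) (pairs (Λ _ (restrict T (∁ˢ Y))) (Λ _ (restrict T Y))) else []

  untag-cuts : ∀ vs → L.map proj₂ (concatMap cuts vs) ≡ ΔW* (L.map V.toList vs)
  untag-cuts [] = refl
  untag-cuts (v ∷ vs) = trans (Lₚ.map-++ proj₂ (cuts v) (concatMap cuts vs))
    (cong₂ _++_ (sym (Lₚ.map-∘ (L.upTo (suc (maxW (V.toList v)))))) (untag-cuts vs))

  untag-opens : ∀ Ys → L.map proj₂ (concatMap opens Ys) ≡
    ΛΛ (concatMap (λ Y → if T Y then ((_ , restrict T (∁ˢ Y)) , (_ , restrict T Y)) ∷ [] else []) Ys)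
  untag-opens [] = refl
  untag-opens (Y ∷ Ys) with T Y
  ... | true = trans (Lₚ.map-++ proj₂ (L.map (Y ,_) ps) (concatMap opens Ys))
      (cong₂ _++_ (trans (sym (Lₚ.map-∘ ps)) (Lₚ.map-id ps)) (untag-opens Ys))
    where
    ps = pairs (Λ _ (restrict T (∁ˢ Y))) (Λ _ (restrict T Y))
  ... | false = untag-opens Ys

  ∈-opens⁻ : ∀ {Y Z p q} → (Z , p , q) ∈ opens Y →
    Z ≡ Y × T Y ≡ true × p ∈ Λ _ (restrict T (∁ˢ Y)) × q ∈ Λ _ (restrict T Y)
  ∈-opens⁻ {Y} h with T Y
  ... | true with ∈-map⁻ (Y ,_) h
  ... | _ , r , refl = refl , refl , ∈-pairs⁻ (Λ _ (restrict T (∁ˢ Y))) (Λ _ (restrict T Y)) r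

  ∈-opens⁺ : ∀ {Y p q} → T Y ≡ true → p ∈ Λ _ (restrict T (∁ˢ Y)) → q ∈ Λ _ (restrict T Y) → (Y , p , q) ∈ opens Y
  ∈-opens⁺ {Y} oY p∈ q∈ rewrite oY = ∈-map⁺ (Y ,_) (∈-pairs⁺ p∈ q∈)

  opens-unique : Unique (concatMap opens (allSubs n))
  opens-unique = concatMap-unique-by (allSubs-unique n) (λ {Y} _ → each Y)
    λ _ _ h h' → trans (sym (proj₁ (∈-opens⁻ h))) (proj₁ (∈-opens⁻ h'))
    where
    each : ∀ Y → Unique (opens Y)
    each Y with T Y
    ... | true = Uniqueₚ.map⁺ (cong proj₂) (pairs-unique (Λ-unique {T = restrict T (∁ˢ Y)}) (Λ-unique {T = restrict T Y}))
    ... | false = []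

  ∈-cuts⁻ : ∀ {v t} → t ∈ cuts v → ∃ λ k → k ≤ maxW (V.toList v) × t ≡ cutAt v k
  ∈-cuts⁻ {v} t∈ = let k , k∈ , eq = ∈-map⁻ (cutAt v) t∈ in k , ℕ.s≤s⁻¹ (∈-upTo⁻ k∈) , eq

  cuts-unique : Unique (concatMap cuts (ΛV n T))
  cuts-unique = concatMap-unique-by (ΛV-unique {T = T})
    (λ {v} v∈ → let P = proj₁ (∈-ΛV⁻ {T = T} v∈) in
      map-unique (Uniqueₚ.upTo⁺ (suc (maxW (V.toList v)))) λ {k} {k'} k∈ k'∈ eq →
        cut-unique {v = v} {v} P P (ℕ.s≤s⁻¹ (∈-upTo⁻ k∈)) (ℕ.s≤s⁻¹ (∈-upTo⁻ k'∈)) refl (cong proj₁ eq) (cong (proj₁ ∘ proj₂) eq) (cong (proj₂ ∘ proj₂) eq))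
    λ {v} {v'} v∈ v'∈ t∈ t∈' →
      let k , k≤ , eq = ∈-cuts⁻ {v} t∈
          k' , k'≤ , eq' = ∈-cuts⁻ {v'} t∈'
          e = trans (sym eq) eq'
      in word-unique {v = v} {v'} {k} {k'} (proj₁ (∈-ΛV⁻ {T = T} v∈)) (proj₁ (∈-ΛV⁻ {T = T} v'∈)) k≤ k'≤ refl
           (cong proj₁ e) (cong (proj₁ ∘ proj₂) e) (cong (proj₂ ∘ proj₂) e)

  module _ (top : IsTopology T) where

    coproduct-⊆ : ∀ {t} → t ∈ concatMap cuts (ΛV n T) → t ∈ concatMap opens (allSubs n)
    coproduct-⊆ t∈ with ∈-concatMap⁻′ cuts (ΛV n T) t∈
    ... | v , v∈ , s∈ with ∈-cuts⁻ {v} s∈ | ∈-ΛV⁻ {T = T} v∈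
    ... | k , k≤ , refl | P , C = ∈-concatMap⁺′ opens (∈-allSubs Y) (∈-opens⁺ Y-open
          (subst (_∈ Λ _ (restrict T (∁ˢ Y))) (sym (filter-below k v))
            (∈-Λ⁺ {T = restrict T (∁ˢ Y)} (subst Packed (filter-below k v) (below-packed k v P)) (compat-restrict {T = T} (∁ˢ Y) v C)))
          (subst (_∈ Λ _ (restrict T Y)) (trans (toList-packV s) (cong pack (sym (filter-above k v))))
            (∈-Λ⁺ {T = restrict T Y} (packV-packed s λ i → ℕₚ.≤-trans (s≤s z≤n) (select-above-> k v i))
              (compat-reorder s (packV s) (packV-preserves s) (packV-reflects s) (compat-restrict {T = T} Y v C)))))
      where
      Y = above k v
      s = select Y v
      -- A compatible word is weakly increasing along the quasi-order, so the positions of its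
      -- letters above `k` form a final segment.
      Y-open : T Y ≡ true
      Y-open = upClosed⇒open top λ {x} {y} x∈ le → trans (Vₚ.lookup-map y _ v)
        (<ᵇ-true⁺ (ℕₚ.<-≤-trans (<ᵇ-true⁻ (trans (sym (Vₚ.lookup-map x _ v)) x∈)) (compat-≤ {v = v} C le)))

    coproduct-⊇ : ∀ {t} → t ∈ concatMap opens (allSubs n) → t ∈ concatMap cuts (ΛV n T)
    coproduct-⊇ t∈ with ∈-concatMap⁻′ opens (allSubs n) t∈
    ... | Y , _ , s∈ with ∈-opens⁻ {Y} s∈
    ... | refl , oY , p∈ , q∈ with ∈-Λ⁻ {T = restrict T (∁ˢ Y)} p∈ | ∈-Λ⁻ {T = restrict T Y} q∈
    ... | p , refl , Pp , Cp | q , refl , Pq , Cq =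
        ∈-concatMap⁺′ cuts (∈-ΛV⁺ {T = T} v-packed v-compat)
          (subst (_∈ cuts v) cut≡ (∈-map⁺ (cutAt v) (∈-upTo⁺ (s≤s k≤))))
      where
      -- The only possible height: the lower part of a cut at `k` has maximum `k`. The upper word is
      -- raised by the same amount.
      k = maxW (V.toList p)
      q' = V.map (k +_) q
      v = merge Y p q'
      v-in : ∀ i → lookup v (emb Y i) ≡ k + lookup q i
      v-in i = trans (sym (lookup-select Y v i)) (trans (cong (λ z → lookup z i) (select-mergeʳ Y p q')) (Vₚ.lookup-map i (k +_) q))
      v-out : ∀ i → lookup v (emb (∁ˢ Y) i) ≡ lookup p i
      v-out i = trans (sym (lookup-select (∁ˢ Y) v i)) (cong (λ z → lookup z i) (select-mergeˡ Y p q'))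
      out∈ : ∀ {c} → c ∈ V.toList p → c ∈ V.toList v
      out∈ c∈ = let i , eq = ∈-toList⁻ p c∈ in subst (_∈ V.toList v) (trans (v-out i) eq) (∈-toList⁺ v (emb (∁ˢ Y) i))
      in∈ : ∀ {c} → c ∈ V.toList q → k + c ∈ V.toList v
      in∈ c∈ = let i , eq = ∈-toList⁻ q c∈ in subst (_∈ V.toList v) (trans (v-in i) (cong (k +_) eq)) (∈-toList⁺ v (emb Y i))
      q-pos : ∀ i → 1 ≤ lookup q i
      q-pos = packed-pos {v = q} Pq
      above-k : ∀ i → k < k + lookup q i
      above-k i = subst (_≤ k + lookup q i) (ℕₚ.+-comm k 1) (ℕₚ.+-monoʳ-≤ k (q-pos i))
      v-packed : Packed (V.toList v)
      v-packed = (λ a∈ → let x , eq = ∈-toList⁻ v a∈ in subst (1 ≤_) eq (pos x (position Y x))) ,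
        (λ a∈ 1≤c c≤a → let x , eq = ∈-toList⁻ v a∈ in down x (position Y x) 1≤c (subst (_ ≤_) (sym eq) c≤a))
        where
        pos : ∀ x → Position Y x → 1 ≤ lookup v x
        pos _ (inside i refl) = subst (1 ≤_) (sym (v-in i)) (ℕₚ.≤-trans (q-pos i) (ℕₚ.m≤n+m _ k))
        pos _ (outside i refl) = subst (1 ≤_) (sym (v-out i)) (packed-pos {v = p} Pp i)
        down : ∀ x → Position Y x → ∀ {c} → 1 ≤ c → c ≤ lookup v x → c ∈ V.toList v
        down _ (outside i refl) 1≤c c≤ = out∈ (proj₂ Pp (∈-toList⁺ p i) 1≤c (subst (_ ≤_) (v-out i) c≤))
        -- Letters up to `k` are all supplied by `p`, whose maximum is `k`; only those beyond `k`
        -- come from the raised `q`.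
        down _ (inside i refl) {c} 1≤c c≤ with c ℕ.≤? k
        ... | yes c≤k = out∈ (packed-surj Pp 1≤c c≤k)
        ... | no c≰k = subst (_∈ V.toList v) (ℕₚ.m+[n∸m]≡n (ℕₚ.<⇒≤ k<c)) (in∈ (proj₂ Pq (∈-toList⁺ q i) (ℕₚ.m<n⇒0<n∸m k<c)
              (subst (c ∸ k ≤_) (ℕₚ.m+n∸m≡n k _) (ℕₚ.∸-monoˡ-≤ k (subst (c ≤_) (v-in i) c≤)))))
          where
          k<c : k < c
          k<c = ℕₚ.≰⇒> c≰k
      ∉Y : ∀ i → lookup Y (emb (∁ˢ Y) i) ≢ true
      ∉Y i = not-true⁻ (trans (sym (Vₚ.lookup-map (emb (∁ˢ Y) i) not Y)) (emb-∈ (∁ˢ Y) i))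
      -- `Y` is a final segment, so mixed relations can only lead from outside into `Y`. There
      -- compatibility is automatic: letters of `p` are at most `k`, raised letters exceed it.
      escape : ∀ i j → leqᵀ T (emb Y j) (emb (∁ˢ Y) i) ≡ true → ⊥
      escape i j le = ∉Y i (leq⁻ {T = T} le {Y} oY (emb-∈ Y j))
      v-compat : Compat (leqᵀ T) v
      v-compat x y with position Y x | position Y y
      ... | inside i refl | inside j refl rewrite sym (leq-restrict {T = T} {Y} i j) | sym (leq-restrict {T = T} {Y} j i) | v-in i | v-in j =
        (λ a b → ℕₚ.+-monoʳ-< k (proj₁ (Cq i j) a b)) , (λ a b → cong (k +_) (proj₂ (Cq i j) a b))
      ... | outside i refl | outside j refl rewrite sym (leq-restrict {T = T} {∁ˢ Y} i j) | sym (leq-restrict {T = T} {∁ˢ Y} j i) | v-out i | v-out j = Cp i j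
      ... | outside i refl | inside j refl rewrite v-in j | v-out i =
        (λ _ _ → ℕₚ.≤-<-trans (lookup≤maxW p i) (above-k j)) , (λ _ b → ⊥-elim (escape i j b))
      ... | inside j refl | outside i refl = (λ a _ → ⊥-elim (escape i j a)) , (λ a _ → ⊥-elim (escape i j a))
      k≤ : k ≤ maxW (V.toList v)
      k≤ = maxW≤ (∈⇒≤maxW ∘ out∈)
      Y≡ : above k v ≡ Y
      Y≡ = vec-ext λ x → trans (Vₚ.lookup-map x (k <ᵇ_) v) (go x (position Y x))
        where
        go : ∀ x → Position Y x → (k <ᵇ lookup v x) ≡ lookup Y x
        go _ (inside i refl) = trans (<ᵇ-true⁺ (subst (k <_) (sym (v-in i)) (above-k i))) (sym (emb-∈ Y i))
        go _ (outside i refl) = bool-ext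
          (λ lt → ⊥-elim (ℕₚ.<⇒≱ (<ᵇ-true⁻ lt) (subst (_≤ k) (sym (v-out i)) (lookup≤maxW p i))))
          (λ h → ⊥-elim (∉Y i h))
      low : filterᵇ (λ a → a ≤ᵇ k) (V.toList v) ≡ V.toList p
      low = trans (filter-below k v) (trans (cong (λ Z → V.toList (select (∁ˢ Z) v)) Y≡) (cong V.toList (select-mergeˡ Y p q')))
      packV-q' : packV q' ≡ q
      packV-q' = packV-unique q' (λ i → subst (1 ≤_) (sym (Vₚ.lookup-map i (k +_) q)) (ℕₚ.≤-trans (q-pos i) (ℕₚ.m≤n+m _ k))) Pq
        (λ i j lt → ℕₚ.+-cancelˡ-< k _ _ (subst₂ _<_ (Vₚ.lookup-map i (k +_) q) (Vₚ.lookup-map j (k +_) q) lt))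
        (λ i j lt → subst₂ _<_ (sym (Vₚ.lookup-map i (k +_) q)) (sym (Vₚ.lookup-map j (k +_) q)) (ℕₚ.+-monoʳ-< k lt))
      high : pack (filterᵇ (λ a → k <ᵇ a) (V.toList v)) ≡ V.toList q
      high = trans (cong pack (trans (filter-above k v) (trans (cong (λ Z → V.toList (select Z v)) Y≡) (cong V.toList (select-mergeʳ Y p q')))))
        (trans (sym (toList-packV q')) (cong V.toList packV-q'))
      cut≡ : cutAt v k ≡ (Y , V.toList p , V.toList q)
      cut≡ = cong₂ _,_ Y≡ (cong₂ _,_ low high)

    -- A permutation survives forgetting the tags, whereas absence of repetition need not; hence the
    -- comparison takes place before `proj₂` is applied.
    Λ-coproduct : ΔW* (Λ n T) ↭ ΛΛ (ΔT T)
    Λ-coproduct = subst₂ _↭_ (untag-cuts (ΛV n T)) (untag-opens (allSubs n))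
      (map⁺ proj₂ (unique-↭ cuts-unique opens-unique coproduct-⊆ coproduct-⊇))

-- Compositions and block words

compsF⁻ : ∀ f m {is} → is ∈ compsF f m → All (1 ≤_) is × sum is ≡ m
compsF⁻ f zero (here refl) = [] , refl
compsF⁻ (suc f) (suc m) is∈ with ∈-concatMap⁻′ (λ i → L.map (suc i ∷_) (compsF f (m ∸ i))) (L.upTo (suc m)) is∈
... | i , i∈ , js∈ with ∈-map⁻ (suc i ∷_) js∈
... | js , h , refl with compsF⁻ f (m ∸ i) h
... | pos , eq = s≤s z≤n ∷ pos , cong suc (trans (cong (i +_) eq) (ℕₚ.m+[n∸m]≡n (ℕ.s≤s⁻¹ (∈-upTo⁻ i∈))))

-- `f` is fuel: each part uses up one unit of it and at least one unit of `m`, so `m ≤ f` is enough.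
compsF⁺ : ∀ f m {is} → m ≤ f → All (1 ≤_) is → sum is ≡ m → is ∈ compsF f m
compsF⁺ f zero {[]} _ _ _ = here refl
compsF⁺ f zero {zero ∷ is} _ (() ∷ _) _
compsF⁺ (suc f) (suc m) {suc i ∷ is} (s≤s m≤f) (_ ∷ pos) eq =
  ∈-concatMap⁺′ (λ i → L.map (suc i ∷_) (compsF f (m ∸ i))) (∈-upTo⁺ (s≤s (subst (i ≤_) eq' (ℕₚ.m≤m+n i _))))
    (∈-map⁺ (suc i ∷_) (compsF⁺ f (m ∸ i) (ℕₚ.≤-trans (ℕₚ.m∸n≤m m i) m≤f) pos
      (trans (sym (ℕₚ.m+n∸m≡n i (sum is))) (cong (_∸ i) eq'))))
  where
  eq' : i + sum is ≡ m
  eq' = ℕₚ.suc-injective eq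

compsF-unique : ∀ f m → Unique (compsF f m)
compsF-unique f zero = [] ∷ []
compsF-unique zero (suc m) = []
compsF-unique (suc f) (suc m) = concatMap-unique-by (Uniqueₚ.upTo⁺ (suc m))
  (λ {i} _ → Uniqueₚ.map⁺ Lₚ.∷-injectiveʳ (compsF-unique f (m ∸ i)))
  λ {i} {j} _ _ h h' → let _ , _ , eq = ∈-map⁻ (suc i ∷_) h
                           _ , _ , eq' = ∈-map⁻ (suc j ∷_) h'
                       in ℕₚ.suc-injective (Lₚ.∷-injectiveˡ (trans (sym eq) eq'))

length-blockWord : ∀ c is → L.length (blockWordFrom c is) ≡ sum is
length-blockWord c [] = refl
length-blockWord c (i ∷ is) = trans (Lₚ.length-++ (L.replicate i c)) (cong₂ _+_ (Lₚ.length-replicate i) (length-blockWord (suc c) is))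

∈-replicate⁻ : ∀ {i c a : ℕ} → a ∈ L.replicate i c → a ≡ c
∈-replicate⁻ {suc i} (here eq) = eq
∈-replicate⁻ {suc i} (there a∈) = ∈-replicate⁻ a∈

blockWord-≥ : ∀ c is {a} → a ∈ blockWordFrom c is → c ≤ a
blockWord-≥ c (i ∷ is) a∈ with ∈-++⁻ (L.replicate i c) a∈
... | inj₁ h = ℕₚ.≤-reflexive (sym (∈-replicate⁻ h))
... | inj₂ h = ℕₚ.≤-trans (ℕₚ.n≤1+n c) (blockWord-≥ (suc c) is h)

-- A part equal to 0 would skip a letter; positivity of the parts is what makes the block word
-- packed.
blockWord-down : ∀ c {is} → All (1 ≤_) is → ∀ {a d} → a ∈ blockWordFrom c is → c ≤ d → d ≤ a → d ∈ blockWordFrom c is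
blockWord-down c {suc i ∷ is} (_ ∷ pos) a∈ c≤d d≤a with ℕₚ.m≤n⇒m<n∨m≡n c≤d
... | inj₂ refl = here refl
... | inj₁ c<d with ∈-++⁻ (L.replicate (suc i) c) a∈
... | inj₁ h with refl ← ∈-replicate⁻ {suc i} h = ⊥-elim (ℕₚ.<⇒≱ c<d d≤a)
... | inj₂ h = ∈-++⁺ʳ (L.replicate (suc i) c) (blockWord-down (suc c) pos h c<d d≤a)

blockWord-packed : ∀ {is} → All (1 ≤_) is → Packed (blockWord is)
blockWord-packed {is} pos = blockWord-≥ 1 is , blockWord-down 1 pos

blockWord-injective : ∀ c {is js} → All (1 ≤_) is → All (1 ≤_) js → blockWordFrom c is ≡ blockWordFrom c js → is ≡ js
blockWord-injective c [] [] _ = refl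
blockWord-injective c {[]} {suc j ∷ js} [] (_ ∷ _) ()
blockWord-injective c {suc i ∷ is} {[]} (_ ∷ _) [] ()
blockWord-injective c {i ∷ is} {j ∷ js} (_ ∷ pi) (_ ∷ pj) eq = go i j eq
  where
  absurd : ∀ ks {w} → blockWordFrom (suc c) ks ≡ c ∷ w → ⊥
  absurd ks {w} e = ℕₚ.1+n≰n (blockWord-≥ (suc c) ks (subst (c ∈_) (sym e) (here refl)))
  -- Common letters `c` are stripped until a head part reaches 0, which is why the heads are
  -- generalized here. If only one does, `c` would occur among letters that are at least `suc c`.
  go : ∀ i j → blockWordFrom c (i ∷ is) ≡ blockWordFrom c (j ∷ js) → i ∷ is ≡ j ∷ js
  go zero zero e = cong (0 ∷_) (blockWord-injective (suc c) pi pj e)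
  go zero (suc j) e = ⊥-elim (absurd is e)
  go (suc i) zero e = ⊥-elim (absurd js (sym e))
  go (suc i) (suc j) e with refl ← go i j (Lₚ.∷-injectiveʳ e) = refl

at-replicate : ∀ {i c k} → 1 ≤ k → k ≤ i → at (L.replicate i c) k ≡ c
at-replicate {suc i} {c} {suc zero} _ _ = refl
at-replicate {suc i} {c} {suc (suc k)} _ (s≤s k≤) = at-replicate {i} (s≤s z≤n) k≤

data Side (i k : ℕ) : Set where
  low : k ≤ i → Side i k
  high : ∀ k' → 1 ≤ k' → k ≡ i + k' → Side i k

side : ∀ i k → Side i k
side i k with k ℕ.≤? i
... | yes k≤i = low k≤i
... | no k≰i = high (k ∸ i) (ℕₚ.m<n⇒0<n∸m (ℕₚ.≰⇒> k≰i)) (sym (ℕₚ.m+[n∸m]≡n (ℕₚ.<⇒≤ (ℕₚ.≰⇒> k≰i))))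

-- Being increasing on blocks means that the pair (block letter, letter of `w`) increases
-- lexicographically with the position: across blocks the first entry grows, within a block the
-- second does. Hence the lexicographic packing.
blocksInc⁻ : ∀ c is w → L.length w ≡ sum is → blocksIncᵇ is w ≡ true → ∀ {k l} → 1 ≤ k → k < l → l ≤ sum is →
  at (blockWordFrom c is) k < at (blockWordFrom c is) l
  ⊎ (at (blockWordFrom c is) k ≡ at (blockWordFrom c is) l × at w k < at w l)
blocksInc⁻ c [] w len inc {k} {l} 1≤k k<l l≤ = ⊥-elim (ℕₚ.<⇒≱ (ℕₚ.≤-trans (s≤s z≤n) k<l) l≤)
blocksInc⁻ c (i ∷ is) w len inc {k} {l} 1≤k k<l l≤ = go (side i k) (side i l)
  where
  w₁ = L.take i w
  w₂ = L.drop i w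
  B = blockWordFrom (suc c) is
  len₁ : L.length w₁ ≡ i
  len₁ = trans (Lₚ.length-take i w) (ℕₚ.m≤n⇒m⊓n≡m (subst (i ≤_) (sym len) (ℕₚ.m≤m+n i _)))
  len₂ : L.length w₂ ≡ sum is
  len₂ = trans (Lₚ.length-drop i w) (trans (cong (_∸ i) len) (ℕₚ.m+n∸m≡n i (sum is)))
  w-low : ∀ {k} → 1 ≤ k → k ≤ i → at w k ≡ at w₁ k
  w-low {k} 1≤k k≤ = trans (cong (λ z → at z k) (sym (Lₚ.take++drop≡id i w))) (at-++ˡ w₁ w₂ (subst (k ≤_) (sym len₁) k≤) 1≤k)
  w-high : ∀ {k} → 1 ≤ k → at w (i + k) ≡ at w₂ k
  w-high {k} 1≤k = trans (cong₂ at (sym (Lₚ.take++drop≡id i w)) (cong (_+ k) (sym len₁))) (at-++ʳ w₁ w₂ 1≤k)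
  B-low : ∀ {k} → 1 ≤ k → k ≤ i → at (L.replicate i c ++ B) k ≡ c
  B-low {k} 1≤k k≤ = trans (at-++ˡ (L.replicate i c) B (subst (k ≤_) (sym (Lₚ.length-replicate i)) k≤) 1≤k) (at-replicate 1≤k k≤)
  B-high : ∀ {k} → 1 ≤ k → at (L.replicate i c ++ B) (i + k) ≡ at B k
  B-high {k} 1≤k = trans (cong (λ z → at (L.replicate i c ++ B) (z + k)) (sym (Lₚ.length-replicate i))) (at-++ʳ (L.replicate i c) B 1≤k)
  1≤l : 1 ≤ l
  1≤l = ℕₚ.≤-trans (s≤s z≤n) k<l
  go : Side i k → Side i l → at (L.replicate i c ++ B) k < at (L.replicate i c ++ B) l
    ⊎ (at (L.replicate i c ++ B) k ≡ at (L.replicate i c ++ B) l × at w k < at w l)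
  go (low k≤) (low l≤) = inj₂ (trans (B-low 1≤k k≤) (sym (B-low 1≤l l≤)) ,
    subst₂ _<_ (sym (w-low 1≤k k≤)) (sym (w-low 1≤l l≤))
      (strictInc⁻ w₁ (proj₁ (∧-true⁻ inc)) 1≤k k<l (subst (l ≤_) (sym len₁) l≤)))
  go (low k≤) (high l' 1≤l' refl) = inj₁ (subst₂ _<_ (sym (B-low 1≤k k≤)) (sym (B-high 1≤l'))
    (blockWord-≥ (suc c) is (∈-at⁺ B 1≤l' (subst (l' ≤_) (sym (length-blockWord (suc c) is)) (ℕₚ.+-cancelˡ-≤ i _ _ l≤)))))
  go (high k' 1≤k' refl) (low l≤i) = ⊥-elim (ℕₚ.<⇒≱ k<l (ℕₚ.≤-trans l≤i (ℕₚ.m≤m+n i k')))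
  go (high k' 1≤k' refl) (high l' 1≤l' refl)
    with blocksInc⁻ (suc c) is w₂ len₂ (proj₂ (∧-true⁻ {strictIncᵇ w₁} inc)) 1≤k' (ℕₚ.+-cancelˡ-< i _ _ k<l) (ℕₚ.+-cancelˡ-≤ i _ _ l≤)
  ... | inj₁ lt = inj₁ (subst₂ _<_ (sym (B-high 1≤k')) (sym (B-high 1≤l')) lt)
  ... | inj₂ (eq , lt) = inj₂ (trans (B-high 1≤k') (trans eq (sym (B-high 1≤l'))) ,
    subst₂ _<_ (sym (w-high 1≤k')) (sym (w-high 1≤l')) lt)

-- The indices `y` and `x` are the letters just read in the coarse and the fine word. Inside a block
-- the fine letter must grow; a new block raises the coarse letter by one and leaves the fine letter
-- free.
data Chain : ℕ → ℕ → Word → Word → Set where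
  end : ∀ {y x} → Chain y x [] []
  same : ∀ {y x x' Y X} → x < x' → Chain y x' Y X → Chain y x (y ∷ Y) (x' ∷ X)
  next : ∀ {y x x' Y X} → Chain (suc y) x' Y X → Chain y x (suc y ∷ Y) (x' ∷ X)

-- The current block is returned with size `suc i`, containing the letter just read: `same`
-- lengthens it, `next` puts a new block of size 1 before it.
chain⇒blocks : ∀ {y x Y X} → Chain y x Y X → ∃ λ i → ∃ λ is →
  All (1 ≤_) is × blockWordFrom y (suc i ∷ is) ≡ y ∷ Y × blocksIncᵇ (suc i ∷ is) (x ∷ X) ≡ true
chain⇒blocks end = 0 , [] , [] , refl , refl
chain⇒blocks {y} {x} (same {x' = x'} x<x' C) with chain⇒blocks C
... | i , is , pos , eq , inc = suc i , is , pos , cong (y ∷_) eq ,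
  ∧-true⁺ (∧-true⁺ (<ᵇ-true⁺ x<x') (proj₁ (∧-true⁻ inc))) (proj₂ (∧-true⁻ inc))
chain⇒blocks {y} (next C) with chain⇒blocks C
... | i , is , pos , eq , inc = 0 , suc i ∷ is , s≤s z≤n ∷ pos , cong (y ∷_) eq , inc

-- What a unit step of the packed word may do to the coarse and fine letters; the comparison of all
-- positions reduces to consecutive ones.
Adjacent : Word → Word → Set
Adjacent Y X = ∀ k → 1 ≤ k → suc k ≤ L.length Y →
  (at Y (suc k) ≡ at Y k × at X k < at X (suc k)) ⊎ at Y (suc k) ≡ suc (at Y k)

adjacent⇒chain : ∀ y x Y X → L.length Y ≡ L.length X → Adjacent (y ∷ Y) (x ∷ X) → Chain y x Y X
adjacent⇒chain y x [] [] _ _ = end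
adjacent⇒chain y x (y' ∷ Y) (x' ∷ X) len adj with adj 1 (s≤s z≤n) (s≤s (s≤s z≤n))
  | adjacent⇒chain y' x' Y X (ℕₚ.suc-injective len) (λ { (suc k) 1≤k k≤ → adj (suc (suc k)) (s≤s z≤n) (s≤s k≤) })
... | inj₁ (refl , lt) | C = same lt C
... | inj₂ refl | C = next C

adjacent⇒blocks : ∀ Y X → L.length Y ≡ L.length X → Adjacent Y X → (1 ≤ L.length Y → at Y 1 ≡ 1) →
  ∃ λ is → All (1 ≤_) is × blockWord is ≡ Y × blocksIncᵇ is X ≡ true
adjacent⇒blocks [] [] _ _ _ = [] , [] , refl , refl
adjacent⇒blocks (y ∷ Y) (x ∷ X) len adj start with start (s≤s z≤n)
... | refl = let i , is , pos , eq , inc = chain⇒blocks (adjacent⇒chain 1 x Y X (ℕₚ.suc-injective len) adj)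
             in suc i ∷ is , s≤s z≤n ∷ pos , eq , inc

-- Lexicographic packing

module _ {n : ℕ} (b a : Vec ℕ n) where

  Lex : Fin n → Fin n → Set
  Lex i j = lookup b i < lookup b j ⊎ (lookup b i ≡ lookup b j × lookup a i < lookup a j)

  lex-irrefl : ∀ {i j} → Lex i j → lookup b i ≡ lookup b j → lookup a i ≡ lookup a j → ⊥
  lex-irrefl (inj₁ lt) p q = ℕₚ.<⇒≢ lt p
  lex-irrefl (inj₂ (_ , lt)) p q = ℕₚ.<⇒≢ lt q

  lex-tri : ∀ i j → Lex i j ⊎ Lex j i ⊎ (lookup b i ≡ lookup b j × lookup a i ≡ lookup a j)
  lex-tri i j with ℕₚ.<-cmp (lookup b i) (lookup b j)
  ... | tri< lt _ _ = inj₁ (inj₁ lt)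
  ... | tri> _ _ gt = inj₂ (inj₁ (inj₁ gt))
  ... | tri≈ _ eq _ with ℕₚ.<-cmp (lookup a i) (lookup a j)
  ... | tri< lt _ _ = inj₁ (inj₂ (eq , lt))
  ... | tri≈ _ eq' _ = inj₂ (inj₂ (eq , eq'))
  ... | tri> _ _ gt = inj₂ (inj₁ (inj₂ (sym eq , gt)))

  lex-asym : ∀ {i j} → Lex i j → Lex j i → ⊥
  lex-asym (inj₁ p) (inj₁ q) = ℕₚ.<-asym p q
  lex-asym (inj₁ p) (inj₂ (e , _)) = ℕₚ.<⇒≢ p (sym e)
  lex-asym (inj₂ (e , _)) (inj₁ q) = ℕₚ.<⇒≢ q (sym e)
  lex-asym (inj₂ (_ , p)) (inj₂ (_ , q)) = ℕₚ.<-asym p q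

  record LexPacking (v : Vec ℕ n) : Set where
    field
      packed : Packed (V.toList v)
      to-lex : ∀ {i j} → lookup v i < lookup v j → Lex i j
      from-lex : ∀ {i j} → Lex i j → lookup v i < lookup v j

    v≡⇒ : ∀ i j → lookup v i ≡ lookup v j → lookup b i ≡ lookup b j × lookup a i ≡ lookup a j
    v≡⇒ i j eq with lex-tri i j
    ... | inj₁ l = ⊥-elim (ℕₚ.<⇒≢ (from-lex l) eq)
    ... | inj₂ (inj₁ l) = ⊥-elim (ℕₚ.<⇒≢ (from-lex l) (sym eq))
    ... | inj₂ (inj₂ e) = e

    ⇒v≡ : ∀ i j → lookup b i ≡ lookup b j → lookup a i ≡ lookup a j → lookup v i ≡ lookup v j
    ⇒v≡ i j p q = ℕₚ.≤-antisym (ℕₚ.≮⇒≥ λ lt → lex-irrefl (to-lex lt) (sym p) (sym q)) (ℕₚ.≮⇒≥ λ lt → lex-irrefl (to-lex lt) p q)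

  lexPacking : (∀ i → 1 ≤ lookup a i) → ∃ LexPacking
  lexPacking pos = packV c , record
    { packed = packV-packed c λ i → subst (1 ≤_) (sym (c-lookup i)) (ℕₚ.≤-trans (pos i) (ℕₚ.m≤n+m _ _))
    ; to-lex = λ {i} {j} lt → reflect (packV-reflects c i j lt)
    ; from-lex = λ {i} {j} l → packV-preserves c i j (enc l)
    }
    where
    -- A radix above every letter of `a`, so that the codes `y * N + x` compare lexicographically.
    N = suc (maxW (V.toList a))
    c = V.zipWith (λ y x → y * N + x) b a
    c-lookup : ∀ i → lookup c i ≡ lookup b i * N + lookup a i
    c-lookup i = Vₚ.lookup-zipWith _ i b a
    enc : ∀ {i j} → Lex i j → lookup c i < lookup c j
    enc {i} {j} (inj₂ (eq , lt)) rewrite c-lookup i | c-lookup j | eq = ℕₚ.+-monoʳ-< (lookup b j * N) lt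
    enc {i} {j} (inj₁ lt) rewrite c-lookup i | c-lookup j = ℕₚ.<-≤-trans
      (subst (lookup b i * N + lookup a i <_) (ℕₚ.+-comm (lookup b i * N) N) (ℕₚ.+-monoʳ-< (lookup b i * N) (s≤s (lookup≤maxW a i))))
      (ℕₚ.≤-trans (ℕₚ.*-monoˡ-≤ N lt) (ℕₚ.m≤m+n _ _))
    -- Trichotomy of the lexicographic order gives the converse from monotonicity of the code,
    -- without decoding.
    reflect : ∀ {i j} → lookup c i < lookup c j → Lex i j
    reflect {i} {j} lt with lex-tri i j
    ... | inj₁ l = l
    ... | inj₂ (inj₁ l) = ⊥-elim (ℕₚ.<-asym lt (enc l))
    ... | inj₂ (inj₂ (p , q)) = ⊥-elim (ℕₚ.<⇒≢ lt (trans (c-lookup i) (trans (cong₂ (λ y x → y * N + x) p q) (sym (c-lookup j)))))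

  lexPacking-unique : ∀ {v v'} → LexPacking v → LexPacking v' → v ≡ v'
  lexPacking-unique P Q = packed-unique (LexPacking.packed P) (LexPacking.packed Q)
    (λ i j → LexPacking.from-lex Q ∘ LexPacking.to-lex P) (λ i j → LexPacking.from-lex P ∘ LexPacking.to-lex Q)

  -- Compatibility of the lexicographic packing, expressed on the pair itself: this is the condition
  -- at which the word side and the topological side meet.
  LexCompat : Rel n → Set
  LexCompat R = ∀ i j → (R i j ≡ true → R j i ≢ true → Lex i j)
                      × (R i j ≡ true → R j i ≡ true → lookup b i ≡ lookup b j × lookup a i ≡ lookup a j)

  lexCompat⇒compat : ∀ {R v} → LexPacking v → LexCompat R → Compat R v
  lexCompat⇒compat P C i j = (λ p q → LexPacking.from-lex P (proj₁ (C i j) p q)) ,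
    (λ p q → let e , e' = proj₂ (C i j) p q in LexPacking.⇒v≡ P i j e e')

  compat⇒lexCompat : ∀ {R v} → LexPacking v → Compat R v → LexCompat R
  compat⇒lexCompat P C i j = (λ p q → LexPacking.to-lex P (proj₁ (C i j) p q)) ,
    (λ p q → LexPacking.v≡⇒ P i j (proj₂ (C i j) p q))

-- Internal coproduct of packed words

module _ {n : ℕ} {v : Vec ℕ n} (P : Packed (V.toList v)) where

  -- The index of one term of `ρW`: `fine` is its first tensor factor, `coarse` its second.
  record Refinement (is : List ℕ) (x : Word) : Set where
    field
      positive : All (1 ≤_) is
      total : sum is ≡ maxW (V.toList v)
      length-x : L.length x ≡ maxW (V.toList v)
      packed-x : Packed x
      blocks : blocksIncᵇ is x ≡ true

    length-B : L.length (blockWord is) ≡ maxW (V.toList v)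
    length-B = trans (length-blockWord 1 is) total

    fine coarse : Vec ℕ n
    fine = V.map (at x) v
    coarse = V.map (at (blockWord is)) v

    fine-packed : Packed (V.toList fine)
    fine-packed = packed-resp (∈-compose⁺ v P x length-x) (∈-compose⁻ v P x length-x) packed-x

    coarse-packed : Packed (V.toList coarse)
    coarse-packed = packed-resp (∈-compose⁺ v P (blockWord is) length-B) (∈-compose⁻ v P (blockWord is) length-B) (blockWord-packed positive)

    -- One direction is `blocksInc⁻`; the other follows because letters are totally ordered and the
    -- lexicographic order is asymmetric.
    is-lexPacking : LexPacking coarse fine v
    is-lexPacking = record { packed = P ; to-lex = λ {i} {j} → to {i} {j} ; from-lex = λ {i} {j} → from {i} {j} }
      where
      to : ∀ {i j} → lookup v i < lookup v j → Lex coarse fine i j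
      to {i} {j} lt rewrite Vₚ.lookup-map i (at x) v | Vₚ.lookup-map j (at x) v
        | Vₚ.lookup-map i (at (blockWord is)) v | Vₚ.lookup-map j (at (blockWord is)) v =
        blocksInc⁻ 1 is x (trans length-x (sym total)) blocks (packed-pos {v = v} P i) lt (subst (lookup v j ≤_) (sym total) (lookup≤maxW v j))
      from : ∀ {i j} → Lex coarse fine i j → lookup v i < lookup v j
      from {i} {j} l = ℕₚ.≰⇒> λ le → case (ℕₚ.m≤n⇒m<n∨m≡n le)
        where
        case : lookup v j < lookup v i ⊎ lookup v j ≡ lookup v i → ⊥
        case (inj₁ lt) = lex-asym coarse fine {i} {j} l (to {j} {i} lt)
        case (inj₂ eq) = lex-irrefl coarse fine {i} {j} l (same-at (blockWord is)) (same-at x)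
          where
          same-at : ∀ w → lookup (V.map (at w) v) i ≡ lookup (V.map (at w) v) j
          same-at w = trans (Vₚ.lookup-map i (at w) v) (trans (cong (at w) (sym eq)) (sym (Vₚ.lookup-map j (at w) v)))

  ∈-ρW⁻ : ∀ {p q} → (p , q) ∈ ρW (V.toList v) → ∃ λ is → ∃ λ x → Σ (Refinement is x) λ r →
    p ≡ V.toList (Refinement.fine r) × q ≡ V.toList (Refinement.coarse r)
  ∈-ρW⁻ h with ∈-concatMap⁻′ (λ is → L.map (λ x → compose x (V.toList v) , compose (blockWord is) (V.toList v)) (QSh is)) (comps (maxW (V.toList v))) h
  ... | is , is∈ , h' with ∈-map⁻ (λ x → compose x (V.toList v) , compose (blockWord is) (V.toList v)) h'
  ... | x , x∈ , refl with compsF⁻ (maxW (V.toList v)) (maxW (V.toList v)) is∈ | ∈-QSh⁻ is x∈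
  ... | pos , tot | len , Px , inc = is , x ,
    record { positive = pos ; total = tot ; length-x = trans len tot ; packed-x = Px ; blocks = inc } ,
    sym (Vₚ.toList-map (at x) v) , sym (Vₚ.toList-map (at (blockWord is)) v)

  ∈-ρW⁺ : ∀ {is x} (r : Refinement is x) → (V.toList (Refinement.fine r) , V.toList (Refinement.coarse r)) ∈ ρW (V.toList v)
  ∈-ρW⁺ {is} {x} r = subst (_∈ ρW (V.toList v)) (cong₂ _,_ (sym (Vₚ.toList-map (at x) v)) (sym (Vₚ.toList-map (at (blockWord is)) v)))
    (∈-concatMap⁺′ (λ is → L.map (λ x → compose x (V.toList v) , compose (blockWord is) (V.toList v)) (QSh is))
      (compsF⁺ _ _ ℕₚ.≤-refl positive total)
      (∈-map⁺ (λ x → compose x (V.toList v) , compose (blockWord is) (V.toList v)) (∈-QSh⁺ is (trans length-x (sym total)) packed-x blocks)))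
    where open Refinement r

  compose-inj : ∀ w w' → L.length w ≡ maxW (V.toList v) → L.length w' ≡ maxW (V.toList v) →
    compose w (V.toList v) ≡ compose w' (V.toList v) → w ≡ w'
  compose-inj w w' len len' eq = compose-injective v P w w' len len' λ i →
    trans (sym (Vₚ.lookup-map i (at w) v)) (trans (cong (λ z → lookup z i) vec-eq) (Vₚ.lookup-map i (at w') v))
    where
    vec-eq : V.map (at w) v ≡ V.map (at w') v
    vec-eq = toList-inj (trans (Vₚ.toList-map (at w) v) (trans eq (sym (Vₚ.toList-map (at w') v))))

  ρW-unique : Unique (ρW (V.toList v))
  ρW-unique = concatMap-unique-by (compsF-unique m m)
    (λ {is} is∈ → map-unique (QSh-unique is) λ {x} {x'} x∈ x'∈ eq →
      compose-inj x x' (len is∈ x∈) (len is∈ x'∈) (cong proj₁ eq))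
    λ {is} {js} is∈ js∈ h h' →
      let x , _ , eq = ∈-map⁻ (λ x → compose x (V.toList v) , compose (blockWord is) (V.toList v)) h
          y , _ , eq' = ∈-map⁻ (λ x → compose x (V.toList v) , compose (blockWord js) (V.toList v)) h'
          pi , ti = compsF⁻ m m is∈
          pj , tj = compsF⁻ m m js∈
      in blockWord-injective 1 pi pj (compose-inj (blockWord is) (blockWord js)
           (trans (length-blockWord 1 is) ti) (trans (length-blockWord 1 js) tj) (cong proj₂ (trans (sym eq) eq')))
    where
    m = maxW (V.toList v)
    len : ∀ {is x} → is ∈ comps m → x ∈ QSh is → L.length x ≡ m
    len {is} is∈ x∈ = trans (proj₁ (∈-QSh⁻ is x∈)) (proj₂ (compsF⁻ m m is∈))

module _ {n : ℕ} {a b v : Vec ℕ n} (Pa : Packed (V.toList a)) (Pb : Packed (V.toList b)) (lp : LexPacking b a v) where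

  open LexPacking lp

  private
    m : ℕ
    m = maxW (V.toList v)
    FX = factor v packed a (λ i j eq → proj₂ (v≡⇒ i j eq))
    FY = factor v packed b (λ i j eq → proj₁ (v≡⇒ i j eq))
    X = proj₁ FX
    Y = proj₁ FY
    lenX : L.length X ≡ m
    lenX = proj₁ (proj₂ FX)
    lenY : L.length Y ≡ m
    lenY = proj₁ (proj₂ FY)
    atX : ∀ {k} i → lookup v i ≡ k → at X k ≡ lookup a i
    atX i refl = proj₂ (proj₂ FX) i
    atY : ∀ {k} i → lookup v i ≡ k → at Y k ≡ lookup b i
    atY i refl = proj₂ (proj₂ FY) i

    -- A letter of b strictly between those of two consecutive values of v would give a value of v between them.
    adj : Adjacent Y X
    adj k 1≤k k< with packed-at {v = v} packed 1≤k (ℕₚ.<⇒≤ (subst (suc k ≤_) lenY k<)) | packed-at {v = v} {suc k} packed (s≤s z≤n) (subst (suc k ≤_) lenY k<)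
    ... | i , vi | j , vj with to-lex {i} {j} (subst₂ _<_ (sym vi) (sym vj) ℕₚ.≤-refl)
    ... | inj₂ (be , al) = inj₁ (trans (atY j vj) (trans (sym be) (sym (atY i vi))) , subst₂ _<_ (sym (atX i vi)) (sym (atX j vj)) al)
    ... | inj₁ bl with ℕₚ.m≤n⇒m<n∨m≡n bl
    ... | inj₂ eq = inj₂ (trans (atY j vj) (trans (sym eq) (cong suc (sym (atY i vi)))))
    ... | inj₁ gap with ∈-toList⁻ b (proj₂ Pb (∈-toList⁺ b j) (s≤s z≤n) bl)
    ... | l , bl≡ = ⊥-elim (ℕₚ.<⇒≱ (subst (_< lookup v l) vi (from-lex {i} {l} (inj₁ (subst (lookup b i <_) (sym bl≡) ℕₚ.≤-refl))))
          (ℕ.s≤s⁻¹ (subst (lookup v l <_) vj (from-lex {l} {j} (inj₁ (subst (_< lookup b j) (sym bl≡) gap))))))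

    -- If b exceeded 1 where `v` equals 1, the packed word b would have a smaller letter elsewhere,
    -- and `v` would take a value below 1 there.
    start : 1 ≤ L.length Y → at Y 1 ≡ 1
    start 1≤ with packed-at {v = v} packed (s≤s z≤n) (subst (1 ≤_) lenY 1≤)
    ... | i , vi with ℕₚ.m≤n⇒m<n∨m≡n (packed-pos {v = b} Pb i)
    ... | inj₂ eq = trans (atY i vi) (sym eq)
    ... | inj₁ lt with ∈-toList⁻ b (proj₂ Pb (∈-toList⁺ b i) (s≤s z≤n) (ℕₚ.<⇒≤ lt))
    ... | l , bl≡ = ⊥-elim (ℕₚ.<⇒≱ (subst (lookup v l <_) vi (from-lex {l} {i} (inj₁ (subst (_< lookup b i) (sym bl≡) lt))))
          (packed-pos {v = v} packed l))

  -- Equal letters of `v` have equal letters in a and in b, so both words factor through `v`; `adj`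
  -- and `start` then identify the factor `Y` of b as a block word on whose blocks the factor `X` of
  -- a increases.
  lexPacking⇒∈ρW : (V.toList a , V.toList b) ∈ ρW (V.toList v)
  lexPacking⇒∈ρW with adjacent⇒blocks Y X (trans lenY (sym lenX)) adj start
  ... | is , pos , B≡ , inc = subst (_∈ ρW (V.toList v)) (cong₂ (λ p q → V.toList p , V.toList q) fine≡ coarse≡) (∈-ρW⁺ packed r)
    where
    fine≡ : V.map (at X) v ≡ a
    fine≡ = vec-ext λ i → trans (Vₚ.lookup-map i (at X) v) (atX i refl)
    coarse≡ : V.map (at (blockWord is)) v ≡ b
    coarse≡ = vec-ext λ i → trans (Vₚ.lookup-map i (at (blockWord is)) v) (trans (cong (λ w → at w (lookup v i)) B≡) (atY i refl))
    r : Refinement packed is X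
    r = record
      { positive = pos
      ; total = trans (sym (length-blockWord 1 is)) (trans (cong L.length B≡) lenY)
      ; length-x = lenX
      ; packed-x = packed-resp
          (λ c∈ → ∈-compose⁻ v packed X lenX (subst (λ z → _ ∈ V.toList z) (sym fine≡) c∈))
          (λ c∈ → subst (λ z → _ ∈ V.toList z) fine≡ (∈-compose⁺ v packed X lenX c∈)) Pa
      ; blocks = inc
      }

module _ {n : ℕ} {T : Fam n} where

  ∈-ρW*⁻ : ∀ {p q} → (p , q) ∈ ρW* (Λ n T) → ∃ λ a → ∃ λ b → p ≡ V.toList a × q ≡ V.toList b ×
    Packed (V.toList a) × Packed (V.toList b) × LexCompat b a (leqᵀ T)
  ∈-ρW*⁻ h with ∈-concatMap⁻′ ρW (Λ n T) h
  ... | _ , w∈ , h' with ∈-Λ⁻ {T = T} w∈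
  ... | v , refl , P , C with ∈-ρW⁻ {v = v} P h'
  ... | is , x , r , p≡ , q≡ = fine , coarse , p≡ , q≡ , fine-packed , coarse-packed , compat⇒lexCompat coarse fine is-lexPacking C
    where open Refinement r

  ∈-ρW*⁺ : ∀ {a b} → Packed (V.toList a) → Packed (V.toList b) → LexCompat b a (leqᵀ T) →
    (V.toList a , V.toList b) ∈ ρW* (Λ n T)
  ∈-ρW*⁺ {a} {b} Pa Pb C = let v , lp = lexPacking b a (packed-pos {v = a} Pa) in
    ∈-concatMap⁺′ ρW (∈-Λ⁺ {T = T} (LexPacking.packed lp) (lexCompat⇒compat b a lp C)) (lexPacking⇒∈ρW {a = a} {b} {v} Pa Pb lp)

  -- The word `v` is recovered from a term as the lexicographic packing of its two factors.
  ρW*-unique : Unique (ρW* (Λ n T))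
  ρW*-unique = concatMap-unique-by (Λ-unique {T = T})
    (λ w∈ → each (∈-Λ⁻ {T = T} w∈)) (λ w∈ w'∈ → apart (∈-Λ⁻ {T = T} w∈) (∈-Λ⁻ {T = T} w'∈))
    where
    each : ∀ {w} → Extension T w → Unique (ρW w)
    each (v , refl , P , _) = ρW-unique {v = v} P
    apart : ∀ {w w' z} → Extension T w → Extension T w' → z ∈ ρW w → z ∈ ρW w' → w ≡ w'
    apart (v , refl , P , _) (v' , refl , P' , _) h h' with ∈-ρW⁻ {v = v} P h | ∈-ρW⁻ {v = v'} P' h'
    ... | _ , _ , r , p≡ , q≡ | _ , _ , r' , p≡' , q≡' = cong V.toList (lexPacking-unique (R.coarse r) (R.fine r) (R.is-lexPacking r)
        (subst₂ (λ b a → LexPacking b a v') (toList-inj (trans (sym q≡') q≡)) (toList-inj (trans (sym p≡') p≡)) (R.is-lexPacking r')))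
      where module R = Refinement

-- Topologies generated by relations

module _ {n : ℕ} where

  Closed : Rel n → Sub n → Set
  Closed R S = ∀ {x y} → (x ∈ˢ S) ≡ true → R x y ≡ true → (y ∈ˢ S) ≡ true

  fromQO⁻ : ∀ {Q S} → fromQO Q S ≡ true → Closed Q S
  fromQO⁻ h {x} {y} x∈ q = ⇒-true⁻ (allᵇ⁻ (allᵇ⁻ h (∈-allFin x)) (∈-allFin y)) (∧-true⁺ x∈ q)

  fromQO⁺ : ∀ {Q S} → Closed Q S → fromQO Q S ≡ true
  fromQO⁺ {Q} {S} cl = allᵇ⁺ (L.allFin n) λ {x} _ → allᵇ⁺ (L.allFin n) λ {y} _ →
    ⇒-true⁺ λ h → let p , q = ∧-true⁻ {x ∈ˢ S} h in cl p q

  fromQO-topology : ∀ Q → IsTopology (fromQO Q)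
  fromQO-topology Q =
    fromQO⁺ {S = ∅ˢ} (λ {x} x∈ _ → ⊥-elim (∉∅ x x∈)) ,
    fromQO⁺ {S = fullˢ} (λ {_} {y} _ _ → Vₚ.lookup-replicate y true) ,
    (λ A B oA oB → fromQO⁺ {S = A ∪ˢ B} λ {x} {y} x∈ q → trans (Vₚ.lookup-zipWith _∨_ y A B)
      (union A B oA oB q (∨-true⁻ (trans (sym (Vₚ.lookup-zipWith _∨_ x A B)) x∈)))) ,
    (λ A B oA oB → fromQO⁺ {S = A ∩ˢ B} λ {x} {y} x∈ q → trans (Vₚ.lookup-zipWith _∧_ y A B)
      (let p , r = ∧-true⁻ {lookup A x} (trans (sym (Vₚ.lookup-zipWith _∧_ x A B)) x∈)
       in ∧-true⁺ (fromQO⁻ {Q} {A} oA p q) (fromQO⁻ {Q} {B} oB r q)))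
    where
    ∉∅ : ∀ x → lookup ∅ˢ x ≢ true
    ∉∅ x h with () ← trans (sym (Vₚ.lookup-replicate x false)) h
    union : ∀ A B → fromQO Q A ≡ true → fromQO Q B ≡ true → ∀ {x y} → Q x y ≡ true →
      lookup A x ≡ true ⊎ lookup B x ≡ true → (lookup A y ∨ lookup B y) ≡ true
    union A B oA oB q (inj₁ p) = ∨-trueˡ (fromQO⁻ {Q} {A} oA p q)
    union A B oA oB q (inj₂ p) = ∨-trueʳ (fromQO⁻ {Q} {B} oB p q)

  leq-fromQO : ∀ Q → (∀ x → Q x x ≡ true) → (∀ {x y z} → Q x y ≡ true → Q y z ≡ true → Q x z ≡ true) →
    ∀ x y → leqᵀ (fromQO Q) x y ≡ Q x y
  leq-fromQO Q rfl trs x y = bool-ext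
    (λ le → trans (sym (lookup-up y)) (leq⁻ {T = fromQO Q} le {up}
      (fromQO⁺ {Q} {up} λ {u} {w} u∈ q → trans (lookup-up w) (trs (trans (sym (lookup-up u)) u∈) q)) (trans (lookup-up x) (rfl x))))
    (λ q → leq⁺ λ {S} oS x∈ → fromQO⁻ {Q} {S} oS x∈ q)
    where
    -- The principal final segment of `x`: the one open set that tests the relation in full.
    up : Sub n
    up = tabulate (Q x)
    lookup-up : ∀ z → lookup up z ≡ Q x z
    lookup-up = Vₚ.lookup∘tabulate (Q x)

  tcIter-⊇ : ∀ k {R Q : Rel n} {x y} → Q x y ≡ true → tcIter k R Q x y ≡ true
  tcIter-⊇ zero q = q
  tcIter-⊇ (suc k) q = tcIter-⊇ k (∨-trueˡ q)

  tcIter-closed : ∀ k {R Q : Rel n} {S} → Closed R S → Closed Q S → Closed (tcIter k R Q) S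
  tcIter-closed zero cR cQ = cQ
  tcIter-closed (suc k) {R} {Q} {S} cR cQ = tcIter-closed k {R} {tcStep R Q} {S} cR step
    where
    step : Closed (tcStep R Q) S
    step {x} {y} x∈ h with ∨-true⁻ {Q x y} h
    ... | inj₁ q = cQ x∈ q
    ... | inj₂ r = let z , _ , p = anyᵇ⁻ (L.allFin n) r
                       q , r' = ∧-true⁻ {Q x z} p in cR (cQ x∈ q) r'

module _ {n : ℕ} {T T' : Fam n} where

  -- Only closed sets matter, so the transitive closure (and the sufficiency of n iterations) never has to be computed.
  quot-open⁻ : ∀ {S} → quot T T' S ≡ true → ∀ {x y} → (x ∈ˢ S) ≡ true →
    leqᵀ T x y ≡ true ⊎ leqᵀ T' y x ≡ true → (y ∈ˢ S) ≡ true
  quot-open⁻ {S} o {x} {y} x∈ (inj₁ le) = fromQO⁻ {S = S} o x∈ (tcIter-⊇ n {y = y} (∨-trueˡ le))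
  quot-open⁻ {S} o {x} {y} x∈ (inj₂ le) = fromQO⁻ {S = S} o x∈ (tcIter-⊇ n {y = y} (∨-trueʳ {leqᵀ T x y} le))

  quot-open⁺ : ∀ {S} → (∀ {x y} → (x ∈ˢ S) ≡ true → leqᵀ T x y ≡ true ⊎ leqᵀ T' y x ≡ true → (y ∈ˢ S) ≡ true) →
    quot T T' S ≡ true
  quot-open⁺ {S} cl = fromQO⁺ {S = S} (tcIter-closed n {S = S} cl' cl')
    where
    cl' : Closed (λ x y → leqᵀ T x y ∨ leqᵀ T' y x) S
    cl' {x} {y} x∈ h = cl x∈ (∨-true⁻ {leqᵀ T x y} h)

  leq-quot-step : ∀ {x y} → leqᵀ T x y ≡ true ⊎ leqᵀ T' y x ≡ true → leqᵀ (quot T T') x y ≡ true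
  leq-quot-step r = leq⁺ λ {S} oS x∈ → quot-open⁻ {S} oS x∈ r

  -- Induction along a path of T/T' without mentioning paths: a property preserved by the generating
  -- steps is the indicator of an open set. It is Boolean valued for that reason.
  leq-quot-elim : (P : Fin n → Bool) →
    (∀ {x y} → P x ≡ true → leqᵀ T x y ≡ true ⊎ leqᵀ T' y x ≡ true → P y ≡ true) →
    ∀ {x y} → leqᵀ (quot T T') x y ≡ true → P x ≡ true → P y ≡ true
  leq-quot-elim P cl {x} {y} le px = trans (sym (look y)) (leq⁻ {T = quot T T'} le {tabulate P}
    (quot-open⁺ {tabulate P} λ {x} {y} x∈ r → trans (look y) (cl (trans (sym (look x)) x∈) r)) (trans (look x) px))
    where
    look : ∀ z → lookup (tabulate P) z ≡ P z
    look = Vₚ.lookup∘tabulate P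

-- Connected components are the classes of T / T.
module _ {n : ℕ} {T : Fam n} where

  -- The generating relation of T/T is symmetric; the induction carries the property of being able
  -- to return to `x`.
  component-sym : ∀ {x y} → leqᵀ (quot T T) x y ≡ true → leqᵀ (quot T T) y x ≡ true
  component-sym {x} le = leq-quot-elim {T = T} {T} (λ z → leqᵀ (quot T T) z x)
    (λ {y} {z} p r → leq-trans {T = quot T T} {z} {y} {x} (leq-quot-step {T = T} {T} (swap r)) p) le (leq-refl {T = quot T T} x)

  component : Fin n → Sub n
  component x = tabulate (leqᵀ (quot T T) x)

  ∈-component : ∀ x y → lookup (component x) y ≡ leqᵀ (quot T T) x y
  ∈-component x = Vₚ.lookup∘tabulate (leqᵀ (quot T T) x)

  -- A set open together with its complement is stable under the quasi-order in both directions, so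
  -- once it contains `x` it contains everything reachable from `x`. If it misses `x`, the argument
  -- applies to the complement.
  component-connected : ∀ x → connectedᵇ (restrict T (component x)) ≡ true
  component-connected x = allᵇ⁺ (allSubs (size Y)) λ {A} _ → ⇒-true⁺ λ h →
    let o , o' = ∧-true⁻ {restrict T Y A} h in clopen A o o'
    where
    Y = component x
    x-pos = emb-surjective Y x (trans (∈-component x x) (leq-refl {T = quot T T} x))
    i₀ = proj₁ x-pos
    full : ∀ A → restrict T Y A ≡ true → restrict T Y (∁ˢ A) ≡ true → lookup A i₀ ≡ true → ∀ i → lookup A i ≡ true
    -- The induction runs over all positions, so `A` is replaced by its image `embed Y A`; a step
    -- starting in this image cannot leave the component.
    full A o o' i₀∈ i = trans (sym (lookup-embed Y A i)) (leq-quot-elim {T = T} {T} (lookup (embed Y A)) step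
        (trans (sym (∈-component x (emb Y i))) (emb-∈ Y i))
        (trans (cong (lookup (embed Y A)) (sym (proj₂ x-pos))) (trans (lookup-embed Y A i₀) i₀∈)))
      where
      step' : ∀ j k → lookup A j ≡ true → leqᵀ T (emb Y j) (emb Y k) ≡ true ⊎ leqᵀ T (emb Y k) (emb Y j) ≡ true → lookup A k ≡ true
      step' j k j∈ (inj₁ le) = leq⁻ {T = restrict T Y} (trans (leq-restrict {T = T} {Y} j k) le) {A} o j∈
      step' j k j∈ (inj₂ le) with lookup A k in eq
      ... | true = refl
      ... | false = ⊥-elim (not-true⁻ (trans (sym (Vₚ.lookup-map j not A))
            (leq⁻ {T = restrict T Y} (trans (leq-restrict {T = T} {Y} k j) le) {∁ˢ A} o' (trans (Vₚ.lookup-map k not A) (cong not eq)))) j∈)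
      step : ∀ {y z} → lookup (embed Y A) y ≡ true → leqᵀ T y z ≡ true ⊎ leqᵀ T z y ≡ true → lookup (embed Y A) z ≡ true
      step {y} {z} y∈ r with emb-surjective Y y y∈Y | emb-surjective Y z z∈Y
        where
        y∈Y : lookup Y y ≡ true
        y∈Y = embed-⊆ Y A y y∈
        z∈Y : lookup Y z ≡ true
        z∈Y = trans (∈-component x z) (leq-trans {T = quot T T} {x} {y} {z} (trans (sym (∈-component x y)) y∈Y) (leq-quot-step {T = T} {T} r))
      ... | j , refl | k , refl = trans (lookup-embed Y A k) (step' j k (trans (sym (lookup-embed Y A j)) y∈) r)
    not-not : ∀ A → ∁ˢ (∁ˢ A) ≡ A
    not-not A = vec-ext λ i → trans (Vₚ.lookup-map i not (∁ˢ A)) (trans (cong not (Vₚ.lookup-map i not A)) (not-involutive (lookup A i)))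
    clopen : ∀ A → restrict T Y A ≡ true → restrict T Y (∁ˢ A) ≡ true → (eqSub A ∅ˢ ∨ eqSub A fullˢ) ≡ true
    clopen A o o' with lookup A i₀ in eq
    ... | true = ∨-trueʳ {eqSub A ∅ˢ} (subst (λ B → eqSub A B ≡ true)
          (vec-ext λ i → trans (full A o o' eq i) (sym (Vₚ.lookup-replicate i true))) (eqSub-refl A))
    ... | false = ∨-trueˡ (subst (λ B → eqSub A B ≡ true)
          (vec-ext λ i → trans (empty i) (sym (Vₚ.lookup-replicate i false))) (eqSub-refl A))
      where
      empty : ∀ i → lookup A i ≡ false
      empty i = trans (sym (not-involutive (lookup A i))) (cong not (trans (sym (Vₚ.lookup-map i not A))
        (full (∁ˢ A) o' (trans (cong (restrict T Y) (not-not A)) o) (trans (Vₚ.lookup-map i₀ not A) (cong not eq)) i)))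

-- Admissible topologies

record Admissible {n : ℕ} (T T' : Fam n) : Set where
  field
    finer : ∀ {Y} → T Y ≡ true → T' Y ≡ true
    connected : ∀ {Y} → connectedᵇ (restrict T' Y) ≡ true → ∀ S → restrict T' Y S ≡ restrict T Y S
    classes : ∀ x y → simᵀ (quot T T') x y ≡ simᵀ (quot T' T') x y

  leq-finer : ∀ {x y} → leqᵀ T' x y ≡ true → leqᵀ T x y ≡ true
  leq-finer le = leq⁺ λ {Y} oY → leq⁻ {T = T'} le {Y} (finer oY)

module _ {n : ℕ} {T T' : Fam n} where

  admissibleᵇ⁻ : admissibleᵇ T T' ≡ true → Admissible T T'
  admissibleᵇ⁻ h with ∧-true⁻ {precᵇ T' T} h
  ... | p , h' with ∧-true⁻ {allᵇ (λ Y → connectedᵇ (restrict T' Y) ⇒ᵇ eqFam (restrict T' Y) (restrict T Y)) (allSubs n)} h'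
  ... | q , r = record
    { finer = λ {Y} → ⇒-true⁻ (allᵇ⁻ p (∈-allSubs Y))
    ; connected = λ {Y} c S → eqB-true⁻ (allᵇ⁻ (⇒-true⁻ (allᵇ⁻ q (∈-allSubs Y)) c) (∈-allSubs S))
    ; classes = λ x y → eqB-true⁻ (allᵇ⁻ (allᵇ⁻ r (∈-allFin x)) (∈-allFin y))
    }

  admissibleᵇ⁺ : Admissible T T' → admissibleᵇ T T' ≡ true
  admissibleᵇ⁺ adm = ∧-true⁺ (allᵇ⁺ (allSubs n) λ {Y} _ → ⇒-true⁺ (finer {Y}))
    (∧-true⁺ (allᵇ⁺ (allSubs n) λ {Y} _ → ⇒-true⁺ λ c → allᵇ⁺ (allSubs (size Y)) λ {S} _ →
        subst (λ z → eqB (restrict T' Y S) z ≡ true) (connected {Y} c S) (eqB-refl (restrict T' Y S)))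
      (allᵇ⁺ (L.allFin n) λ {x} _ → allᵇ⁺ (L.allFin n) λ {y} _ →
        subst (λ z → eqB (simᵀ (quot T T') x y) z ≡ true) (classes x y) (eqB-refl (simᵀ (quot T T') x y))))
    where open Admissible adm

isTopᵇ⁻ : ∀ {n} {T : Fam n} → isTopᵇ T ≡ true → IsTopology T
isTopᵇ⁻ {n} {T} h = let p , h' = ∧-true⁻ {T ∅ˢ} h
                        q , r = ∧-true⁻ {T fullˢ} h'
                        both = λ A B oA oB → ∧-true⁻ {T (A ∪ˢ B)} (⇒-true⁻ (allᵇ⁻ (allᵇ⁻ r (∈-allSubs A)) (∈-allSubs B)) (∧-true⁺ oA oB))
                    in p , q , (λ A B oA oB → proj₁ (both A B oA oB)) , (λ A B oA oB → proj₂ (both A B oA oB))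

isTopᵇ⁺ : ∀ {n} {T : Fam n} → IsTopology T → isTopᵇ T ≡ true
isTopᵇ⁺ {n} {T} (p , q , r , s) = ∧-true⁺ p (∧-true⁺ q (allᵇ⁺ (allSubs n) λ {A} _ → allᵇ⁺ (allSubs n) λ {B} _ →
  ⇒-true⁺ λ h → let a , b = ∧-true⁻ {T A} h in ∧-true⁺ (r A B a b) (s A B a b)))

IsTopology-resp : ∀ {n} {F G : Fam n} → (∀ S → F S ≡ G S) → IsTopology G → IsTopology F
IsTopology-resp F≗G (p , q , r , s) = trans (F≗G _) p , trans (F≗G _) q ,
  (λ A B a b → trans (F≗G _) (r A B (trans (sym (F≗G A)) a) (trans (sym (F≗G B)) b))) ,
  (λ A B a b → trans (F≗G _) (s A B (trans (sym (F≗G A)) a) (trans (sym (F≗G B)) b)))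

-- The topology cut out by the levels of a word

-- A specification instead of a formula, because the representative found in `allFams n` is known
-- only up to pointwise equality.
record LevelTopology {n : ℕ} (T : Fam n) (b : Vec ℕ n) (F : Fam n) : Set where
  field
    topology : IsTopology F
    leq⇒ : ∀ {x y} → leqᵀ F x y ≡ true → leqᵀ T x y ≡ true × lookup b x ≡ lookup b y
    ⇒leq : ∀ {x y} → leqᵀ T x y ≡ true → lookup b x ≡ lookup b y → leqᵀ F x y ≡ true

module _ {n : ℕ} {T : Fam n} {b : Vec ℕ n} where

  -- The specification fixes the quasi-order, and a topology on a finite set is determined by its
  -- quasi-order.
  levelTopology-unique : ∀ {F G} → LevelTopology T b F → LevelTopology T b G → ∀ S → F S ≡ G S
  levelTopology-unique F G S = bool-ext (include F G S) (include G F S)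
    where
    include : ∀ {F G} → LevelTopology T b F → LevelTopology T b G → ∀ S → F S ≡ true → G S ≡ true
    include {F} {G} LF LG S oS = upClosed⇒open (LevelTopology.topology LG) λ x∈ le →
      let p , q = LevelTopology.leq⇒ LG le in leq⁻ {T = F} (LevelTopology.⇒leq LF p q) {S} oS x∈

  levelTopology-exists : ∃ λ F → F ∈ allFams n × LevelTopology T b F
  levelTopology-exists = F , F∈ , record
    { topology = IsTopology-resp F≗ (fromQO-topology Q)
    ; leq⇒ = λ {x} {y} le → let p , q = ∧-true⁻ {leqᵀ T x y} (trans (sym (leq-F x y)) le) in p , ≡ᵇ-true⁻ q
    ; ⇒leq = λ {x} {y} le eq → trans (leq-F x y) (∧-true⁺ le (≡ᵇ-true⁺ eq))
    }
    where
    Q : Rel n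
    Q x y = leqᵀ T x y ∧ (lookup b x ≡ᵇ lookup b y)
    enumerated = allFams-complete (fromQO Q)
    F = proj₁ enumerated
    F∈ = proj₁ (proj₂ enumerated)
    F≗ = proj₂ (proj₂ enumerated)
    Q-trans : ∀ {x y z} → Q x y ≡ true → Q y z ≡ true → Q x z ≡ true
    Q-trans {x} {y} {z} p q = let p₁ , p₂ = ∧-true⁻ {leqᵀ T x y} p
                                  q₁ , q₂ = ∧-true⁻ {leqᵀ T y z} q
      in ∧-true⁺ (leq-trans {T = T} {x} {y} {z} p₁ q₁) (≡ᵇ-true⁺ (trans (≡ᵇ-true⁻ {lookup b x} p₂) (≡ᵇ-true⁻ {lookup b y} q₂)))
    leq-F : ∀ x y → leqᵀ F x y ≡ Q x y
    leq-F x y = trans (leq-cong F≗ x y) (leq-fromQO Q (λ x → ∧-true⁺ (leq-refl {T = T} x) (≡ᵇ-true⁺ {lookup b x} refl)) (λ {x} {y} {z} → Q-trans {x} {y} {z}) x y)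

module _ {n : ℕ} {T F : Fam n} (adm : Admissible T F) {b : Vec ℕ n} (C : Compat (leqᵀ (quot T F)) b) where

  open Admissible adm

  -- A relation of `F` holds both ways in `quot T F`, so b agrees on it. Conversely, a relation of
  -- `T` on which b agrees cannot be strict in `quot T F`; its ends are thus equivalent there,
  -- `classes` puts them into one component of `F`, and on this connected set `F` and `T` coincide.
  compat⇒levelTopology : IsTopology F → LevelTopology T b F
  compat⇒levelTopology topF = record { topology = topF ; leq⇒ = λ {x} {y} → to {x} {y} ; ⇒leq = λ {x} {y} → from {x} {y} }
    where
    to : ∀ {x y} → leqᵀ F x y ≡ true → leqᵀ T x y ≡ true × lookup b x ≡ lookup b y
    to {x} {y} le = leq-finer le ,
      proj₂ (C x y) (leq-quot-step {T = T} {F} (inj₁ (leq-finer le))) (leq-quot-step {T = T} {F} (inj₂ le))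
    from : ∀ {x y} → leqᵀ T x y ≡ true → lookup b x ≡ lookup b y → leqᵀ F x y ≡ true
    from {x} {y} le eq with leqᵀ (quot T F) y x ≟ᴮ true
    ... | no ¬yx = ⊥-elim (ℕₚ.<⇒≢ (proj₁ (C x y) (leq-quot-step {T = T} {F} (inj₁ le)) ¬yx) eq)
    ... | yes yx = same-component (emb-surjective Y x (trans (∈-component {T = F} x x) (leq-refl {T = quot F F} x)))
                                  (emb-surjective Y y (trans (∈-component {T = F} x y) x~y))
      where
      Y = component {T = F} x
      x~y : leqᵀ (quot F F) x y ≡ true
      x~y = proj₁ (∧-true⁻ {leqᵀ (quot F F) x y} (trans (sym (classes x y)) (∧-true⁺ (leq-quot-step {T = T} {F} (inj₁ le)) yx)))
      same-component : (∃ λ i → emb Y i ≡ x) → (∃ λ j → emb Y j ≡ y) → leqᵀ F x y ≡ true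
      same-component (i , ei) (j , ej) = subst₂ (λ u w → leqᵀ F u w ≡ true) ei ej
        (trans (sym (leq-restrict {T = F} {Y} i j))
          (trans (leq-cong (connected {Y} (component-connected {T = F} x)) i j)
            (trans (leq-restrict {T = T} {Y} i j) (subst₂ (λ u w → leqᵀ T u w ≡ true) (sym ei) (sym ej) le))))

  -- b is weakly increasing along `T`; where it stays constant the relation already belongs to `F`,
  -- and `a` decides.
  compat⇒lexCompat-T : IsTopology F → ∀ {a} → Compat (leqᵀ F) a → LexCompat b a (leqᵀ T)
  compat⇒lexCompat-T topF {a} D i j = strict , equal
    where
    open LevelTopology (compat⇒levelTopology topF)
    strict : leqᵀ T i j ≡ true → leqᵀ T j i ≢ true → Lex b a i j
    strict p q with ℕₚ.m≤n⇒m<n∨m≡n (compat-≤ {v = b} C {i} {j} (leq-quot-step {T = T} {F} (inj₁ p)))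
    ... | inj₁ lt = inj₁ lt
    ... | inj₂ eq = inj₂ (eq , proj₁ (D i j) (⇒leq p eq) (q ∘ leq-finer))
    equal : leqᵀ T i j ≡ true → leqᵀ T j i ≡ true → lookup b i ≡ lookup b j × lookup a i ≡ lookup a j
    equal p q = eq , proj₂ (D i j) (⇒leq p eq) (⇒leq q (sym eq))
      where
      eq = proj₂ (C i j) (leq-quot-step {T = T} {F} (inj₁ p)) (leq-quot-step {T = T} {F} (inj₁ q))

module _ {n : ℕ} {T F : Fam n} (top : IsTopology T) {b a : Vec ℕ n} (lev : LevelTopology T b F)
  (C : LexCompat b a (leqᵀ T)) where

  open LevelTopology lev

  private
    b-mono : ∀ {x y} → leqᵀ T x y ≡ true → lookup b x ≤ lookup b y
    b-mono {x} {y} le with leqᵀ T y x ≟ᴮ true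
    ... | yes ge = ℕₚ.≤-reflexive (proj₁ (proj₂ (C x y) le ge))
    ... | no ¬ge with proj₁ (C x y) le ¬ge
    ... | inj₁ lt = ℕₚ.<⇒≤ lt
    ... | inj₂ (eq , _) = ℕₚ.≤-reflexive eq

  -- Along a path of `quot T F` the letter of b never drops. If it ends where it began, every step
  -- stayed in one level, hence was a relation of `F` or a reversed one.
  quot-level : ∀ {x y} → leqᵀ (quot T F) x y ≡ true →
    lookup b x < lookup b y ⊎ (lookup b x ≡ lookup b y × leqᵀ (quot F F) x y ≡ true)
  quot-level {x} {y} le = read (∨-true⁻ {lookup b x <ᵇ lookup b y} (leq-quot-elim {T = T} {F} P step le
      (∨-trueʳ {lookup b x <ᵇ lookup b x} (∧-true⁺ (≡ᵇ-true⁺ {lookup b x} refl) (leq-refl {T = quot F F} x)))))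
    where
    P : Fin n → Bool
    P z = (lookup b x <ᵇ lookup b z) ∨ ((lookup b x ≡ᵇ lookup b z) ∧ leqᵀ (quot F F) x z)
    read : ∀ {z} → (lookup b x <ᵇ lookup b z) ≡ true ⊎ ((lookup b x ≡ᵇ lookup b z) ∧ leqᵀ (quot F F) x z) ≡ true →
      lookup b x < lookup b z ⊎ (lookup b x ≡ lookup b z × leqᵀ (quot F F) x z ≡ true)
    read (inj₁ lt) = inj₁ (<ᵇ-true⁻ lt)
    read {z} (inj₂ h) = let p , q = ∧-true⁻ {lookup b x ≡ᵇ lookup b z} h in inj₂ (≡ᵇ-true⁻ p , q)
    write : ∀ {z} → lookup b x < lookup b z ⊎ (lookup b x ≡ lookup b z × leqᵀ (quot F F) x z ≡ true) → P z ≡ true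
    write (inj₁ lt) = ∨-trueˡ (<ᵇ-true⁺ lt)
    write {z} (inj₂ (p , q)) = ∨-trueʳ {lookup b x <ᵇ lookup b z} (∧-true⁺ (≡ᵇ-true⁺ p) q)
    step : ∀ {y z} → P y ≡ true → leqᵀ T y z ≡ true ⊎ leqᵀ F z y ≡ true → P z ≡ true
    step {y} {z} h r = write {z} (go (read {y} (∨-true⁻ {lookup b x <ᵇ lookup b y} h)) r)
      where
      via : leqᵀ (quot F F) x y ≡ true → leqᵀ F y z ≡ true ⊎ leqᵀ F z y ≡ true → leqᵀ (quot F F) x z ≡ true
      via p s = leq-trans {T = quot F F} {x} {y} {z} p (leq-quot-step {T = F} {F} s)
      go : lookup b x < lookup b y ⊎ (lookup b x ≡ lookup b y × leqᵀ (quot F F) x y ≡ true) →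
        leqᵀ T y z ≡ true ⊎ leqᵀ F z y ≡ true → lookup b x < lookup b z ⊎ (lookup b x ≡ lookup b z × leqᵀ (quot F F) x z ≡ true)
      go (inj₁ lt) (inj₁ le) = inj₁ (ℕₚ.<-≤-trans lt (b-mono le))
      go (inj₁ lt) (inj₂ le) = inj₁ (subst (lookup b x <_) (sym (proj₂ (leq⇒ le))) lt)
      go (inj₂ (eq , p)) (inj₂ le) = inj₂ (trans eq (sym (proj₂ (leq⇒ le))) , via p (inj₂ le))
      go (inj₂ (eq , p)) (inj₁ le) with ℕₚ.m≤n⇒m<n∨m≡n (b-mono le)
      ... | inj₁ lt = inj₁ (subst (_< lookup b z) (sym eq) lt)
      ... | inj₂ eq' = inj₂ (trans eq eq' , via p (inj₁ (⇒leq le eq')))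

  component⇒quot : ∀ {x y} → leqᵀ (quot F F) x y ≡ true → leqᵀ (quot T F) x y ≡ true
  component⇒quot {x} le = leq-quot-elim {T = F} {F} (leqᵀ (quot T F) x)
    (λ {y} {z} p r → leq-trans {T = quot T F} {x} {y} {z} p (leq-quot-step {T = T} {F} (widen r))) le (leq-refl {T = quot T F} x)
    where
    widen : ∀ {y z} → leqᵀ F y z ≡ true ⊎ leqᵀ F z y ≡ true → leqᵀ T y z ≡ true ⊎ leqᵀ F z y ≡ true
    widen (inj₁ p) = inj₁ (proj₁ (leq⇒ p))
    widen (inj₂ p) = inj₂ p

  level-finer : ∀ {Y} → T Y ≡ true → F Y ≡ true
  level-finer {Y} oY = upClosed⇒open topology λ x∈ le → leq⁻ {T = T} (proj₁ (leq⇒ le)) {Y} oY x∈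

  -- The level of b through a point of `Y` and its complement are both open in `F`, and the trace of
  -- this level on `Y` is not empty.
  connected⇒level : ∀ {Y} → connectedᵇ (restrict F Y) ≡ true → ∀ i j → lookup b (emb Y i) ≡ lookup b (emb Y j)
  connected⇒level {Y} con i j = decide (∨-true⁻ {eqSub A ∅ˢ} (⇒-true⁻ (allᵇ⁻ con (∈-allSubs A))
      (∧-true⁺ (restrict⁺ {T = F} {Y} {W} W-open) (subst (λ B → restrict F Y B ≡ true) complement (restrict⁺ {T = F} {Y} {∁ˢ W} ∁W-open)))))
    where
    W : Sub n
    W = tabulate λ z → lookup b (emb Y i) ≡ᵇ lookup b z
    look : ∀ z → lookup W z ≡ (lookup b (emb Y i) ≡ᵇ lookup b z)
    look = Vₚ.lookup∘tabulate _
    A = select Y W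
    A-look : ∀ k → lookup A k ≡ (lookup b (emb Y i) ≡ᵇ lookup b (emb Y k))
    A-look k = trans (lookup-select Y W k) (look (emb Y k))
    level : ∀ {x y} → leqᵀ F x y ≡ true → lookup W x ≡ lookup W y
    level {x} {y} le = trans (look x) (trans (cong (lookup b (emb Y i) ≡ᵇ_) (proj₂ (leq⇒ le))) (sym (look y)))
    W-open : F W ≡ true
    W-open = upClosed⇒open topology λ x∈ le → trans (sym (level le)) x∈
    ∁W-open : F (∁ˢ W) ≡ true
    ∁W-open = upClosed⇒open topology λ {x} {y} x∈ le →
      trans (Vₚ.lookup-map y not W) (trans (cong not (sym (level le))) (trans (sym (Vₚ.lookup-map x not W)) x∈))
    complement : select Y (∁ˢ W) ≡ ∁ˢ A
    complement = vec-ext λ k → trans (lookup-select Y (∁ˢ W) k) (trans (Vₚ.lookup-map (emb Y k) not W)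
      (trans (cong not (sym (lookup-select Y W k))) (sym (Vₚ.lookup-map k not A))))
    decide : eqSub A ∅ˢ ≡ true ⊎ eqSub A fullˢ ≡ true → lookup b (emb Y i) ≡ lookup b (emb Y j)
    decide (inj₁ h) with () ← trans (sym (trans (A-look i) (≡ᵇ-true⁺ {lookup b (emb Y i)} refl)))
      (trans (cong (λ z → lookup z i) (eqSub⁻ {A = A} {∅ˢ} h)) (Vₚ.lookup-replicate i false))
    decide (inj₂ h) = ≡ᵇ-true⁻ (trans (sym (A-look j)) (trans (cong (λ z → lookup z j) (eqSub⁻ {A = A} {fullˢ} h)) (Vₚ.lookup-replicate j true)))

  level-admissible : Admissible T F
  level-admissible = record { finer = level-finer ; connected = connected ; classes = classes }
    where
    connected : ∀ {Y} → connectedᵇ (restrict F Y) ≡ true → ∀ S → restrict F Y S ≡ restrict T Y S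
    connected {Y} con S = bool-ext (coarsen ∘ restrict⁻ {T = F} {Y})
      (λ h → refine (restrict⁻ {T = T} {Y} h))
      where
      refine : (∃ λ W → T W ≡ true × S ≡ select Y W) → restrict F Y S ≡ true
      refine (W , oW , refl) = restrict⁺ {T = F} {Y} {W} (level-finer oW)
      coarsen : (∃ λ W → F W ≡ true × S ≡ select Y W) → restrict T Y S ≡ true
      coarsen (W , oW , refl) = subst (λ Z → restrict T Y Z ≡ true) agree (restrict⁺ {T = T} {Y} {U} U-open)
        where
        reach : Fin n → Fin (size Y) → Bool
        reach z j = lookup W (emb Y j) ∧ leqᵀ T (emb Y j) z
        -- The final segment of `T` generated by the points of `W` in `Y`. It acquires no further
        -- point of `Y`: b is constant on `Y`, so relations of `T` between its points are relations
        -- of `F`, under which `W` is stable.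
        U : Sub n
        U = tabulate λ z → anyᵇ (reach z) (L.allFin (size Y))
        look : ∀ z → lookup U z ≡ anyᵇ (reach z) (L.allFin (size Y))
        look = Vₚ.lookup∘tabulate _
        U⁻ : ∀ {z} → lookup U z ≡ true → ∃ λ j → lookup W (emb Y j) ≡ true × leqᵀ T (emb Y j) z ≡ true
        U⁻ {z} h = let j , _ , p = anyᵇ⁻ (L.allFin (size Y)) (trans (sym (look z)) h) in j , ∧-true⁻ p
        U⁺ : ∀ {z} j → lookup W (emb Y j) ≡ true → leqᵀ T (emb Y j) z ≡ true → lookup U z ≡ true
        U⁺ {z} j p q = trans (look z) (anyᵇ⁺ (∈-allFin j) (∧-true⁺ p q))
        U-open : T U ≡ true
        U-open = upClosed⇒open top λ {x} {y} x∈ le → let j , p , q = U⁻ x∈ in U⁺ j p (leq-trans {T = T} {emb Y j} {x} {y} q le)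
        agree : select Y U ≡ select Y W
        agree = vec-ext λ i → trans (lookup-select Y U i) (trans (bool-ext
          (λ h → let j , p , q = U⁻ h in leq⁻ {T = F} (⇒leq q (connected⇒level {Y} con j i)) {W} oW p)
          (λ h → U⁺ i h (leq-refl {T = T} (emb Y i)))) (sym (lookup-select Y W i)))
    -- If `x` and `y` reach each other, b cannot rise in both directions, so one of the two
    -- relations lies in a component of `F`, where symmetry gives the other.
    classes : ∀ x y → simᵀ (quot T F) x y ≡ simᵀ (quot F F) x y
    classes x y = bool-ext
      (λ h → let p , q = ∧-true⁻ {leqᵀ (quot T F) x y} h in both (quot-level {x} {y} p) (quot-level {y} {x} q))
      (λ h → let p , q = ∧-true⁻ {leqᵀ (quot F F) x y} h in ∧-true⁺ (component⇒quot {x} {y} p) (component⇒quot {y} {x} q))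
      where
      both : lookup b x < lookup b y ⊎ (lookup b x ≡ lookup b y × leqᵀ (quot F F) x y ≡ true) →
        lookup b y < lookup b x ⊎ (lookup b y ≡ lookup b x × leqᵀ (quot F F) y x ≡ true) → simᵀ (quot F F) x y ≡ true
      both (inj₂ (_ , p)) _ = ∧-true⁺ p (component-sym {T = F} {x} {y} p)
      both (inj₁ _) (inj₂ (_ , q)) = ∧-true⁺ (component-sym {T = F} {y} {x} q) q
      both (inj₁ lt) (inj₁ gt) = ⊥-elim (ℕₚ.<-asym lt gt)

  -- A relation of `quot T F` that does not raise b lies in a component of `F` and is therefore
  -- reversible; a strict one must raise b.
  level-compat-coarse : Compat (leqᵀ (quot T F)) b
  level-compat-coarse i j = (λ p ¬q → strict (quot-level {i} {j} p) ¬q) , (λ p q → equal (quot-level {i} {j} p) (quot-level {j} {i} q))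
    where
    strict : lookup b i < lookup b j ⊎ (lookup b i ≡ lookup b j × leqᵀ (quot F F) i j ≡ true) →
      leqᵀ (quot T F) j i ≢ true → lookup b i < lookup b j
    strict (inj₁ lt) _ = lt
    strict (inj₂ (_ , p)) ¬q = ⊥-elim (¬q (component⇒quot {j} {i} (component-sym {T = F} {i} {j} p)))
    equal : lookup b i < lookup b j ⊎ (lookup b i ≡ lookup b j × leqᵀ (quot F F) i j ≡ true) →
      lookup b j < lookup b i ⊎ (lookup b j ≡ lookup b i × leqᵀ (quot F F) j i ≡ true) → lookup b i ≡ lookup b j
    equal (inj₂ (eq , _)) _ = eq
    equal (inj₁ _) (inj₂ (eq , _)) = sym eq
    equal (inj₁ lt) (inj₁ gt) = ⊥-elim (ℕₚ.<-asym lt gt)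

  level-compat-fine : Compat (leqᵀ F) a
  level-compat-fine i j = strict , (λ p q → proj₂ (proj₂ (C i j) (proj₁ (leq⇒ p)) (proj₁ (leq⇒ q))))
    where
    strict : leqᵀ F i j ≡ true → leqᵀ F j i ≢ true → lookup a i < lookup a j
    strict p ¬q with leq⇒ p
    ... | le , eq with proj₁ (C i j) le (λ ge → ¬q (⇒leq ge (sym eq)))
    ... | inj₁ lt = ⊥-elim (ℕₚ.<⇒≢ lt eq)
    ... | inj₂ (_ , lt) = lt

-- Internal coproduct of topologies

module _ {n : ℕ} (T : Fam n) where

  admissibles : List (Fam n)
  admissibles = filterᵇ (λ F → isTopᵇ F ∧ admissibleᵇ T F) (allFams n)

  factors : Fam n → List (Word × Word)
  factors F = pairs (Λ n F) (Λ n (quot T F))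

  ΛΛ-factors : ∀ Fs → ΛΛ (L.map (λ F → ((n , F) , (n , quot T F))) Fs) ≡ concatMap factors Fs
  ΛΛ-factors [] = refl
  ΛΛ-factors (F ∷ Fs) = cong (factors F ++_) (ΛΛ-factors Fs)

  ∈-admissibles⁻ : ∀ {F} → F ∈ admissibles → IsTopology F × Admissible T F
  ∈-admissibles⁻ {F} F∈ = let _ , h = ∈-filterᵇ⁻ {p = λ F → isTopᵇ F ∧ admissibleᵇ T F} {allFams n} F∈
                              p , q = ∧-true⁻ {isTopᵇ F} h in isTopᵇ⁻ {T = F} p , admissibleᵇ⁻ q

  ∈-factors⁻ : ∀ {F p q} → (p , q) ∈ factors F → ∃ λ a → ∃ λ b → p ≡ V.toList a × q ≡ V.toList b ×
    Packed (V.toList a) × Packed (V.toList b) × Compat (leqᵀ F) a × Compat (leqᵀ (quot T F)) b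
  ∈-factors⁻ {F} h with ∈-pairs⁻ (Λ n F) (Λ n (quot T F)) h
  ... | p∈ , q∈ with ∈-Λ⁻ {T = F} p∈ | ∈-Λ⁻ {T = quot T F} q∈
  ... | a , p≡ , Pa , Ca | b , q≡ , Pb , Cb = a , b , p≡ , q≡ , Pa , Pb , Ca , Cb

  -- The second word of a term is compatible with the quotient and hence forces the topology, so
  -- different admissible topologies share no term.
  factors-unique : Unique (concatMap factors admissibles)
  factors-unique = concatMap-unique (filterᵇ-AllPairs allFams-distinct)
    (λ {F} _ → pairs-unique (Λ-unique {T = F}) (Λ-unique {T = quot T F}))
    λ {F} {G} F∈ G∈ F≢G h h' → F≢G (agree F∈ G∈ (∈-factors⁻ {F} h) (∈-factors⁻ {G} h'))
    where
    agree : ∀ {F G p q} → F ∈ admissibles → G ∈ admissibles →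
      (∃ λ a → ∃ λ b → p ≡ V.toList a × q ≡ V.toList b × Packed (V.toList a) × Packed (V.toList b) × Compat (leqᵀ F) a × Compat (leqᵀ (quot T F)) b) →
      (∃ λ a → ∃ λ b → p ≡ V.toList a × q ≡ V.toList b × Packed (V.toList a) × Packed (V.toList b) × Compat (leqᵀ G) a × Compat (leqᵀ (quot T G)) b) →
      ∀ S → F S ≡ G S
    agree {F} {G} F∈ G∈ (_ , b , _ , q≡ , _ , _ , _ , C) (_ , b' , _ , q≡' , _ , _ , _ , C') with toList-inj {u = b} {b'} (trans (sym q≡) q≡')
    ... | refl = levelTopology-unique
      (compat⇒levelTopology (proj₂ (∈-admissibles⁻ {F} F∈)) {b} C (proj₁ (∈-admissibles⁻ {F} F∈)))
      (compat⇒levelTopology (proj₂ (∈-admissibles⁻ {G} G∈)) {b} C' (proj₁ (∈-admissibles⁻ {G} G∈)))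

  internal-⊆ : ∀ {z} → z ∈ concatMap factors admissibles → z ∈ ρW* (Λ n T)
  internal-⊆ {z} h with ∈-concatMap⁻′ factors admissibles h
  ... | F , F∈ , h' with ∈-factors⁻ {F} h' | ∈-admissibles⁻ {F} F∈
  ... | a , b , refl , refl , Pa , Pb , Ca , Cb | topF , adm =
    ∈-ρW*⁺ {T = T} {a} {b} Pa Pb (compat⇒lexCompat-T adm {b} Cb topF {a} Ca)

  internal-⊇ : IsTopology T → ∀ {z} → z ∈ ρW* (Λ n T) → z ∈ concatMap factors admissibles
  internal-⊇ top h with ∈-ρW*⁻ {T = T} h
  ... | a , b , refl , refl , Pa , Pb , C with levelTopology-exists {T = T} {b}
  ... | F , F∈ , lev = ∈-concatMap⁺′ factors
    (∈-filterᵇ⁺ {p = λ F → isTopᵇ F ∧ admissibleᵇ T F} F∈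
      (∧-true⁺ (isTopᵇ⁺ (LevelTopology.topology lev)) (admissibleᵇ⁺ (level-admissible top {b} {a} lev C))))
    (∈-pairs⁺ (∈-Λ⁺ {T = F} Pa (level-compat-fine top {b} {a} lev C)) (∈-Λ⁺ {T = quot T F} Pb (level-compat-coarse top {b} {a} lev C)))

  Λ-internal : IsTopology T → ΛΛ (ΓT T) ↭ ρW* (Λ n T)
  Λ-internal top = subst (_↭ ρW* (Λ n T)) (sym (ΛΛ-factors admissibles))
    (unique-↭ factors-unique (ρW*-unique {T = T}) internal-⊆ (internal-⊇ top))

-- Unit, counit, product and coproduct suffice for the Hopf algebra claim: a bialgebra morphism
-- between Hopf algebras commutes with the antipodes.
theorem5p7 : ((T : Fam 0) → IsTopology T → Λ 0 T ↭ ([] ∷ []))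
    × ((n : ℕ) (T : Fam n) → IsTopology T → εW (Λ n T) ≡ εT n)
    × ((n m : ℕ) (T : Fam n) (T' : Fam m) → IsTopology T → IsTopology T' →
    Λ (n + m) (prodT T T') ↭ (Λ n T *W Λ m T'))
    × ((n : ℕ) (T : Fam n) → IsTopology T → ΔW* (Λ n T) ↭ ΛΛ (ΔT T))
    × ((n : ℕ) (T : Fam n) → IsTopology T → ΛΛ (ΓT T) ↭ ρW* (Λ n T))
theorem5p7 =
  (λ _ _ → ↭-refl) ,
  (λ n T _ → εW-Λ n T) ,
  (λ n m T T' → Λ-product) ,
  (λ n T → Λ-coproduct T) ,
  (λ n T → Λ-internal T)
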